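{- Let $S$ be a $3$-connected isotropic system with at least $5$ vertices and let $N$ be the set of non-essential vertices of $S$. If $S$ is not cyclic, then the edge set of $H(S)$ is the union of the edge sets of all $N$-ears, $N$-triangles, $N$-windmills, $N$-tripods, and $N$-tables in $H(S)$.
   Context: Let $K=\{0,\alpha,\beta,\gamma\}$ be the $2$-dimensional vector space over $\mathrm{GF}(2)$ with bilinear form $\langle x,y\rangle=1$ iff $0\ne x\ne y\ne 0$. For a finite set $V$, $K^V$ is the $\mathrm{GF}(2)$-space of functions $V\to K$ with $\langle \mathbf a,\mathbf b\rangle=\sum_{v\in V}\langle \mathbf a(v),\mathbf b(v)\rangle$. The support $\mathrm{supp}(\mathbf a)$ is $\{v:\mathbf a(v)\ne 0\}$; $\mathbf a$ is complete if its support is $V$. For $X\subseteq V$, $p_X:K^V\to K^X$ is restriction and $\mathbf a[X]\in K^V$ agrees with $\mathbf a$ on $X$ and is $0$ elsewhere. An isotropic system is a pair $S=(V,L)$ with $L$ a subspace of $K^V$ such that $\langle\mathbf a,\mathbf b\rangle=0$ for all $\mathbf a,\mathbf b\in L$ and $\dim L=|V|$; elements of $V$ are its vertices. For $v\in V$ and $x\in K\setminus\{0\}$, the elementary minor is $S|^v_x=(V\setminus\{v\},\{p_{V\setminus\{v\}}(\mathbf a):\mathbf a\in L,\ \mathbf a(v)\in\{0,x\}\})$. The connectivity function is $c_S(X)=|X|-\dim\{p_X(\mathbf a):\mathbf a\in L,\ \mathrm{supp}(\mathbf a)\subseteq X\}$. A partition $(X,Y)$ of $V$ is a $k$-separation if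 $\min\{|X|,|Y|\}\ge k$ and $c_S(X)<k$; $S$ is $3$-connected if it has no $1$- or $2$-separation. A vertex $v$ of $S$ is non-essential if at least two of $S|^v_\alpha,S|^v_\beta,S|^v_\gamma$ are $3$-connected, and essential otherwise. An Eulerian vector of $S$ is a complete $\mathbf a\in K^V$ with $\mathbf a[X]\notin L$ for every nonempty $X\subseteq V$; for such $\mathbf a$ and each $v$ there is a unique $\mathbf b_v\in L$ with $\langle\mathbf b_v(v),\mathbf a(v)\rangle=1$ and $\langle\mathbf b_v(w),\mathbf a(w)\rangle=0$ for $w\ne v$; the fundamental graph of $S$ w.r.t. $\mathbf a$ is the graph on $V$ with $v\sim w$ iff $\mathbf b_v(w)\ne0$. $S$ is cyclic if some fundamental graph of $S$ is a cycle of length at least $5$. A triangle in $S$ is a vector of $L$ whose support has size $3$; $H(S)$ is the $3$-uniform hypergraph on $V$ whose edges are the supports of triangles. A partial hypergraph of $H$ has vertex and edge sets contained in those of $H$; the partial hypergraph generated by a set $F$ of edges is $(\bigcup_{e\in F}e,F)$. A tight path of length $k\ge1$ is a partial hypergraph $P$ admitting an ordering $v_0,\dots,v_{k+1}$ of $V(P)$ with $E(P)=\{\{v_{i-1},v_i,v_{i+1}\}:1\le i\le k\}$; an end is a vertex in exactly one edge of $P$, an internal vertex is one in at least two edges. For a $3$-uniform hypergraph $H=(V,E)$ and $N\subseteq V$: (i) an $N$-ear is a tight path $P$ of length at least $2$ whose two ends are in $N$, whose internal vertices are in $V\setminus N$, and such that no edge in $E\setminus E(P)$ contains an internal vertex of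 $P$; (ii) an $N$-triangle is the partial hypergraph generated by $\{e\}$ for an edge $e\subseteq N$ such that no edge $e'$ of $H$ has $|e\cap e'|=2$; (iii) the partial hypergraph generated by the set $X$ of all edges containing some $v\in V\setminus N$ is an $N$-windmill if $X\ne\emptyset$, for every $e\in X$, $e\setminus\{v\}\subseteq N$ and $e$ is the only edge of $H$ containing $e\setminus\{v\}$, and $e\cap e'=\{v\}$ for all distinct $e,e'\in X$; (iv) the partial hypergraph generated by the set $X$ of all edges containing $v$ or $w$, for distinct $v,w\in V\setminus N$, is an $N$-tripod if $|X|=3$ and $\{v,w\}\subseteq e\subseteq N\cup\{v,w\}$ for each $e\in X$; (v) the partial hypergraph generated by the set $X$ of all edges intersecting some edge $f\subseteq V\setminus N$ of $H$ is an $N$-table if $|X|=4$, $|e\cap f|\ge2$ and $e\setminus f\subseteq N$ for every $e\in X$, and $e\setminus f\ne e'\setminus f$ for distinct $e,e'\in X$. -}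

module Defs where

open import Data.Nat using (ℕ; zero; suc; _+_; _≤_; _<_)
open import Data.Bool using (Bool; true; false; not; _xor_; if_then_else_)
open import Data.Fin using (Fin; zero; suc; toℕ; inject₁)
open import Data.Fin.Subset using (Subset; _∈_; _∉_; _⊆_; _∩_; _∪_; ∁; ⁅_⁆; ∣_∣; Nonempty)
open import Data.Vec using (Vec; []; _∷_; lookup; replicate; zipWith; map; foldr; removeAt; tabulate)
open import Data.Product using (Σ; ∃; ∃-syntax; _×_; _,_)
open import Data.Sum using (_⊎_)
open import Data.Empty using (⊥)
open import Relation.Nullary using (¬_)
open import Relation.Binary.PropositionalEquality using (_≡_; _≢_)
open import Function.Definitions using (Injective)
open import Function.Bundles using (_⇔_)

-- The Klein four-group K = {0, α, β, γ} as a GF(2)-vector space.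
-- GF(2) is modelled by Bool with _xor_ as addition.

data K : Set where
  O α β γ : K

_+K_ : K → K → K
O +K y = y
x +K O = x
α +K α = O
α +K β = γ
α +K γ = β
β +K α = γ
β +K β = O
β +K γ = α
γ +K α = β
γ +K β = α
γ +K γ = O

⟪_,_⟫K : K → K → Bool
⟪ O , _ ⟫K = false
⟪ _ , O ⟫K = false
⟪ α , α ⟫K = false
⟪ β , β ⟫K = false
⟪ γ , γ ⟫K = false
⟪ _ , _ ⟫K = true

-- The space K^V for V = Fin n, as vectors of length n.

module _ {n : ℕ} where

  𝟎 : Vec K n
  𝟎 = replicate n O

  _⊕_ : Vec K n → Vec K n → Vec K n
  _⊕_ = zipWith _+K_

  ⟪_,_⟫ : Vec K n → Vec K n → Bool
  ⟪ a , b ⟫ = foldr (λ _ → Bool) _xor_ false (zipWith ⟪_,_⟫K a b)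

  isZero : K → Bool
  isZero O = true
  isZero _ = false

  supp : Vec K n → Subset n
  supp a = map (λ x → not (isZero x)) a

  restrict : Vec K n → Subset n → Vec K n
  restrict a X = tabulate (λ i → if lookup X i then lookup a i else O)

  Complete : Vec K n → Set
  Complete a = ∀ i → lookup a i ≢ O

lincomb : ∀ {n d} → Vec (Vec K n) d → Vec Bool d → Vec K n
lincomb []      []          = 𝟎
lincomb (b ∷ B) (true ∷ s)  = b ⊕ lincomb B s
lincomb (b ∷ B) (false ∷ s) = lincomb B s

IsSubspace : ∀ {n} → (Vec K n → Set) → Set
IsSubspace L = L 𝟎 × (∀ a b → L a → L b → L (a ⊕ b))

HasDim : ∀ {n} → (Vec K n → Set) → ℕ → Set
HasDim {n} W d =
  Σ (Vec (Vec K n) d) λ B →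
    (∀ (s : Vec Bool d) → lincomb B s ≡ 𝟎 → s ≡ replicate d false)
    × (∀ a → W a ⇔ (∃[ s ] lincomb B s ≡ a))

IsotropicSystem : ∀ n → (Vec K n → Set) → Set
IsotropicSystem n L =
  IsSubspace L
  × (∀ a b → L a → L b → ⟪ a , b ⟫ ≡ false)
  × HasDim L n

-- {a ∈ L : supp(a) ⊆ X}; p_X is injective on it, so its dimension equals
-- dim { p_X(a) : a ∈ L, supp(a) ⊆ X }.
SuppIn : ∀ {n} → (Vec K n → Set) → Subset n → Vec K n → Set
SuppIn L X a = L a × supp a ⊆ X

ConnLess : ∀ {n} → (Vec K n → Set) → Subset n → ℕ → Set
ConnLess L X k = ∃[ d ] (HasDim (SuppIn L X) d × ∣ X ∣ < k + d)

IsSeparation : ∀ {n} → (Vec K n → Set) → ℕ → Subset n → Set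
IsSeparation L k X = k ≤ ∣ X ∣ × k ≤ ∣ ∁ X ∣ × ConnLess L X k

ThreeConnected : ∀ {n} → (Vec K n → Set) → Set
ThreeConnected L = ∀ X → ¬ IsSeparation L 1 X × ¬ IsSeparation L 2 X

-- S|^v_x (V∖{v} is identified with Fin m via removeAt)
Minor : ∀ {m} → (Vec K (suc m) → Set) → Fin (suc m) → K → Vec K m → Set
Minor L v x b = ∃[ a ] (L a × (lookup a v ≡ O ⊎ lookup a v ≡ x) × removeAt a v ≡ b)

NonEssential : ∀ {n} → (Vec K n → Set) → Fin n → Set
NonEssential {suc m} L v =
  (ThreeConnected (Minor L v α) × ThreeConnected (Minor L v β))
  ⊎ (ThreeConnected (Minor L v α) × ThreeConnected (Minor L v γ))
  ⊎ (ThreeConnected (Minor L v β) × ThreeConnected (Minor L v γ))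

Eulerian : ∀ {n} → (Vec K n → Set) → Vec K n → Set
Eulerian L a = Complete a × (∀ X → Nonempty X → ¬ L (restrict a X))

-- v ~ w in the fundamental graph w.r.t. a (b_v is unique, so "some b_v" = "the b_v")
FundAdj : ∀ {n} → (Vec K n → Set) → Vec K n → Fin n → Fin n → Set
FundAdj L a v w =
  v ≢ w ×
  ∃[ b ] (L b
          × ⟪ lookup b v , lookup a v ⟫K ≡ true
          × (∀ u → u ≢ v → ⟪ lookup b u , lookup a u ⟫K ≡ false)
          × lookup b w ≢ O)

CycAdj : ∀ {n} → Fin n → Fin n → Set
CycAdj {n} i j =
  toℕ j ≡ suc (toℕ i) ⊎ toℕ i ≡ suc (toℕ j)
  ⊎ (toℕ i ≡ 0 × suc (toℕ j) ≡ n) ⊎ (toℕ j ≡ 0 × suc (toℕ i) ≡ n)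

IsCycleGraph : ∀ {n} → (Fin n → Fin n → Set) → Set
IsCycleGraph {n} G =
  5 ≤ n × Σ (Fin n → Fin n) λ f → Injective _≡_ _≡_ f × (∀ i j → G (f i) (f j) ⇔ CycAdj i j)

Cyclic : ∀ {n} → (Vec K n → Set) → Set
Cyclic L = ∃[ a ] (Eulerian L a × IsCycleGraph (FundAdj L a))

Edge : ∀ {n} → (Vec K n → Set) → Subset n → Set
Edge L e = ∃[ a ] (L a × ∣ supp a ∣ ≡ 3 × supp a ≡ e)

-- Hypergraph notions, for a 3-uniform hypergraph on Fin n with edge
-- predicate E, and a set N ⊆ V given as a predicate.

module _ {n : ℕ} where

  HasSize : {A : Set} → (A → Set) → ℕ → Set
  HasSize {A} P k = Σ (Fin k → A) λ g → Injective _≡_ _≡_ g × (∀ a → P a ⇔ (∃[ i ] g i ≡ a))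

  tri : Fin n → Fin n → Fin n → Subset n
  tri a b c = ⁅ a ⁆ ∪ ⁅ b ⁆ ∪ ⁅ c ⁆

  InN : (Fin n → Set) → Subset n → Set
  InN N e = ∀ v → v ∈ e → N v

  -- edges of the tight path with vertex ordering f = v_0, …, v_{k+1}
  PathEdge : ∀ {k} → (Fin (suc (suc k)) → Fin n) → Subset n → Set
  PathEdge {k} f e = ∃[ j ] (e ≡ tri (f (inject₁ (inject₁ {k} j))) (f (inject₁ (suc j))) (f (suc (suc j))))

  IsEnd : (Subset n → Set) → Fin n → Set
  IsEnd P v = ∃[ e ] (P e × v ∈ e × (∀ e' → P e' → v ∈ e' → e' ≡ e))

  IsInternal : (Subset n → Set) → Fin n → Set
  IsInternal P v = ∃[ e ] ∃[ e' ] (P e × P e' × e ≢ e' × v ∈ e × v ∈ e')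

  EarEdge : (Subset n → Set) → (Fin n → Set) → Subset n → Set
  EarEdge E N e =
    ∃[ k ] Σ (Fin (suc (suc k)) → Fin n) λ f →
      2 ≤ k
      × Injective _≡_ _≡_ f
      × (∀ e' → PathEdge f e' → E e')
      × (∀ v → IsEnd (PathEdge f) v → N v)
      × (∀ v → IsInternal (PathEdge f) v → ¬ N v)
      × (∀ e' v → E e' → ¬ PathEdge f e' → IsInternal (PathEdge f) v → v ∉ e')
      × PathEdge f e

  TriangleEdge : (Subset n → Set) → (Fin n → Set) → Subset n → Set
  TriangleEdge E N e = E e × InN N e × (∀ e' → E e' → ∣ e ∩ e' ∣ ≢ 2)

  -- the edges containing v form an N-windmill
  IsWindmill : (Subset n → Set) → (Fin n → Set) → Fin n → Set
  IsWindmill E N v =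
    ¬ N v
    × (∃[ e ] (E e × v ∈ e))
    × (∀ e → E e → v ∈ e →
         InN N (e ∩ ∁ ⁅ v ⁆) × (∀ e' → E e' → (e ∩ ∁ ⁅ v ⁆) ⊆ e' → e' ≡ e))
    × (∀ e e' → E e → E e' → v ∈ e → v ∈ e' → e ≢ e' → e ∩ e' ≡ ⁅ v ⁆)

  WindmillEdge : (Subset n → Set) → (Fin n → Set) → Subset n → Set
  WindmillEdge E N e = ∃[ v ] (IsWindmill E N v × E e × v ∈ e)

  -- the edges containing v or w form an N-tripod
  IsTripod : (Subset n → Set) → (Fin n → Set) → Fin n → Fin n → Set
  IsTripod E N v w =
    v ≢ w × ¬ N v × ¬ N w
    × HasSize (λ e → E e × (v ∈ e ⊎ w ∈ e)) 3
    × (∀ e → E e → (v ∈ e ⊎ w ∈ e) →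
         v ∈ e × w ∈ e × (∀ u → u ∈ e → N u ⊎ u ≡ v ⊎ u ≡ w))

  TripodEdge : (Subset n → Set) → (Fin n → Set) → Subset n → Set
  TripodEdge E N e = ∃[ v ] ∃[ w ] (IsTripod E N v w × E e × (v ∈ e ⊎ w ∈ e))

  -- the edges intersecting the edge f form an N-table
  IsTable : (Subset n → Set) → (Fin n → Set) → Subset n → Set
  IsTable E N f =
    E f × (∀ u → u ∈ f → ¬ N u)
    × HasSize (λ e → E e × Nonempty (e ∩ f)) 4
    × (∀ e → E e → Nonempty (e ∩ f) → 2 ≤ ∣ e ∩ f ∣ × InN N (e ∩ ∁ f))
    × (∀ e e' → E e → Nonempty (e ∩ f) → E e' → Nonempty (e' ∩ f) → e ≢ e' →
         e ∩ ∁ f ≢ e' ∩ ∁ f)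

  TableEdge : (Subset n → Set) → (Fin n → Set) → Subset n → Set
  TableEdge E N e = ∃[ f ] (IsTable E N f × E e × Nonempty (e ∩ f))

{-# OPTIONS --safe #-}
module Submission where

open import Defs
open import Data.Nat using (ℕ; zero; suc; _+_; _*_; _∸_; _^_; _≤_; _<_; z≤n; s≤s)
import Data.Nat.Properties as ℕₚ
open import Data.Nat.Tactic.RingSolver using (solve-∀)
open import Data.Bool using (Bool; true; false; not; _∨_; _xor_; if_then_else_)
import Data.Bool.Properties as Boolₚ
import Data.Empty
open import Data.Fin
  using (Fin; zero; suc; toℕ; fromℕ; fromℕ<; inject₁; punchIn; punchOut; combine; finToFun; funToFin)
open import Data.Fin.Patterns using (0F; 1F; 2F; 3F)
import Data.Fin.Properties as Finₚ
open import Data.Fin.Subset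
  using (Subset; _∈_; _∉_; _⊆_; _∩_; _∪_; _-_; ∁; ⁅_⁆; ∣_∣; Nonempty; ⊤; ⊥)
open import Data.Fin.Subset.Properties
open import Data.List using (List; []; _∷_; allFin; length)
open import Data.List.Membership.Propositional using () renaming (_∈_ to _∈ˡ_)
open import Data.List.Membership.Propositional.Properties using (∈-allFin)
open import Data.List.Relation.Unary.All using (All; []; _∷_)
open import Data.List.Relation.Unary.Any using (here; there)
open import Data.Product using (∃-syntax; Σ; _×_; _,_; proj₁; proj₂)
open import Data.Sum using (_⊎_; inj₁; inj₂; [_,_]′)
open import Data.Vec
  using (Vec; []; _∷_; lookup; replicate; zipWith; map; tabulate; insertAt; removeAt; _[_]≔_)
import Data.Vec.Properties as Vecₚ
open import Function.Base using (_∘_; id)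
open import Function.Bundles using (_⇔_; mk⇔; Equivalence)
open import Function.Definitions using (Injective)
open import Relation.Nullary using (¬_; Dec; yes; no; contradiction)
open import Relation.Nullary.Decidable using (map′; ¬?; _×-dec_; _⊎-dec_; _→-dec_; from-yes)
open import Relation.Unary using (Decidable)
open import Relation.Binary.Definitions using (DecidableEquality; tri<; tri≈; tri>)
open import Relation.Binary.PropositionalEquality

open Equivalence using (to; from)

-- Write L_X for the vectors of L supported in X. The connectivity c(X) = |X| - dim L_X is symmetric
-- and submodular, and adding a vertex u to X changes it by 1 - i, where i is the dimension of the
-- space of values at u of L_{X ∪ u}. Uncrossing two separations of minors at two essential vertices
-- of a triangle (as for Tutte's triangle lemma) shows that each of these vertices lies in a second
-- triangle taking another value there. By isotropy, triangles meeting in exactly one vertex agree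
-- there and triangles meeting in exactly two disagree at both, and no two triangles disagree at a
-- non-essential vertex. Hence edges with at most one essential vertex are N-triangles or blades of
-- windmills. An edge with two essential vertices lies in a tripod (a pair in three edges), or in a
-- table (an edge all of whose pairs lie in a second edge), or a longest tight path through it is an
-- ear: dimension bounds on small sets exclude every other edge at an internal vertex, and a path
-- that closes up makes S cyclic. Systems with 5 or 6 vertices are treated apart, as the dimension
-- bounds degenerate there.

-- `L` is only a predicate, so membership in it cannot be searched. Case distinctions go through
-- numbers instead: cutting the given basis by linear functionals yields the dimension of each L_X
-- and of the matching spaces in the minors. These numbers decide 3-connectivity of minors,
-- essentiality of vertices and the existence of a triangle on three given vertices; where a vector
-- is needed, a gap between two dimensions supplies it. The bound c(X) ≥ 2, available once X and its
-- complement both have at least two vertices, caps the dimension on a set of k vertices at k - 2.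
-- Three triangles on four vertices would have dimension 3, and a wheel of four triangles on five
-- vertices dimension 4. Excluding these takes n ≥ 6 and n ≥ 7, which is where the small cases come
-- from. Centres of tripods and tables are separated from the paths beforehand: every edge at such a
-- centre contains a second one, so a path that avoids them goes on avoiding them while it grows.

_≟K_ : DecidableEquality K
O ≟K O = yes refl
O ≟K α = no λ ()
O ≟K β = no λ ()
O ≟K γ = no λ ()
α ≟K O = no λ ()
α ≟K α = yes refl
α ≟K β = no λ ()
α ≟K γ = no λ ()
β ≟K O = no λ ()
β ≟K α = no λ ()
β ≟K β = yes refl
β ≟K γ = no λ ()
γ ≟K O = no λ ()
γ ≟K α = no λ ()
γ ≟K β = no λ ()
γ ≟K γ = yes refl

-- Identities over `K` become finite checks that `from-yes` evaluates.
∀K? : ∀ {P : K → Set} → Decidable P → Dec (∀ x → P x)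
∀K? P? = map′ (λ { (o , a , b , c) → λ { O → o ; α → a ; β → b ; γ → c } })
              (λ f → f O , f α , f β , f γ)
              (P? O ×-dec P? α ×-dec P? β ×-dec P? γ)

+K-assoc : ∀ x y z → (x +K y) +K z ≡ x +K (y +K z)
+K-assoc = from-yes (∀K? λ x → ∀K? λ y → ∀K? λ z → ((x +K y) +K z) ≟K (x +K (y +K z)))

+K-comm : ∀ x y → x +K y ≡ y +K x
+K-comm = from-yes (∀K? λ x → ∀K? λ y → (x +K y) ≟K (y +K x))

+K-identityʳ : ∀ x → x +K O ≡ x
+K-identityʳ = from-yes (∀K? λ x → (x +K O) ≟K x)

+K-self : ∀ x → x +K x ≡ O
+K-self = from-yes (∀K? λ x → (x +K x) ≟K O)

+K≡O⇒≡ : ∀ x y → x +K y ≡ O → x ≡ y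
+K≡O⇒≡ x y eq = begin
  x             ≡⟨ +K-identityʳ x ⟨
  x +K O        ≡⟨ cong (x +K_) (+K-self y) ⟨
  x +K (y +K y) ≡⟨ +K-assoc x y y ⟨
  (x +K y) +K y ≡⟨ cong (_+K y) eq ⟩
  y             ∎
  where open ≡-Reasoning

⟪⟫K-+K : ∀ x y z → ⟪ x +K y , z ⟫K ≡ ⟪ x , z ⟫K xor ⟪ y , z ⟫K
⟪⟫K-+K = from-yes (∀K? λ x → ∀K? λ y → ∀K? λ z →
  ⟪ x +K y , z ⟫K Boolₚ.≟ (⟪ x , z ⟫K xor ⟪ y , z ⟫K))

⟪⟫K-comm : ∀ x y → ⟪ x , y ⟫K ≡ ⟪ y , x ⟫K
⟪⟫K-comm = from-yes (∀K? λ x → ∀K? λ y → ⟪ x , y ⟫K Boolₚ.≟ ⟪ y , x ⟫K)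

⟪O,⟫K : ∀ {x} y → x ≡ O → ⟪ x , y ⟫K ≡ false
⟪O,⟫K y refl = refl

⟪,O⟫K : ∀ x {y} → y ≡ O → ⟪ x , y ⟫K ≡ false
⟪,O⟫K x {y} e = trans (⟪⟫K-comm x y) (⟪O,⟫K x e)

⟪⟫K-same : ∀ x → ⟪ x , x ⟫K ≡ false
⟪⟫K-same = from-yes (∀K? λ x → ⟪ x , x ⟫K Boolₚ.≟ false)

⟪⟫K-true : ∀ {x y} → x ≢ O → y ≢ O → x ≢ y → ⟪ x , y ⟫K ≡ true
⟪⟫K-true {O} p q r = contradiction refl p
⟪⟫K-true {α} {O} p q r = contradiction refl q
⟪⟫K-true {β} {O} p q r = contradiction refl q
⟪⟫K-true {γ} {O} p q r = contradiction refl q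
⟪⟫K-true {α} {α} p q r = contradiction refl r
⟪⟫K-true {α} {β} p q r = refl
⟪⟫K-true {α} {γ} p q r = refl
⟪⟫K-true {β} {α} p q r = refl
⟪⟫K-true {β} {β} p q r = contradiction refl r
⟪⟫K-true {β} {γ} p q r = refl
⟪⟫K-true {γ} {α} p q r = refl
⟪⟫K-true {γ} {β} p q r = refl
⟪⟫K-true {γ} {γ} p q r = contradiction refl r

⟪⟫K-true⁻ : ∀ {x y} → ⟪ x , y ⟫K ≡ true → x ≢ O × y ≢ O × x ≢ y
⟪⟫K-true⁻ {x} {y} e =
  (λ x≡O → f≢t (trans (sym (⟪O,⟫K y x≡O)) e)) ,
  (λ y≡O → f≢t (trans (sym (⟪,O⟫K x y≡O)) e)) ,
  λ { refl → f≢t (trans (sym (⟪⟫K-same x)) e) }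
  where
  f≢t : false ≢ true
  f≢t ()

⟪⟫K-false⁻ : ∀ {x y} → ⟪ x , y ⟫K ≡ false → y ≢ O → x ≡ O ⊎ x ≡ y
⟪⟫K-false⁻ {x} {y} e y≢O with x ≟K O | x ≟K y
... | yes p | _ = inj₁ p
... | no _ | yes q = inj₂ q
... | no p | no q with () ← trans (sym e) (⟪⟫K-true p y≢O q)

-- Linear algebra over GF(2): bases, dimension, kernels of functionals.

module _ {n : ℕ} where

  lookup-ext : ∀ {A : Set} {a b : Vec A n} → (∀ i → lookup a i ≡ lookup b i) → a ≡ b
  lookup-ext {a = a} {b} h =
    trans (sym (Vecₚ.tabulate∘lookup a)) (trans (Vecₚ.tabulate-cong h) (Vecₚ.tabulate∘lookup b))

  lookup-⊕ : ∀ i (a b : Vec K n) → lookup (a ⊕ b) i ≡ lookup a i +K lookup b i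
  lookup-⊕ = Vecₚ.lookup-zipWith _+K_

  lookup-𝟎 : ∀ i → lookup (𝟎 {n}) i ≡ O
  lookup-𝟎 i = Vecₚ.lookup-replicate i O

  ⊕-comm : ∀ (a b : Vec K n) → a ⊕ b ≡ b ⊕ a
  ⊕-comm = Vecₚ.zipWith-comm +K-comm

  ⊕-assoc : ∀ (a b c : Vec K n) → (a ⊕ b) ⊕ c ≡ a ⊕ (b ⊕ c)
  ⊕-assoc = Vecₚ.zipWith-assoc +K-assoc

  ⊕-identityˡ : ∀ (a : Vec K n) → 𝟎 ⊕ a ≡ a
  ⊕-identityˡ = Vecₚ.zipWith-identityˡ λ _ → refl

  ⊕-identityʳ : ∀ (a : Vec K n) → a ⊕ 𝟎 ≡ a
  ⊕-identityʳ = Vecₚ.zipWith-identityʳ +K-identityʳ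

  ⊕-self : ∀ (a : Vec K n) → a ⊕ a ≡ 𝟎
  ⊕-self a = lookup-ext λ i → trans (lookup-⊕ i a a) (trans (+K-self (lookup a i)) (sym (lookup-𝟎 i)))

  ⊕-swap : ∀ (a b c : Vec K n) → a ⊕ (b ⊕ c) ≡ b ⊕ (a ⊕ c)
  ⊕-swap a b c = trans (sym (⊕-assoc a b c)) (trans (cong (_⊕ c) (⊕-comm a b)) (⊕-assoc b a c))

Additive : ∀ {n} → (Vec K n → Bool) → Set
Additive φ = ∀ a b → φ (a ⊕ b) ≡ φ a xor φ b

Additive-𝟎 : ∀ {n} (φ : Vec K n → Bool) → Additive φ → φ 𝟎 ≡ false
Additive-𝟎 φ add = begin
  φ 𝟎          ≡⟨ cong φ (⊕-self 𝟎) ⟨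
  φ (𝟎 ⊕ 𝟎)   ≡⟨ add 𝟎 𝟎 ⟩
  φ 𝟎 xor φ 𝟎 ≡⟨ Boolₚ.xor-same (φ 𝟎) ⟩
  false        ∎
  where open ≡-Reasoning

Indep : ∀ {n d} → Vec (Vec K n) d → Set
Indep {d = d} B = ∀ s → lincomb B s ≡ 𝟎 → s ≡ replicate d false

_≐_ : ∀ {n} → (Vec K n → Set) → (Vec K n → Set) → Set
W ≐ W' = ∀ a → W a ⇔ W' a

HasDim-cong : ∀ {n d} {W W' : Vec K n → Set} → W ≐ W' → HasDim W d → HasDim W' d
HasDim-cong W≐W' (B , ind , span) =
  B , ind , λ a → mk⇔ (to (span a) ∘ from (W≐W' a)) (to (W≐W' a) ∘ from (span a))

module _ {n : ℕ} where

  lincomb-xor : ∀ {d} (B : Vec (Vec K n) d) s t →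
                lincomb B (zipWith _xor_ s t) ≡ lincomb B s ⊕ lincomb B t
  lincomb-xor [] [] [] = sym (⊕-identityˡ 𝟎)
  lincomb-xor (b ∷ B) (false ∷ s) (false ∷ t) = lincomb-xor B s t
  lincomb-xor (b ∷ B) (true ∷ s) (false ∷ t) =
    trans (cong (b ⊕_) (lincomb-xor B s t)) (sym (⊕-assoc b _ _))
  lincomb-xor (b ∷ B) (false ∷ s) (true ∷ t) =
    trans (cong (b ⊕_) (lincomb-xor B s t)) (⊕-swap b _ _)
  lincomb-xor (b ∷ B) (true ∷ s) (true ∷ t) = begin
    lincomb B (zipWith _xor_ s t)                 ≡⟨ lincomb-xor B s t ⟩
    x ⊕ y                                         ≡⟨ ⊕-identityˡ _ ⟨
    𝟎 ⊕ (x ⊕ y)                                   ≡⟨ cong (_⊕ (x ⊕ y)) (⊕-self b) ⟨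
    (b ⊕ b) ⊕ (x ⊕ y)                             ≡⟨ ⊕-assoc b b _ ⟩
    b ⊕ (b ⊕ (x ⊕ y))                             ≡⟨ cong (b ⊕_) (⊕-swap b x y) ⟩
    b ⊕ (x ⊕ (b ⊕ y))                             ≡⟨ ⊕-assoc b x _ ⟨
    (b ⊕ x) ⊕ (b ⊕ y)                             ∎
    where
    open ≡-Reasoning
    x = lincomb B s
    y = lincomb B t

  lincomb-false : ∀ {d} (B : Vec (Vec K n) d) → lincomb B (replicate d false) ≡ 𝟎
  lincomb-false [] = refl
  lincomb-false (b ∷ B) = lincomb-false B

  Span : ∀ {d} → Vec (Vec K n) d → Vec K n → Set
  Span B a = ∃[ s ] lincomb B s ≡ a

  xor-false⇒≡ : ∀ {d} (s t : Vec Bool d) → zipWith _xor_ s t ≡ replicate d false → s ≡ t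
  xor-false⇒≡ [] [] e = refl
  xor-false⇒≡ (x ∷ s) (y ∷ t) e =
    cong₂ _∷_ (bit x y (Vecₚ.∷-injectiveˡ e)) (xor-false⇒≡ s t (Vecₚ.∷-injectiveʳ e))
    where
    bit : ∀ x y → x xor y ≡ false → x ≡ y
    bit false false e = refl
    bit true true e = refl

  Indep⇒injective : ∀ {d} (B : Vec (Vec K n) d) → Indep B →
                    ∀ s t → lincomb B s ≡ lincomb B t → s ≡ t
  Indep⇒injective B ind s t e = xor-false⇒≡ s t (ind _
    (trans (lincomb-xor B s t) (trans (cong (_⊕ lincomb B t) e) (⊕-self _))))

bitsToFin : ∀ {d} → Vec Bool d → Fin (2 ^ d)
bitsToFin s = funToFin (λ i → if lookup s i then suc zero else zero)

bitsToFin-injective : ∀ {d} (s t : Vec Bool d) → bitsToFin s ≡ bitsToFin t → s ≡ t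
bitsToFin-injective s t e = lookup-ext λ i → bit _ _
  (trans (sym (Finₚ.finToFun-funToFin _ i))
    (trans (cong (λ k → finToFun k i) e) (Finₚ.finToFun-funToFin _ i)))
  where
  bit : ∀ x y → (if x then suc zero else zero {1}) ≡ (if y then suc zero else zero) → x ≡ y
  bit false false e = refl
  bit true true e = refl
  bit false true ()
  bit true false ()

isOne : Fin 2 → Bool
isOne zero = false
isOne (suc zero) = true

finToBits : ∀ {d} → Fin (2 ^ d) → Vec Bool d
finToBits k = tabulate (λ i → isOne (finToFun k i))

finToBits-injective : ∀ {d} (j k : Fin (2 ^ d)) → finToBits {d} j ≡ finToBits k → j ≡ k
finToBits-injective {d} j k e =
  trans (sym (Finₚ.funToFin-finToFin {d} {2} j))
    (trans (funToFin-cong λ i → bit _ _ (trans (sym (Vecₚ.lookup∘tabulate _ i))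
        (trans (cong (λ v → lookup v i) e) (Vecₚ.lookup∘tabulate _ i))))
      (Finₚ.funToFin-finToFin {d} {2} k))
  where
  bit : ∀ x y → isOne x ≡ isOne y → x ≡ y
  bit zero zero e = refl
  bit (suc zero) (suc zero) e = refl
  bit zero (suc zero) ()
  bit (suc zero) zero ()
  funToFin-cong : ∀ {m n} {f g : Fin m → Fin n} → (∀ i → f i ≡ g i) → funToFin f ≡ funToFin g
  funToFin-cong {zero} h = refl
  funToFin-cong {suc m} h = cong₂ combine (h zero) (funToFin-cong (h ∘ suc))

-- Over a finite field counting replaces the exchange lemma: 2^m vectors embed into 2^d.
bits-injection⇒≤ : ∀ {m d} (f : Vec Bool m → Vec Bool d) → (∀ s t → f s ≡ f t → s ≡ t) → m ≤ d
bits-injection⇒≤ {m} {d} f inj with m ℕₚ.≤? d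
... | yes m≤d = m≤d
... | no m≰d = contradiction
  (Finₚ.injective⇒≤ {f = bitsToFin ∘ f ∘ finToBits}
    (λ e → finToBits-injective {m} _ _ (inj _ _ (bitsToFin-injective _ _ e))))
  (ℕₚ.<⇒≱ (ℕₚ.^-monoʳ-< 2 (s≤s (s≤s z≤n)) (ℕₚ.≰⇒> m≰d)))

Indep-size : ∀ {n m d} {W : Vec K n → Set} (B : Vec (Vec K n) m) → Indep B →
             (∀ s → W (lincomb B s)) → HasDim W d → m ≤ d
Indep-size B ind inW (C , _ , span) = bits-injection⇒≤ (λ s → proj₁ (to (span _) (inW s)))
  λ s t e → Indep⇒injective B ind s t
    (trans (sym (proj₂ (to (span _) (inW s))))
      (trans (cong (lincomb C) e) (proj₂ (to (span _) (inW t)))))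

HasDim-mono : ∀ {n d e} {W W' : Vec K n → Set} → (∀ a → W a → W' a) →
              HasDim W d → HasDim W' e → d ≤ e
HasDim-mono W⊆W' (B , ind , span) = Indep-size B ind (λ s → W⊆W' _ (from (span _) (s , refl)))

HasDim-unique : ∀ {n d e} {W W' : Vec K n → Set} → W ≐ W' → HasDim W d → HasDim W' e → d ≡ e
HasDim-unique W≐W' p q =
  ℕₚ.≤-antisym (HasDim-mono (to ∘ W≐W') p q) (HasDim-mono (from ∘ W≐W') q p)

-- The indices stand for the dimensions of `W` and of its intersection with the kernel of `φ`. The
-- constructor `drop` keeps a vector off the kernel, because it could not be recovered later by a
-- search in `W`.
data Cut {n} (W : Vec K n → Set) (φ : Vec K n → Bool) : ℕ → ℕ → Set where
  flat : ∀ {d} → (∀ a → W a → φ a ≡ false) → Cut W φ d d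
  drop : ∀ {d a} → W a → φ a ≡ true → Cut W φ (suc d) d

_∩Ker_ : ∀ {n} → (Vec K n → Set) → (Vec K n → Bool) → Vec K n → Set
(W ∩Ker φ) a = W a × φ a ≡ false

module _ {n : ℕ} (φ : Vec K n → Bool) (add : Additive φ) where

  -- When φ b = 1 this is the projection c + φ(c) b onto the kernel of `φ` along `b`.
  adjust : Vec K n → Vec K n → Vec K n
  adjust b c = if φ c then c ⊕ b else c

  φ-adjust : ∀ b c → φ b ≡ true → φ (adjust b c) ≡ false
  φ-adjust b c e with φ c in eq
  ... | true = trans (add c b) (trans (cong₂ _xor_ eq e) refl)
  ... | false = eq

  adjust-⊕ : ∀ b c a → adjust b c ⊕ adjust b a ≡ adjust b (c ⊕ a)
  adjust-⊕ b c a rewrite add c a with φ c | φ a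
  ... | true | true = trans (⊕-assoc c b _)
          (cong (c ⊕_) (trans (cong (b ⊕_) (⊕-comm a b)) (trans (sym (⊕-assoc b b a))
            (trans (cong (_⊕ a) (⊕-self b)) (⊕-identityˡ a)))))
  ... | true | false = trans (⊕-assoc c b a) (trans (cong (c ⊕_) (⊕-comm b a)) (sym (⊕-assoc c a b)))
  ... | false | true = sym (⊕-assoc c a b)
  ... | false | false = refl

  lincomb-adjust : ∀ {d} b (B : Vec (Vec K n) d) s →
                   lincomb (map (adjust b) B) s ≡ adjust b (lincomb B s)
  lincomb-adjust b [] [] rewrite Additive-𝟎 φ add = refl
  lincomb-adjust b (c ∷ B) (true ∷ s) =
    trans (cong (adjust b c ⊕_) (lincomb-adjust b B s)) (adjust-⊕ b c _)
  lincomb-adjust b (c ∷ B) (false ∷ s) = lincomb-adjust b B s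

  adjust≡lincomb : ∀ {d} b (B : Vec (Vec K n) d) s →
                   adjust b (lincomb B s) ≡ lincomb (b ∷ B) (φ (lincomb B s) ∷ s)
  adjust≡lincomb b B s with φ (lincomb B s)
  ... | true = ⊕-comm _ b
  ... | false = refl

  -- Elimination of one equation: the first basis vector off the kernel is the pivot. Those before
  -- it lie in the kernel and stay; those after it are projected along it.
  cutSpan : ∀ {d} (B : Vec (Vec K n) d) → Indep B →
            ∃[ e ] (Cut (Span B) φ d e × HasDim (Span B ∩Ker φ) e)
  cutSpan [] ind = 0 , flat (λ { a ([] , refl) → Additive-𝟎 φ add }) ,
    [] , (λ { [] _ → refl }) , λ a → mk⇔ proj₁ λ { ([] , refl) → ([] , refl) , Additive-𝟎 φ add }
  cutSpan {suc d} (b ∷ B) ind with φ b in eq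
  ... | true = d , drop (true ∷ replicate d false ,
                         trans (cong (b ⊕_) (lincomb-false B)) (⊕-identityʳ b)) eq ,
               map (adjust b) B ,
               (λ s e → Vecₚ.∷-injectiveʳ (ind (φ (lincomb B s) ∷ s) (trans (sym (new s)) e))) ,
               λ a → mk⇔ (toNew a) λ { (s , refl) → (φ (lincomb B s) ∷ s , sym (new s)) , φ-new s }
    where
    new : ∀ s → lincomb (map (adjust b) B) s ≡ lincomb (b ∷ B) (φ (lincomb B s) ∷ s)
    new s = trans (lincomb-adjust b B s) (adjust≡lincomb b B s)
    φ-new : ∀ s → φ (lincomb (map (adjust b) B) s) ≡ false
    φ-new s = trans (cong φ (lincomb-adjust b B s)) (φ-adjust b (lincomb B s) eq)
    toNew : ∀ a → (Span (b ∷ B) ∩Ker φ) a → Span (map (adjust b) B) a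
    toNew a ((false ∷ s , refl) , z) = s , trans (lincomb-adjust b B s) (lemma z)
      where
      lemma : φ (lincomb B s) ≡ false → adjust b (lincomb B s) ≡ lincomb B s
      lemma z rewrite z = refl
    toNew a ((true ∷ s , refl) , z) = s , trans (lincomb-adjust b B s) (lemma (bit _ h))
      where
      h : true xor φ (lincomb B s) ≡ false
      h = trans (cong (_xor φ (lincomb B s)) (sym eq)) (trans (sym (add b _)) z)
      bit : ∀ x → true xor x ≡ false → x ≡ true
      bit true _ = refl
      lemma : φ (lincomb B s) ≡ true → adjust b (lincomb B s) ≡ b ⊕ lincomb B s
      lemma z rewrite z = ⊕-comm _ b
  ... | false with cutSpan B (λ s e → Vecₚ.∷-injectiveʳ (ind (false ∷ s) e))
  ...   | e , cut , C , indC , spanC = go cut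
    where
    φ-cons : ∀ x s → φ (lincomb (b ∷ B) (x ∷ s)) ≡ φ (lincomb B s)
    φ-cons true s = trans (add b _) (cong (_xor φ (lincomb B s)) eq)
    φ-cons false s = refl
    intoB : ∀ s → Span B (lincomb C s)
    intoB s = proj₁ (from (spanC _) (s , refl))
    indep : Indep (b ∷ C)
    indep (false ∷ s) z = cong (false ∷_) (indC s z)
    indep (true ∷ s) z with intoB s
    ... | t , t≡ with () ← Vecₚ.∷-injectiveˡ (ind (true ∷ t) (trans (cong (b ⊕_) t≡) z))
    span : ∀ a → (Span (b ∷ B) ∩Ker φ) a ⇔ Span (b ∷ C) a
    span a = mk⇔ f g
      where
      f : (Span (b ∷ B) ∩Ker φ) a → Span (b ∷ C) a
      f ((x ∷ s , refl) , z) with to (spanC (lincomb B s)) ((s , refl) , trans (sym (φ-cons x s)) z)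
      f ((true ∷ s , refl) , z) | t , t≡ = true ∷ t , cong (b ⊕_) t≡
      f ((false ∷ s , refl) , z) | t , t≡ = false ∷ t , t≡
      g : Span (b ∷ C) a → (Span (b ∷ B) ∩Ker φ) a
      g (x ∷ t , refl) with from (spanC (lincomb C t)) (t , refl)
      g (true ∷ t , refl) | (s , s≡) , z = (true ∷ s , cong (b ⊕_) s≡) , trans (add b _) (cong₂ _xor_ eq z)
      g (false ∷ t , refl) | (s , s≡) , z = (false ∷ s , s≡) , z
    go : Cut (Span B) φ d e → ∃[ e ] (Cut (Span (b ∷ B)) φ (suc d) e × HasDim (Span (b ∷ B) ∩Ker φ) e)
    go (flat h) = suc d , flat (λ { a (x ∷ s , refl) → trans (φ-cons x s) (h _ (s , refl)) }) ,
                  b ∷ C , indep , span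
    go (drop (s , s≡) t) = d , drop (false ∷ s , s≡) t , b ∷ C , indep , span

  abstract
    cut : ∀ {d} {W : Vec K n → Set} → HasDim W d → ∃[ e ] (Cut W φ d e × HasDim (W ∩Ker φ) e)
    cut {d} {W} (B , ind , span) with cutSpan B ind
    ... | e , c , hd = e , tr c ,
          HasDim-cong (λ a → mk⇔ (λ { (p , q) → from (span a) p , q }) (λ { (p , q) → to (span a) p , q })) hd
      where
      tr : ∀ {d e} → Cut (Span B) φ d e → Cut W φ d e
      tr (flat h) = flat λ a → h a ∘ to (span a)
      tr (drop p q) = drop (from (span _) p) q

Functional : ℕ → Set
Functional n = Σ (Vec K n → Bool) Additive

_∩Kers_ : ∀ {n} → (Vec K n → Set) → List (Functional n) → Vec K n → Set
W ∩Kers [] = W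
W ∩Kers (φ ∷ Φ) = (W ∩Ker proj₁ φ) ∩Kers Φ

cuts : ∀ {n d} {W : Vec K n → Set} Φ → HasDim W d → ∃[ e ] HasDim (W ∩Kers Φ) e
cuts [] hd = _ , hd
cuts ((φ , add) ∷ Φ) hd = cuts Φ (proj₂ (proj₂ (cut φ add hd)))

-- A functional that is nonzero on `W` is nonzero on the larger `W'`, so every drop for `W` is also
-- one for `W'`. With W = L_X, W' = L_(X ∪ Y) and the coordinates outside Y as functionals, this is
-- submodularity of dimension.
cuts-submodular : ∀ {n d e d' e'} {W W' : Vec K n → Set} Φ → (∀ a → W a → W' a) →
  HasDim W d → HasDim W' d' → HasDim (W ∩Kers Φ) e → HasDim (W' ∩Kers Φ) e' →
  d + e' ≤ d' + e
cuts-submodular {e' = e'} [] W⊆W' p p' q q'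
  rewrite HasDim-unique (λ a → mk⇔ (λ x → x) (λ x → x)) p q
        | HasDim-unique (λ a → mk⇔ (λ x → x) (λ x → x)) p' q' = ℕₚ.≤-reflexive (ℕₚ.+-comm _ e')
cuts-submodular ((φ , add) ∷ Φ) W⊆W' p p' q q' with cut φ add p | cut φ add p'
... | f , c , hf | f' , c' , hf' =
  step c c' (cuts-submodular Φ (λ { a (x , y) → W⊆W' a x , y }) hf hf' q q')
  where
  step : ∀ {d f d' f' e e'} → Cut _ φ d f → Cut _ φ d' f' → f + e' ≤ f' + e → d + e' ≤ d' + e
  step (flat _) (flat _) h = h
  step (flat _) (drop _ _) h = ℕₚ.m≤n⇒m≤1+n h
  step (drop {a = a} x t) (flat f) h with () ← trans (sym t) (f a (W⊆W' a x))
  step (drop _ _) (drop _ _) h = s≤s h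

-- Injectivity is asked on `W` only, since deletion of a coordinate, the map of interest, is
-- injective on `L` but not on the whole space.
HasDim-image : ∀ {m n d} {W : Vec K m → Set} (p : Vec K m → Vec K n) →
  p 𝟎 ≡ 𝟎 → (∀ a b → p (a ⊕ b) ≡ p a ⊕ p b) → (∀ a → W a → p a ≡ 𝟎 → a ≡ 𝟎) →
  HasDim W d → HasDim (λ b → ∃[ a ] (W a × p a ≡ b)) d
HasDim-image {W = W} p p𝟎 p⊕ inj (B , ind , span) = map p B ,
  (λ s e → ind s (inj _ (from (span _) (s , refl)) (trans (sym (lin B s)) e))) ,
  λ b → mk⇔ (λ { (a , w , refl) → f a (to (span a) w) })
             λ { (s , refl) → lincomb B s , from (span _) (s , refl) , sym (lin B s) }
  where
  lin : ∀ {d} (B : Vec _ d) s → lincomb (map p B) s ≡ p (lincomb B s)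
  lin [] [] = sym p𝟎
  lin (b ∷ B) (true ∷ s) = trans (cong (p b ⊕_) (lin B s)) (sym (p⊕ b _))
  lin (b ∷ B) (false ∷ s) = lin B s
  f : ∀ a → Span B a → ∃[ s ] lincomb (map p B) s ≡ p a
  f a (s , refl) = s , lin B s

-- Dimension and connectivity

module _ {n : ℕ} where

  ∉⇒lookup : ∀ {X : Subset n} {v} → v ∉ X → lookup X v ≡ false
  ∉⇒lookup {X} {v} v∉X with lookup X v in eq
  ... | true = contradiction (Vecₚ.lookup⇒[]= v X eq) v∉X
  ... | false = refl

  ∈⇒lookup : ∀ {X : Subset n} {v} → v ∈ X → lookup X v ≡ true
  ∈⇒lookup = Vecₚ.[]=⇒lookup

  lookup⇒∉ : ∀ {X : Subset n} {v} → lookup X v ≡ false → v ∉ X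
  lookup⇒∉ {X} e v∈X with () ← trans (sym e) (∈⇒lookup v∈X)

  ∈-supp : ∀ (a : Vec K n) {v} → lookup a v ≢ O → v ∈ supp a
  ∈-supp a {v} a≢ = Vecₚ.lookup⇒[]= v _ (trans (Vecₚ.lookup-map v _ a) (f (lookup a v) a≢))
    where
    f : ∀ x → x ≢ O → not (isZero {n} x) ≡ true
    f O h = contradiction refl h
    f α _ = refl
    f β _ = refl
    f γ _ = refl

  supp-∈ : ∀ (a : Vec K n) {v} → v ∈ supp a → lookup a v ≢ O
  supp-∈ a {v} v∈ a≡O with () ← trans (sym (∈⇒lookup v∈))
    (trans (Vecₚ.lookup-map v _ a) (cong (λ x → not (isZero {n} x)) a≡O))

  ∁-involutive : ∀ (X : Subset n) → ∁ (∁ X) ≡ X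
  ∁-involutive X = ⊆-antisym (λ h → x∉∁p⇒x∈p (x∈∁p⇒x∉p h)) (λ h → x∉p⇒x∈∁p (x∈p⇒x∉∁p h))

  ∉-∪ : ∀ {X Y : Subset n} {v} → v ∉ X → v ∉ Y → v ∉ X ∪ Y
  ∉-∪ {X} {Y} p q h = [ p , q ]′ (x∈p∪q⁻ X Y h)

  ∉-∪⁻ˡ : ∀ {X Y : Subset n} {v} → v ∉ X ∪ Y → v ∉ X
  ∉-∪⁻ˡ h = h ∘ x∈p∪q⁺ ∘ inj₁

  ∉-∪⁻ʳ : ∀ {X Y : Subset n} {v} → v ∉ X ∪ Y → v ∉ Y
  ∉-∪⁻ʳ {X} h = h ∘ x∈p∪q⁺ {p = X} ∘ inj₂

  ∪-inj₁ : ∀ {X : Subset n} Y {v} → v ∈ X → v ∈ X ∪ Y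
  ∪-inj₁ Y h = x∈p∪q⁺ (inj₁ h)

  ∪-inj₂ : ∀ (X : Subset n) {Y v} → v ∈ Y → v ∈ X ∪ Y
  ∪-inj₂ X h = x∈p∪q⁺ {p = X} (inj₂ h)

  ∈-insert : ∀ (X : Subset n) v → v ∈ X ∪ ⁅ v ⁆
  ∈-insert X v = ∪-inj₂ X (x∈⁅x⁆ v)

  ∉-insert : ∀ {X : Subset n} {v i} → i ∉ X → i ≢ v → i ∉ X ∪ ⁅ v ⁆
  ∉-insert i∉X i≢v = ∉-∪ i∉X (x≢y⇒x∉⁅y⁆ i≢v)

  ∈-insert⁻ : ∀ (X : Subset n) {v i} → i ∈ X ∪ ⁅ v ⁆ → i ∈ X ⊎ i ≡ v
  ∈-insert⁻ X {v} h with x∈p∪q⁻ X ⁅ v ⁆ h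
  ... | inj₁ p = inj₁ p
  ... | inj₂ p = inj₂ (x∈⁅y⁆⇒x≡y v p)

  ∈-remove⁻ : ∀ (X : Subset n) v {i} → i ∈ X - v → i ∈ X × i ≢ v
  ∈-remove⁻ X v h = p─q⊆p X ⁅ v ⁆ h , λ { refl → ∉-remove X v h }
    where
    ∉-remove : ∀ {n} (X : Subset n) v → v ∉ X - v
    ∉-remove (x ∷ X) zero ()
    ∉-remove (x ∷ X) (suc v) (Data.Vec.there h) = ∉-remove X v h

  remove-insert : ∀ {X : Subset n} {v} → v ∈ X → (X - v) ∪ ⁅ v ⁆ ≡ X
  remove-insert {X} {v} v∈X = ⊆-antisym
    (λ h → [ proj₁ ∘ ∈-remove⁻ X v , (λ { refl → v∈X }) ]′ (∈-insert⁻ (X - v) h))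
    (λ {i} h → f i h (i Finₚ.≟ v))
    where
    f : ∀ i → i ∈ X → Dec (i ≡ v) → i ∈ (X - v) ∪ ⁅ v ⁆
    f i h (yes refl) = ∈-insert (X - v) v
    f i h (no i≢v) = ∪-inj₁ ⁅ v ⁆ (x∈p∧x≢y⇒x∈p-y h i≢v)

  ∁-insert : ∀ {X : Subset n} {v} → v ∉ X → ∁ (X ∪ ⁅ v ⁆) ∪ ⁅ v ⁆ ≡ ∁ X
  ∁-insert {X} {v} v∉X = ⊆-antisym
    (λ h → [ (λ p → x∉p⇒x∈∁p (∉-∪⁻ˡ (x∈∁p⇒x∉p p))) , (λ { refl → x∉p⇒x∈∁p v∉X }) ]′
             (∈-insert⁻ (∁ (X ∪ ⁅ v ⁆)) h))
    (λ {i} h → f i h (i Finₚ.≟ v))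
    where
    f : ∀ i → i ∈ ∁ X → Dec (i ≡ v) → i ∈ ∁ (X ∪ ⁅ v ⁆) ∪ ⁅ v ⁆
    f i h (yes refl) = ∈-insert (∁ (X ∪ ⁅ v ⁆)) v
    f i h (no i≢v) = ∪-inj₁ ⁅ v ⁆ (x∉p⇒x∈∁p (∉-insert (x∈∁p⇒x∉p h) i≢v))

∣∪∣+∣∩∣ : ∀ {n} (X Y : Subset n) → ∣ X ∪ Y ∣ + ∣ X ∩ Y ∣ ≡ ∣ X ∣ + ∣ Y ∣
∣∪∣+∣∩∣ [] [] = refl
∣∪∣+∣∩∣ (true ∷ X) (true ∷ Y) = cong suc (trans (ℕₚ.+-suc _ _)
  (trans (cong suc (∣∪∣+∣∩∣ X Y)) (sym (ℕₚ.+-suc _ _))))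
∣∪∣+∣∩∣ (true ∷ X) (false ∷ Y) = cong suc (∣∪∣+∣∩∣ X Y)
∣∪∣+∣∩∣ (false ∷ X) (true ∷ Y) = trans (cong suc (∣∪∣+∣∩∣ X Y)) (sym (ℕₚ.+-suc _ _))
∣∪∣+∣∩∣ (false ∷ X) (false ∷ Y) = ∣∪∣+∣∩∣ X Y

∣X∣+∣∁X∣ : ∀ {n} (X : Subset n) → ∣ X ∣ + ∣ ∁ X ∣ ≡ n
∣X∣+∣∁X∣ [] = refl
∣X∣+∣∁X∣ (true ∷ X) = cong suc (∣X∣+∣∁X∣ X)
∣X∣+∣∁X∣ (false ∷ X) = trans (ℕₚ.+-suc _ _) (cong suc (∣X∣+∣∁X∣ X))

∣∪∣≤ : ∀ {n} (X Y : Subset n) → ∣ X ∪ Y ∣ ≤ ∣ X ∣ + ∣ Y ∣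
∣∪∣≤ X Y = ℕₚ.≤-trans (ℕₚ.m≤m+n _ _) (ℕₚ.≤-reflexive (∣∪∣+∣∩∣ X Y))

∣insert∣ : ∀ {n} {X : Subset n} {v} → v ∉ X → ∣ X ∪ ⁅ v ⁆ ∣ ≡ suc ∣ X ∣
∣insert∣ {n} {X} {v} v∉X = begin
  ∣ X ∪ ⁅ v ⁆ ∣                  ≡⟨ ℕₚ.+-identityʳ _ ⟨
  ∣ X ∪ ⁅ v ⁆ ∣ + 0              ≡⟨ cong (∣ X ∪ ⁅ v ⁆ ∣ +_) empty ⟨
  ∣ X ∪ ⁅ v ⁆ ∣ + ∣ X ∩ ⁅ v ⁆ ∣ ≡⟨ ∣∪∣+∣∩∣ X ⁅ v ⁆ ⟩
  ∣ X ∣ + ∣ ⁅ v ⁆ ∣              ≡⟨ cong (∣ X ∣ +_) (∣⁅x⁆∣≡1 v) ⟩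
  ∣ X ∣ + 1                      ≡⟨ ℕₚ.+-comm _ 1 ⟩
  suc ∣ X ∣                      ∎
  where
  open ≡-Reasoning
  none : ∀ {i} → i ∉ X ∩ ⁅ v ⁆
  none h with x∈p∩q⁻ X ⁅ v ⁆ h
  ... | p , q with refl ← x∈⁅y⁆⇒x≡y v q = v∉X p
  empty : ∣ X ∩ ⁅ v ⁆ ∣ ≡ 0
  empty = trans (cong ∣_∣ (⊆-antisym {i = X ∩ ⁅ v ⁆} {j = ⊥} (λ h → contradiction h none) (⊆-min _)))
            (∣⊥∣≡0 n)

∣remove∣ : ∀ {n} {X : Subset n} {v} → v ∈ X → ∣ X ∣ ≡ suc ∣ X - v ∣
∣remove∣ {X = X} {v} v∈X = trans (sym (cong ∣_∣ (remove-insert v∈X)))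
  (∣insert∣ (λ h → proj₂ (∈-remove⁻ X v h) refl))

abstract
  nonempty-∣∣ : ∀ {n} (X : Subset n) → 1 ≤ ∣ X ∣ → Nonempty X
  nonempty-∣∣ {n} X h with nonempty? X
  ... | yes p = p
  ... | no ¬p = contradiction h (subst (λ k → ¬ 1 ≤ k)
        (sym (trans (cong ∣_∣ (Empty-unique ¬p)) (∣⊥∣≡0 n))) λ ())

∈⇒1≤∣∣ : ∀ {n} {X : Subset n} {v} → v ∈ X → 1 ≤ ∣ X ∣
∈⇒1≤∣∣ v∈X = subst (1 ≤_) (sym (∣remove∣ v∈X)) (s≤s z≤n)

∈⇒2≤∣∣ : ∀ {n} {X : Subset n} {v w} → v ∈ X → w ∈ X → v ≢ w → 2 ≤ ∣ X ∣
∈⇒2≤∣∣ v∈X w∈X v≢w =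
  subst (2 ≤_) (sym (∣remove∣ v∈X)) (s≤s (∈⇒1≤∣∣ (x∈p∧x≢y⇒x∈p-y w∈X (v≢w ∘ sym))))

-- Linear arithmetic by hand: pad both sides with `k` until they match a known inequality, leaving
-- equations to the ring solver.
by-cancel : ∀ k {p q m n} → p ≤ q → m + k ≡ p → n + k ≡ q → m ≤ n
by-cancel k {m = m} {n} p≤q refl refl = ℕₚ.+-cancelʳ-≤ k m n p≤q

⟪,⟫-single : ∀ {n} (a b : Vec K n) u → ⟪ lookup a u , lookup b u ⟫K ≡ true →
  (∀ v → v ≢ u → ⟪ lookup a v , lookup b v ⟫K ≡ false) → ⟪ a , b ⟫ ≡ true
⟪,⟫-single (x ∷ a) (y ∷ b) zero e h = cong₂ _xor_ e (allFalse a b λ v → h (suc v) λ ())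
  where
  allFalse : ∀ {n} (a b : Vec K n) → (∀ v → ⟪ lookup a v , lookup b v ⟫K ≡ false) → ⟪ a , b ⟫ ≡ false
  allFalse [] [] h = refl
  allFalse (x ∷ a) (y ∷ b) h = cong₂ _xor_ (h zero) (allFalse a b (h ∘ suc))
⟪,⟫-single (x ∷ a) (y ∷ b) (suc u) e h =
  cong₂ _xor_ (h zero λ ()) (⟪,⟫-single a b u e λ v v≢u → h (suc v) (v≢u ∘ Finₚ.suc-injective))

coord : ∀ {n} → Fin n → K → Functional n
coord u x = (λ a → ⟪ lookup a u , x ⟫K) ,
  λ a b → trans (cong ⟪_, x ⟫K (lookup-⊕ u a b)) (⟪⟫K-+K (lookup a u) (lookup b u) x)

another : ∀ x → x ≢ O → ∃[ y ] ⟪ x , y ⟫K ≡ true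
another O h = contradiction refl h
another α _ = β , refl
another β _ = α , refl
another γ _ = α , refl

α≢O : α ≢ O
α≢O ()

module Connectivity {n : ℕ} (L : Vec K n → Set) (sys : IsotropicSystem n L) where

  L-⊕ : ∀ {a b} → L a → L b → L (a ⊕ b)
  L-⊕ = proj₂ (proj₁ sys) _ _

  L-iso : ∀ {a b} → L a → L b → ⟪ a , b ⟫ ≡ false
  L-iso = proj₁ (proj₂ sys) _ _

  -- Unlike `SuppIn`, this form can be cut out by functionals, vertex by vertex.
  LX : Subset n → Vec K n → Set
  LX X a = L a × (∀ v → v ∉ X → lookup a v ≡ O)

  LX≐SuppIn : ∀ X → LX X ≐ SuppIn L X
  LX≐SuppIn X a = mk⇔ (λ { (p , q) → p , λ {v} v∈ → f v (q v) v∈ })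
    λ { (p , q) → p , λ v v∉X → g v (λ h → v∉X (q (∈-supp a h))) }
    where
    f : ∀ v → (v ∉ X → lookup a v ≡ O) → v ∈ supp a → v ∈ X
    f v q v∈ with v ∈? X
    ... | yes p = p
    ... | no p = contradiction (q p) (supp-∈ a v∈)
    g : ∀ v → ¬ (lookup a v ≢ O) → lookup a v ≡ O
    g v h with lookup a v ≟K O
    ... | yes p = p
    ... | no p = contradiction p h

  LX-mono : ∀ {X Y a} → X ⊆ Y → LX X a → LX Y a
  LX-mono X⊆Y (p , q) = p , λ v v∉Y → q v (v∉Y ∘ X⊆Y)

  -- Being zero for `u` in `X` lets `killers` run over all vertices uniformly. Pairing with both `α`
  -- and `β`, a basis of `K`, detects a nonzero value.
  vanish : Subset n → Fin n → K → Functional n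
  vanish X u x with lookup X u
  ... | true = (λ _ → false) , λ _ _ → refl
  ... | false = coord u x

  killers : Subset n → List (Fin n) → List (Functional n)
  killers X [] = []
  killers X (v ∷ vs) = vanish X v α ∷ vanish X v β ∷ killers X vs

  Kills : (Vec K n → Set) → Subset n → (Fin n → Set) → Vec K n → Set
  Kills W X P a = W a × (∀ v → P v → v ∉ X → lookup a v ≡ O)

  killers-spec : ∀ W X vs → (W ∩Kers killers X vs) ≐ Kills W X (_∈ˡ vs)
  killers-spec W X [] a = mk⇔ (λ p → p , λ _ ()) proj₁
  killers-spec W X (u ∷ vs) a = mk⇔
    (λ h → let ((w , e) , e') , g = to (ih a) h in w , λ
      { v (here refl) v∉ → αβ u e e' v∉ ; v (there v∈) v∉ → g v v∈ v∉ })
    (λ { (w , h) → from (ih a) (((w , zer α (h u (here refl))) , zer β (h u (here refl))) , λ v → h v ∘ there) })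
    where
    ih = killers-spec ((W ∩Ker proj₁ (vanish X u α)) ∩Ker proj₁ (vanish X u β)) X vs
    αβ : ∀ u → proj₁ (vanish X u α) a ≡ false → proj₁ (vanish X u β) a ≡ false → u ∉ X → lookup a u ≡ O
    αβ u e e' u∉ with lookup X u | ∉⇒lookup u∉
    ... | false | _ with lookup a u
    ...   | O = refl
    αβ u e () u∉ | false | _ | α
    αβ u () e' u∉ | false | _ | β
    αβ u () e' u∉ | false | _ | γ
    zer : ∀ x → (u ∉ X → lookup a u ≡ O) → proj₁ (vanish X u x) a ≡ false
    zer x h with lookup X u in eq
    ... | true = refl
    ... | false = ⟪O,⟫K x (h (lookup⇒∉ eq))

  abstract
    hasDim : ∀ X → ∃[ d ] HasDim (LX X) d
    hasDim X with cuts (killers X (allFin n)) (proj₂ (proj₂ sys))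
    ... | d , hd = d , HasDim-cong (λ a → mk⇔
        (λ h → let p , q = to (killers-spec L X (allFin n) a) h in p , λ v → q v (∈-allFin v))
        λ { (p , q) → from (killers-spec L X (allFin n) a) (p , λ v _ → q v) }) hd

  d : Subset n → ℕ
  d X = proj₁ (hasDim X)

  d-HasDim : ∀ X → HasDim (LX X) (d X)
  d-HasDim X = proj₂ (hasDim X)

  d-submodular : ∀ X Y → d X + d Y ≤ d (X ∪ Y) + d (X ∩ Y)
  d-submodular X Y = cuts-submodular (killers Y (allFin n))
    (λ a → LX-mono (∪-inj₁ Y)) (d-HasDim X) (d-HasDim (X ∪ Y))
    (HasDim-cong (λ a → mk⇔
      (λ { (p , q) → from (killers-spec (LX X) Y (allFin n) a)
             ((p , λ v v∉ → q v (v∉ ∘ proj₁ ∘ x∈p∩q⁻ X Y)) , λ v _ v∉ → q v (v∉ ∘ proj₂ ∘ x∈p∩q⁻ X Y)) })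
      (λ h → let (p , q) , r = to (killers-spec (LX X) Y (allFin n) a) h in
             p , λ v v∉ → both a q r v v∉ (v ∈? X))) (d-HasDim (X ∩ Y)))
    (HasDim-cong (λ a → mk⇔
      (λ { (p , q) → from (killers-spec (LX (X ∪ Y)) Y (allFin n) a)
             ((p , λ v v∉ → q v (∉-∪⁻ʳ {X = X} v∉)) , λ v _ → q v) })
      (λ h → let (p , q) , r = to (killers-spec (LX (X ∪ Y)) Y (allFin n) a) h in
             p , λ v → r v (∈-allFin v))) (d-HasDim Y))
    where
    both : ∀ (a : Vec K n) → (∀ v → v ∉ X → lookup a v ≡ O) →
           (∀ v → v ∈ˡ allFin n → v ∉ Y → lookup a v ≡ O) →
           ∀ v → v ∉ X ∩ Y → Dec (v ∈ X) → lookup a v ≡ O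
    both a q r v v∉ (yes v∈X) = r v (∈-allFin v) λ v∈Y → v∉ (x∈p∩q⁺ (v∈X , v∈Y))
    both a q r v v∉ (no v∉X) = q v v∉X

  -- The two possible increments of d when a vertex u is added, one for each coordinate at u.
  Step : Subset n → Fin n → K → ℕ → Set
  Step P u x e =
    ((d Q ≡ e × (∀ a → LX Q a → ⟪ lookup a u , x ⟫K ≡ false))
       ⊎ (d Q ≡ suc e × ∃[ a ] (LX Q a × ⟪ lookup a u , x ⟫K ≡ true)))
    × ((e ≡ d P × (∀ a → LX Q a → ⟪ lookup a u , x ⟫K ≡ false → lookup a u ≡ O))
       ⊎ (e ≡ suc (d P) × ∃[ a ] (LX Q a × lookup a u ≡ x)))
    where Q = P ∪ ⁅ u ⁆

  -- The number `e` counts the vectors with value `O` or `x` at `u`; a second cut, by some `y` that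
  -- pairs with `x`, leaves those that vanish at `u`, which is L_P. The intermediate space is kept
  -- because it is also the one that the elementary minor at `u` and `x` sees.
  step′ : ∀ P u x → u ∉ P → x ≢ O →
          ∃[ e ] (HasDim (LX (P ∪ ⁅ u ⁆) ∩Ker proj₁ (coord u x)) e × Step P u x e)
  step′ P u x u∉P x≢O with another x x≢O
  ... | y , xy with cut (proj₁ (coord u x)) (proj₂ (coord u x)) (d-HasDim (P ∪ ⁅ u ⁆))
  ...   | e , c , hd with cut (proj₁ (coord u y)) (proj₂ (coord u y)) hd
  ...     | f , c' , hd' = e , hd , first c , second (sym f≡dP) c'
    where
    Q = P ∪ ⁅ u ⁆
    xy≢ : ∀ z → ⟪ z , x ⟫K ≡ false → ⟪ z , y ⟫K ≡ false → z ≡ O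
    xy≢ z p q with ⟪⟫K-false⁻ p x≢O
    ... | inj₁ r = r
    ... | inj₂ refl with () ← trans (sym q) xy
    x-of : ∀ z → ⟪ z , x ⟫K ≡ false → ⟪ z , y ⟫K ≡ true → z ≡ x
    x-of z p q with ⟪⟫K-false⁻ p x≢O
    ... | inj₁ refl with () ← q
    x-of z p q | inj₂ r = r
    W = (LX Q ∩Ker proj₁ (coord u x)) ∩Ker proj₁ (coord u y)
    f≡dP : d P ≡ f
    f≡dP = HasDim-unique (λ a → mk⇔
      (λ { (p , q) → ((p , λ v v∉ → q v (∉-∪⁻ˡ v∉)) , ⟪O,⟫K x (q u u∉P)) , ⟪O,⟫K y (q u u∉P) })
      (λ { (((p , q) , r) , s) → p , λ v v∉ → out a q r s v v∉ (v Finₚ.≟ u) }))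
      (d-HasDim P) hd'
      where
      out : ∀ (a : Vec K n) → (∀ v → v ∉ Q → lookup a v ≡ O) → ⟪ lookup a u , x ⟫K ≡ false →
            ⟪ lookup a u , y ⟫K ≡ false → ∀ v → v ∉ P → Dec (v ≡ u) → lookup a v ≡ O
      out a q r s v v∉ (yes refl) = xy≢ _ r s
      out a q r s v v∉ (no v≢u) = q v (∉-insert v∉ v≢u)
    first : ∀ {d e} → Cut (LX Q) (proj₁ (coord u x)) d e → (d ≡ e × _) ⊎ (d ≡ suc e × _)
    first (flat h) = inj₁ (refl , h)
    first (drop p q) = inj₂ (refl , _ , p , q)
    second : ∀ {e f} → f ≡ d P → Cut (LX Q ∩Ker proj₁ (coord u x)) (proj₁ (coord u y)) e f →
             (e ≡ d P × (∀ a → LX Q a → ⟪ lookup a u , x ⟫K ≡ false → lookup a u ≡ O))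
             ⊎ (e ≡ suc (d P) × ∃[ a ] (LX Q a × lookup a u ≡ x))
    second refl (flat h) = inj₁ (refl , λ a p q → xy≢ _ q (h a (p , q)))
    second refl (drop (p , q) r) = inj₂ (refl , _ , p , x-of _ q r)

  abstract
    step-HasDim : ∀ P u x → u ∉ P → x ≢ O →
      ∃[ e ] (HasDim (LX (P ∪ ⁅ u ⁆) ∩Ker proj₁ (coord u x)) e × Step P u x e)
    step-HasDim = step′

  step : ∀ P u x → u ∉ P → x ≢ O → ∃[ e ] Step P u x e
  step P u x u∉P x≢O = let e , _ , st = step-HasDim P u x u∉P x≢O in e , st

  L-single : ∀ {a b} → L a → L b → ∀ u →
             (∀ v → v ≢ u → ⟪ lookup a v , lookup b v ⟫K ≡ false) → ⟪ lookup a u , lookup b u ⟫K ≡ false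
  L-single {a} {b} La Lb u h with ⟪ lookup a u , lookup b u ⟫K in eq
  ... | false = refl
  ... | true with () ← trans (sym (L-iso La Lb)) (⟪,⟫-single a b u eq h)

  -- The supports can meet only in `u`, so isotropy leaves a single term.
  orth : ∀ {X u a b} → LX (X ∪ ⁅ u ⁆) a → LX (∁ X) b → ⟪ lookup a u , lookup b u ⟫K ≡ false
  orth {X} {u} {a} {b} (La , pa) (Lb , pb) = L-single La Lb u λ v v≢u → f v v≢u (v ∈? X)
    where
    f : ∀ v → v ≢ u → Dec (v ∈ X) → ⟪ lookup a v , lookup b v ⟫K ≡ false
    f v v≢u (yes v∈X) = ⟪,O⟫K (lookup a v) (pb v (x∈p⇒x∉∁p v∈X))
    f v v≢u (no v∉X) = ⟪O,⟫K (lookup b v) (pa v (∉-insert v∉X v≢u))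

  zero-HasDim : HasDim {n} (_≡ 𝟎) 0
  zero-HasDim = [] , (λ { [] _ → refl }) , λ a → mk⇔ (λ a≡𝟎 → [] , sym a≡𝟎) λ { ([] , e) → sym e }

  LX⊥≐𝟎 : LX ⊥ ≐ (_≡ 𝟎)
  LX⊥≐𝟎 a = mk⇔ (λ { (_ , p) → lookup-ext λ i → trans (p i ∉⊥) (sym (lookup-𝟎 i)) })
    λ { refl → proj₁ (proj₁ sys) , λ v _ → lookup-𝟎 v }

  L₀≡0 : d ⊥ ≡ 0
  L₀≡0 = HasDim-unique LX⊥≐𝟎 (d-HasDim ⊥) zero-HasDim

  d⊤≡n : d ⊤ ≡ n
  d⊤≡n = HasDim-unique (λ a → mk⇔ proj₁ λ p → p , λ v v∉ → contradiction ∈⊤ v∉)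
    (d-HasDim ⊤) (proj₂ (proj₂ sys))

  d-step≤2 : ∀ P u → u ∉ P → d (P ∪ ⁅ u ⁆) ≤ 2 + d P
  d-step≤2 P u u∉P with step P u α u∉P (λ ())
  ... | e , inj₁ (p , _) , inj₁ (refl , _) = ℕₚ.≤-trans (ℕₚ.≤-reflexive p) (ℕₚ.m≤n+m _ 2)
  ... | e , inj₁ (p , _) , inj₂ (refl , _) = ℕₚ.≤-trans (ℕₚ.≤-reflexive p) (ℕₚ.m≤n+m _ 1)
  ... | e , inj₂ (p , _) , inj₁ (refl , _) = ℕₚ.≤-trans (ℕₚ.≤-reflexive p) (ℕₚ.m≤n+m _ 1)
  ... | e , inj₂ (p , _) , inj₂ (refl , _) = ℕₚ.≤-reflexive p

  d-step≤1 : ∀ P u x → u ∉ P → x ≢ O → (∀ a → LX (P ∪ ⁅ u ⁆) a → ⟪ lookup a u , x ⟫K ≡ false) →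
             d (P ∪ ⁅ u ⁆) ≤ 1 + d P
  d-step≤1 P u x u∉P x≢O h with step P u x u∉P x≢O
  ... | e , inj₁ (p , _) , inj₁ (refl , _) = ℕₚ.≤-trans (ℕₚ.≤-reflexive p) (ℕₚ.m≤n+m _ 1)
  ... | e , inj₁ (p , _) , inj₂ (refl , _) = ℕₚ.≤-reflexive p
  ... | e , inj₂ (p , a , LXa , t) , _ with () ← trans (sym t) (h a LXa)

  d-step≡0 : ∀ P u → u ∉ P → (∀ a → LX (P ∪ ⁅ u ⁆) a → lookup a u ≡ O) → d (P ∪ ⁅ u ⁆) ≡ d P
  d-step≡0 P u u∉P h with step P u α u∉P (λ ())
  ... | e , inj₁ (p , _) , inj₁ (q , _) = trans p q
  ... | e , inj₁ (p , _) , inj₂ (q , a , LXa , t) with () ← trans (sym t) (h a LXa)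
  d-step≡0 P u u∉P h | e , inj₂ (p , a , LXa , t) , _ with () ← trans (sym t) (⟪O,⟫K α (h a LXa))

  d-step≥1 : ∀ P u {a} → u ∉ P → LX (P ∪ ⁅ u ⁆) a → lookup a u ≢ O → 1 + d P ≤ d (P ∪ ⁅ u ⁆)
  d-step≥1 P u {a} u∉P LXa a≢O with step P u α u∉P (λ ())
  ... | e , inj₁ (p , h) , inj₁ (q , h') = contradiction (h' a LXa (h a LXa)) a≢O
  ... | e , inj₁ (p , _) , inj₂ (refl , _) = ℕₚ.≤-reflexive (sym p)
  ... | e , inj₂ (p , _) , inj₁ (refl , _) = ℕₚ.≤-reflexive (sym p)
  ... | e , inj₂ (p , _) , inj₂ (refl , _) = ℕₚ.≤-trans (ℕₚ.m≤n+m _ 1) (ℕₚ.≤-reflexive (sym p))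

  d-step≥2 : ∀ P u {a b} → u ∉ P → LX (P ∪ ⁅ u ⁆) a → LX (P ∪ ⁅ u ⁆) b →
             lookup a u ≢ O → lookup b u ≢ O → lookup a u ≢ lookup b u → 2 + d P ≤ d (P ∪ ⁅ u ⁆)
  d-step≥2 P u {a} {b} u∉P LXa LXb a≢O b≢O a≢b with step P u (lookup a u) u∉P a≢O
  ... | e , inj₁ (p , h) , _ with () ← trans (sym (h b LXb)) (⟪⟫K-true b≢O a≢O (a≢b ∘ sym))
  d-step≥2 P u {a} {b} u∉P LXa LXb a≢O b≢O a≢b | e , inj₂ (p , _) , inj₁ (q , h) =
    contradiction (h a LXa (⟪⟫K-same (lookup a u))) a≢O
  d-step≥2 P u u∉P LXa LXb a≢O b≢O a≢b | e , inj₂ (p , _) , inj₂ (refl , _) = ℕₚ.≤-reflexive (sym p)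

  d-step-flat⁻ : ∀ P u → u ∉ P → d P < d (P ∪ ⁅ u ⁆) → ∃[ a ] (LX (P ∪ ⁅ u ⁆) a × lookup a u ≢ O)
  d-step-flat⁻ P u u∉P lt with step P u α u∉P (λ ())
  ... | e , inj₁ (p , _) , inj₁ (q , _) = contradiction (sym (trans p q)) (ℕₚ.<⇒≢ lt)
  ... | e , inj₂ (p , a , LXa , t) , _ = a , LXa , proj₁ (⟪⟫K-true⁻ t)
  ... | e , inj₁ _ , inj₂ (q , a , LXa , refl-x) = a , LXa , λ a≡O → α≢O (trans (sym refl-x) a≡O)
  -- By isotropy, the values at u of L_{X ∪ u} and of L_{Y ∪ u} are orthogonal when X, Y, u partition V.
  d-dual-step : ∀ X u → u ∉ X → d (X ∪ ⁅ u ⁆) + d (∁ X) ≤ 2 + (d X + d (∁ (X ∪ ⁅ u ⁆)))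
  d-dual-step X u u∉X = ≤₀ (step X u α u∉X (λ ()))
    where
    Y = ∁ (X ∪ ⁅ u ⁆)
    u∉Y : u ∉ Y
    u∉Y h = x∈∁p⇒x∉p h (∈-insert X u)
    Y∪u≡ : Y ∪ ⁅ u ⁆ ≡ ∁ X
    Y∪u≡ = ∁-insert u∉X
    orth′ : ∀ {a b} → LX (X ∪ ⁅ u ⁆) a → LX (Y ∪ ⁅ u ⁆) b → ⟪ lookup a u , lookup b u ⟫K ≡ false
    orth′ p q = orth p (subst (λ Z → LX Z _) Y∪u≡ q)
    arrange : ∀ {p q r s t u} → p ≤ q + r → s ≤ t + u → p + s ≤ (q + t) + (r + u)
    arrange {q = q} {r} {t = t} {u} h k = ℕₚ.≤-trans (ℕₚ.+-mono-≤ h k) (ℕₚ.≤-reflexive (eq q r t u))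
      where
      eq : ∀ q r t u → (q + r) + (t + u) ≡ (q + t) + (r + u)
      eq = solve-∀
    ≤₁ : ∀ {a} → LX (X ∪ ⁅ u ⁆) a → lookup a u ≢ O →
         d (X ∪ ⁅ u ⁆) + d (Y ∪ ⁅ u ⁆) ≤ 2 + (d X + d Y)
    ≤₁ {a} p a≢O with step Y u (lookup a u) u∉Y a≢O
    ... | e , inj₂ (_ , b , q , t) , _ with () ← trans (sym t)
            (trans (⟪⟫K-comm (lookup b u) (lookup a u)) (orth′ p q))
    ≤₁ {a} p a≢O | e , inj₁ (r , _) , inj₁ (s , _) =
      arrange {q = 2} {t = 0} (d-step≤2 X u u∉X) (ℕₚ.≤-reflexive (trans r s))
    ≤₁ {a} p a≢O | e , inj₁ (r , _) , inj₂ (s , b , q , t) =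
      arrange {q = 1} {t = 1}
        (d-step≤1 X u (lookup a u) u∉X a≢O λ a' p' → trans (cong ⟪ lookup a' u ,_⟫K (sym t)) (orth′ p' q))
        (ℕₚ.≤-reflexive (trans r s))
    ≤₀ : ∃[ e ] Step X u α e → d (X ∪ ⁅ u ⁆) + d (∁ X) ≤ 2 + (d X + d Y)
    ≤₀ st rewrite sym Y∪u≡ = go st
      where
      go : ∃[ e ] Step X u α e → d (X ∪ ⁅ u ⁆) + d (Y ∪ ⁅ u ⁆) ≤ 2 + (d X + d Y)
      go (e , inj₁ (p , _) , inj₁ (q , _)) =
        arrange {q = 0} {t = 2} (ℕₚ.≤-reflexive (trans p q)) (d-step≤2 Y u u∉Y)
      go (e , inj₂ (p , a , LXa , t) , _) = ≤₁ LXa (proj₁ (⟪⟫K-true⁻ t))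
      go (e , inj₁ _ , inj₂ (q , a , LXa , t)) = ≤₁ LXa λ a≡O → α≢O (trans (sym t) a≡O)
  -- Moving one vertex across is `d-dual-step`, so dim L = n enters only at the empty set. Applying
  -- the inequality to the complement as well gives the equality below.
  d-symmetric-≤ : ∀ k X → ∣ X ∣ ≡ k → d X + ∣ ∁ X ∣ ≤ d (∁ X) + ∣ X ∣
  d-symmetric-≤ zero X e with nonempty? X
  ... | yes (v , v∈X) = contradiction (∈⇒1≤∣∣ v∈X) (subst (λ k → ¬ 1 ≤ k) (sym e) λ ())
  ... | no ¬ne rewrite Empty-unique ¬ne = begin
    d ⊥ + ∣ ∁ (⊥ {n}) ∣       ≡⟨ cong (_+ ∣ ∁ (⊥ {n}) ∣) L₀≡0 ⟩
    ∣ ∁ (⊥ {n}) ∣             ≤⟨ ∣p∣≤n (∁ (⊥ {n})) ⟩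
    n                         ≡⟨ d⊤≡n ⟨
    d ⊤                       ≡⟨ cong d (⊆-antisym (λ _ → x∉p⇒x∈∁p ∉⊥) (λ _ → ∈⊤)) ⟩
    d (∁ ⊥)                   ≤⟨ ℕₚ.m≤m+n _ _ ⟩
    d (∁ ⊥) + ∣ ⊥ {n} ∣       ∎
    where open ℕₚ.≤-Reasoning
  d-symmetric-≤ (suc k) X e with nonempty-∣∣ X (subst (1 ≤_) (sym e) (s≤s z≤n))
  ... | u , u∈X = subst (λ Z → d Z + ∣ ∁ Z ∣ ≤ d (∁ Z) + ∣ Z ∣) (remove-insert u∈X) main
    where
    X' = X - u
    u∉X' : u ∉ X'
    u∉X' h = proj₂ (∈-remove⁻ X u h) refl
    Q = X' ∪ ⁅ u ⁆
    cardQ : ∣ Q ∣ ≡ suc ∣ X' ∣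
    cardQ = ∣insert∣ u∉X'
    card∁ : ∣ ∁ X' ∣ ≡ suc ∣ ∁ Q ∣
    card∁ = trans (sym (cong ∣_∣ (∁-insert u∉X'))) (∣insert∣ (λ h → x∈∁p⇒x∉p h (∈-insert X' u)))
    rearrange : ∀ {dQ d∁X' dX' d∁Q a c cQ b} → dQ + d∁X' ≤ 2 + (dX' + d∁Q) → dX' + c ≤ d∁X' + a →
                b ≡ suc a → c ≡ suc cQ → dQ + cQ ≤ d∁Q + b
    rearrange {dQ} {d∁X'} {dX'} {d∁Q} {a} {c} {cQ} h k refl refl = by-cancel (d∁X' + dX' + 1)
      (ℕₚ.+-mono-≤ h k) (lhs dQ cQ d∁X' dX') (rhs d∁Q a d∁X' dX')
      where
      lhs : ∀ p q r s → (p + q) + (r + s + 1) ≡ (p + r) + (s + suc q)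
      lhs = solve-∀
      rhs : ∀ p q r s → (p + suc q) + (r + s + 1) ≡ (2 + (s + p)) + (r + q)
      rhs = solve-∀
    main : d Q + ∣ ∁ Q ∣ ≤ d (∁ Q) + ∣ Q ∣
    main = rearrange (d-dual-step X' u u∉X')
      (d-symmetric-≤ k X' (ℕₚ.suc-injective (trans (sym (∣remove∣ u∈X)) e))) cardQ card∁

  d-symmetric : ∀ X → d X + ∣ ∁ X ∣ ≡ d (∁ X) + ∣ X ∣
  d-symmetric X = ℕₚ.≤-antisym (d-symmetric-≤ _ X refl)
    (subst (λ Z → d (∁ X) + ∣ Z ∣ ≤ d Z + ∣ ∁ X ∣) (∁-involutive X) (d-symmetric-≤ _ (∁ X) refl))

  -- Submodularity on `X` and its complement gives d X + d (∁ X) ≤ n; adding the symmetry equation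
  -- gives 2 d X ≤ 2 ∣X∣. Hence the truncated subtraction in `c` is exact.
  d≤∣∣ : ∀ X → d X ≤ ∣ X ∣
  d≤∣∣ X = halve (ℕₚ.≤-trans (d-submodular X (∁ X)) bound) (d-symmetric X)
    where
    ∩≡⊥ : X ∩ ∁ X ≡ ⊥
    ∩≡⊥ = ⊆-antisym (λ h → let p , q = x∈p∩q⁻ X (∁ X) h in contradiction p (x∈∁p⇒x∉p q)) (⊆-min _)
    bound : d (X ∪ ∁ X) + d (X ∩ ∁ X) ≤ ∣ X ∣ + ∣ ∁ X ∣
    bound = ℕₚ.≤-reflexive (begin
      d (X ∪ ∁ X) + d (X ∩ ∁ X) ≡⟨ cong₂ (λ p q → d p + d q) (p∪∁p≡⊤ X) ∩≡⊥ ⟩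
      d ⊤ + d ⊥                 ≡⟨ cong₂ _+_ d⊤≡n L₀≡0 ⟩
      n + 0                     ≡⟨ ℕₚ.+-identityʳ n ⟩
      n                         ≡⟨ ∣X∣+∣∁X∣ X ⟨
      ∣ X ∣ + ∣ ∁ X ∣           ∎)
      where open ≡-Reasoning
    halve : ∀ {p q r s} → p + q ≤ r + s → p + s ≡ q + r → p ≤ r
    halve {p} {q} {r} {s} h e = ℕₚ.*-cancelˡ-≤ 2 (by-cancel (q + s) (ℕₚ.+-mono-≤ h (ℕₚ.≤-reflexive e))
        (l p q s) (rr q r s))
      where
      l : ∀ p q s → 2 * p + (q + s) ≡ (p + q) + (p + s)
      l = solve-∀
      rr : ∀ q r s → 2 * r + (q + s) ≡ (r + s) + (q + r)
      rr = solve-∀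

  abstract
    c : Subset n → ℕ
    c X = ∣ X ∣ ∸ d X

    c+d : ∀ X → c X + d X ≡ ∣ X ∣
    c+d X = ℕₚ.m∸n+n≡m (d≤∣∣ X)

  c-symmetric : ∀ X → c (∁ X) ≡ c X
  c-symmetric X = ℕₚ.+-cancelʳ-≡ (d (∁ X) + d X) _ _ (begin
    c (∁ X) + (d (∁ X) + d X) ≡⟨ ℕₚ.+-assoc (c (∁ X)) _ _ ⟨
    c (∁ X) + d (∁ X) + d X   ≡⟨ cong (_+ d X) (c+d (∁ X)) ⟩
    ∣ ∁ X ∣ + d X             ≡⟨ ℕₚ.+-comm _ (d X) ⟩
    d X + ∣ ∁ X ∣             ≡⟨ d-symmetric X ⟩
    d (∁ X) + ∣ X ∣           ≡⟨ cong (d (∁ X) +_) (c+d X) ⟨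
    d (∁ X) + (c X + d X)     ≡⟨ sw (d (∁ X)) (c X) (d X) ⟩
    c X + (d (∁ X) + d X)     ∎)
    where
    open ≡-Reasoning
    sw : ∀ p q r → p + (q + r) ≡ q + (p + r)
    sw = solve-∀

  c-submodular : ∀ X Y → c (X ∪ Y) + c (X ∩ Y) ≤ c X + c Y
  c-submodular X Y = by-cancel (d (X ∪ Y) + d (X ∩ Y) + (d X + d Y))
      (ℕₚ.+-mono-≤ (ℕₚ.≤-reflexive (∣∪∣+∣∩∣ X Y)) (d-submodular X Y))
      (trans (l (c (X ∪ Y)) (c (X ∩ Y)) (d (X ∪ Y)) (d (X ∩ Y)) (d X + d Y))
        (cong (_+ (d X + d Y)) (cong₂ _+_ (c+d (X ∪ Y)) (c+d (X ∩ Y)))))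
      (trans (r (c X) (c Y) (d X) (d Y) (d (X ∪ Y) + d (X ∩ Y)))
        (cong (_+ (d (X ∪ Y) + d (X ∩ Y))) (cong₂ _+_ (c+d X) (c+d Y))))
    where
    l : ∀ p q r s t → (p + q) + (r + s + t) ≡ ((p + r) + (q + s)) + t
    l = solve-∀
    r : ∀ p q r s t → (p + q) + (t + (r + s)) ≡ ((p + r) + (q + s)) + t
    r = solve-∀

  c-step : ∀ P u → u ∉ P → (∀ a → LX (P ∪ ⁅ u ⁆) a → lookup a u ≡ O) → c (P ∪ ⁅ u ⁆) ≡ suc (c P)
  c-step P u u∉P h = ℕₚ.+-cancelʳ-≡ (d P) _ _ (begin
    c (P ∪ ⁅ u ⁆) + d P           ≡⟨ cong (c (P ∪ ⁅ u ⁆) +_) (d-step≡0 P u u∉P h) ⟨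
    c (P ∪ ⁅ u ⁆) + d (P ∪ ⁅ u ⁆) ≡⟨ c+d (P ∪ ⁅ u ⁆) ⟩
    ∣ P ∪ ⁅ u ⁆ ∣                 ≡⟨ ∣insert∣ u∉P ⟩
    suc ∣ P ∣                     ≡⟨ cong suc (c+d P) ⟨
    suc (c P) + d P               ∎)
    where open ≡-Reasoning

  d≡0⇒zero : ∀ {X a} → d X ≡ 0 → LX X a → ∀ u → lookup a u ≡ O
  d≡0⇒zero {X} {a} d0 LXa u with lookup a u ≟K O
  ... | yes p = p
  ... | no a≢O = contradiction (Indep-size (a ∷ []) ind inW (d-HasDim X)) (subst (λ k → ¬ 1 ≤ k) (sym d0) λ ())
    where
    ind : Indep (a ∷ [])
    ind (false ∷ []) _ = refl
    ind (true ∷ []) e = contradiction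
      (trans (cong (λ b → lookup b u) (trans (sym (⊕-identityʳ a)) e)) (lookup-𝟎 u)) a≢O
    inW : ∀ s → LX X (lincomb (a ∷ []) s)
    inW (false ∷ []) = proj₁ (proj₁ sys) , λ v _ → lookup-𝟎 v
    inW (true ∷ []) = subst (LX X) (sym (⊕-identityʳ a)) LXa

  abstract
    1≤d⇒nonzero : ∀ {X} → 1 ≤ d X → ∃[ a ] (LX X a × ∃[ u ] lookup a u ≢ O)
    1≤d⇒nonzero {X} h with d X | d-HasDim X
    1≤d⇒nonzero {X} () | zero | _
    ... | suc k | B , ind , span
      with Finₚ.any? (λ u → ¬? (lookup (lincomb B (true ∷ replicate k false)) u ≟K O))
    ... | yes (u , a≢O) = _ , from (span _) (_ , refl) , u , a≢O
    ... | no none = contradiction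
      (Vecₚ.∷-injectiveˡ (ind (true ∷ replicate k false) (lookup-ext λ i → trans (zeros i) (sym (lookup-𝟎 i)))))
      λ ()
      where
      zeros : ∀ i → lookup (lincomb B (true ∷ replicate k false)) i ≡ O
      zeros i with lookup (lincomb B (true ∷ replicate k false)) i ≟K O
      ... | yes p = p
      ... | no p = contradiction (i , p) none

-- Tutte's triangle lemma

record Triangle {n} (L : Vec K n → Set) (t : Vec K n) (u v w : Fin n) : Set where
  field
    inL : L t
    at₁ : lookup t u ≢ O
    at₂ : lookup t v ≢ O
    at₃ : lookup t w ≢ O
    off : ∀ i → i ≢ u → i ≢ v → i ≢ w → lookup t i ≡ O
    u≢v : u ≢ v
    u≢w : u ≢ w
    v≢w : v ≢ w

open Triangle

module _ {n} {L : Vec K n → Set} where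

  rotate : ∀ {t u v w} → Triangle L t u v w → Triangle L t v w u
  rotate T = record
    { inL = inL T ; at₁ = at₂ T ; at₂ = at₃ T ; at₃ = at₁ T
    ; off = λ i i≢v i≢w i≢u → off T i i≢u i≢v i≢w
    ; u≢v = v≢w T ; u≢w = u≢v T ∘ sym ; v≢w = u≢w T ∘ sym }

  swap₂₃ : ∀ {t u v w} → Triangle L t u v w → Triangle L t u w v
  swap₂₃ T = record
    { inL = inL T ; at₁ = at₁ T ; at₂ = at₃ T ; at₃ = at₂ T
    ; off = λ i i≢u i≢w i≢v → off T i i≢u i≢v i≢w
    ; u≢v = u≢w T ; u≢w = u≢v T ; v≢w = v≢w T ∘ sym }

  swap₁₂ : ∀ {t u v w} → Triangle L t u v w → Triangle L t v u w
  swap₁₂ = swap₂₃ ∘ rotate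

module ThreeConn {n : ℕ} (L : Vec K n → Set) (sys : IsotropicSystem n L)
                 (5≤n : 5 ≤ n) (tc : ThreeConnected L) where

  open Connectivity L sys public

  connLess : ∀ X k → c X < k → ConnLess L X k
  connLess X k c<k = d X , HasDim-cong (LX≐SuppIn X) (d-HasDim X) ,
    subst (_< k + d X) (c+d X) (ℕₚ.+-monoˡ-< (d X) c<k)

  1≤c : ∀ X → 1 ≤ ∣ X ∣ → 1 ≤ ∣ ∁ X ∣ → 1 ≤ c X
  1≤c X p q with 1 ℕₚ.≤? c X
  ... | yes r = r
  ... | no r = contradiction (p , q , connLess X 1 (ℕₚ.≰⇒> r)) (proj₁ (tc X))

  2≤c : ∀ X → 2 ≤ ∣ X ∣ → 2 ≤ ∣ ∁ X ∣ → 2 ≤ c X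
  2≤c X p q with 2 ℕₚ.≤? c X
  ... | yes r = r
  ... | no r = contradiction (p , q , connLess X 2 (ℕₚ.≰⇒> r)) (proj₂ (tc X))

  c-lower : ∀ X → 2 ≤ ∣ ∁ X ∣ → ∣ X ∣ ≤ c X ⊎ 2 ≤ c X
  c-lower X h = go ∣ X ∣ refl
    where
    go : ∀ k → ∣ X ∣ ≡ k → k ≤ c X ⊎ 2 ≤ c X
    go 0 eq = inj₁ z≤n
    go 1 eq = inj₁ (1≤c X (ℕₚ.≤-reflexive (sym eq)) (ℕₚ.≤-trans (s≤s z≤n) h))
    go (suc (suc k)) eq = inj₂ (2≤c X (subst (2 ≤_) (sym eq) (s≤s (s≤s z≤n))) h)

  2≤∁ : ∀ X → ∣ X ∣ ≤ 3 → 2 ≤ ∣ ∁ X ∣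
  2≤∁ X h = ℕₚ.+-cancelˡ-≤ 3 2 _ (begin
    5               ≤⟨ 5≤n ⟩
    n               ≡⟨ ∣X∣+∣∁X∣ X ⟨
    ∣ X ∣ + ∣ ∁ X ∣ ≤⟨ ℕₚ.+-monoˡ-≤ _ h ⟩
    3 + ∣ ∁ X ∣     ∎)
    where open ℕₚ.≤-Reasoning

  -- For ∣X∣ ≤ 2 both alternatives of `c-lower` give ∣X∣ ≤ c X; `5≤n` supplies the two vertices
  -- outside.
  d≡0 : ∀ X → ∣ X ∣ ≤ 2 → d X ≡ 0
  d≡0 X h = ℕₚ.+-cancelˡ-≡ (c X) _ _ (trans (c+d X)
    (trans (ℕₚ.≤-antisym ([ id , ℕₚ.≤-trans h ]′ (c-lower X (2≤∁ X (ℕₚ.m≤n⇒m≤1+n h)))) (subst (c X ≤_) (c+d X) (ℕₚ.m≤m+n _ _)))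
      (sym (ℕₚ.+-identityʳ _))))

  light⇒zero : ∀ {X a} → ∣ X ∣ ≤ 2 → LX X a → ∀ u → lookup a u ≡ O
  light⇒zero {X} h = d≡0⇒zero (d≡0 X h)

  LX-supp : ∀ {a} → L a → LX (supp a) a
  LX-supp {a} La = from (LX≐SuppIn (supp a) a) (La , id)

  3≤∣supp∣ : ∀ {a u} → L a → lookup a u ≢ O → 3 ≤ ∣ supp a ∣
  3≤∣supp∣ {a} {u} La a≢O with 3 ℕₚ.≤? ∣ supp a ∣
  ... | yes p = p
  ... | no p = contradiction (light⇒zero (ℕₚ.≤-pred (ℕₚ.≰⇒> p)) (LX-supp La) u) a≢O

  abstract
    -- Supports of size one or two are ruled out by `light⇒zero`, so two further vertices can be
    -- extracted.
    supp-triangle : ∀ {a u} → L a → lookup a u ≢ O → ∣ supp a ∣ ≤ 3 → ∃[ v ] ∃[ w ] Triangle L a u v w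
    supp-triangle {a} {u} La a≢O h with nonempty-∣∣ (supp a - u) one
      where
      one : 1 ≤ ∣ supp a - u ∣
      one = ℕₚ.≤-trans (s≤s z≤n) (ℕₚ.≤-pred (subst (3 ≤_) (∣remove∣ (∈-supp a a≢O)) (3≤∣supp∣ La a≢O)))
    ... | v , v∈ with nonempty-∣∣ (supp a - u - v) one
      where
      one : 1 ≤ ∣ supp a - u - v ∣
      one = ℕₚ.≤-pred (ℕₚ.≤-pred (subst (3 ≤_) (trans (∣remove∣ (∈-supp a a≢O)) (cong suc (∣remove∣ v∈))) (3≤∣supp∣ La a≢O)))
    ...   | w , w∈ = v , w , record
      { inL = La ; at₁ = a≢O ; at₂ = supp-∈ a (proj₁ v∈′) ; at₃ = supp-∈ a (proj₁ (∈-remove⁻ (supp a) u (proj₁ w∈′)))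
      ; off = λ i i≢u i≢v i≢w → zer i λ a≢ → ℕₚ.<⇒≱ (s≤s (∈⇒1≤∣∣
          (x∈p∧x≢y⇒x∈p-y (x∈p∧x≢y⇒x∈p-y (x∈p∧x≢y⇒x∈p-y (∈-supp a a≢) i≢u) i≢v) i≢w))) none
      ; u≢v = proj₂ v∈′ ∘ sym ; u≢w = proj₂ (∈-remove⁻ (supp a) u (proj₁ w∈′)) ∘ sym ; v≢w = proj₂ w∈′ ∘ sym }
      where
      v∈′ : v ∈ supp a × v ≢ u
      v∈′ = ∈-remove⁻ (supp a) u v∈
      w∈′ : w ∈ supp a - u × w ≢ v
      w∈′ = ∈-remove⁻ (supp a - u) v w∈
      none : suc ∣ supp a - u - v - w ∣ ≤ 1
      none = ℕₚ.≤-pred (ℕₚ.≤-pred (subst (_≤ 3) (trans (∣remove∣ (∈-supp a a≢O))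
        (cong suc (trans (∣remove∣ v∈) (cong suc (∣remove∣ w∈))))) h))
      zer : ∀ i → ¬ (lookup a i ≢ O) → lookup a i ≡ O
      zer i h with lookup a i ≟K O
      ... | yes p = p
      ... | no p = contradiction p h

  abstract
    light-triangle : ∀ {X a u} → ∣ X ∣ ≤ 3 → LX X a → lookup a u ≢ O → ∃[ v ] ∃[ w ] Triangle L a u v w
    light-triangle {X} {a} h LXa a≢O = supp-triangle (proj₁ LXa) a≢O
      (ℕₚ.≤-trans (p⊆q⇒∣p∣≤∣q∣ (proj₂ (to (LX≐SuppIn X a) LXa))) h)

  -- Only `u` contributes to the pairing of `a` with `t`, so isotropy forces orthogonal, hence
  -- equal, nonzero values there.
  single-agree : ∀ {t u v w a} → Triangle L t u v w → L a → lookup a v ≡ O → lookup a w ≡ O →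
                 lookup a u ≢ O → lookup a u ≡ lookup t u
  single-agree {t} {u} {v} {w} {a} T La av aw au
    with ⟪⟫K-false⁻ (L-single La (inL T) u λ i i≢u → z i i≢u (i Finₚ.≟ v) (i Finₚ.≟ w)) (at₁ T)
    where
    z : ∀ i → i ≢ u → Dec (i ≡ v) → Dec (i ≡ w) → ⟪ lookup a i , lookup t i ⟫K ≡ false
    z i i≢u (yes refl) _ = ⟪O,⟫K _ av
    z i i≢u (no _) (yes refl) = ⟪O,⟫K _ aw
    z i i≢u (no i≢v) (no i≢w) = ⟪,O⟫K _ (off T i i≢u i≢v i≢w)
  ... | inj₁ p = contradiction p au
  ... | inj₂ p = p

  -- A certificate that the elementary minor of S at u and x is not 3-connected.
  record Sep (u : Fin n) (x : K) : Set where
    field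
      X : Subset n
      u∉X : u ∉ X
      2≤X : 2 ≤ ∣ X ∣
      2≤Y : 2 ≤ ∣ ∁ (X ∪ ⁅ u ⁆) ∣
      cX : c X ≡ 2
      cXu : c (X ∪ ⁅ u ⁆) ≡ 2
      a : Vec K n
      LXa : LX (X ∪ ⁅ u ⁆) a
      au : lookup a u ≡ x
      b : Vec K n
      LXb : LX (∁ X) b
      bu : lookup b u ≡ x

  -- The two sides are exchanged, `a` and `b` trade places, and symmetry of `c` does the rest.
  flip : ∀ {u x} → Sep u x → Sep u x
  flip {u} S = record
    { X = ∁ (X ∪ ⁅ u ⁆) ; u∉X = λ h → x∈∁p⇒x∉p h (∈-insert X u) ; 2≤X = 2≤Y
    ; 2≤Y = subst (2 ≤_) (cong ∣_∣ (sym ∁∁)) 2≤X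
    ; cX = trans (c-symmetric _) cXu
    ; cXu = trans (cong c (∁-insert u∉X)) (trans (c-symmetric X) cX)
    ; a = b ; LXa = subst (λ Z → LX Z b) (sym (∁-insert u∉X)) LXb ; au = bu
    ; b = a ; LXb = subst (λ Z → LX Z a) (sym (∁-involutive _)) LXa ; bu = au }
    where
    open Sep S
    ∁∁ : ∁ (∁ (X ∪ ⁅ u ⁆) ∪ ⁅ u ⁆) ≡ X
    ∁∁ = trans (cong ∁ (∁-insert u∉X)) (∁-involutive X)

  module _ {u x} (S : Sep u x) (x≢O : x ≢ O) where
    open Sep S

    -- At `u` each side is orthogonal to the vector `b` or `a` of the opposite side, and both of
    -- these have value `x`.
    only : ∀ {e} → LX (X ∪ ⁅ u ⁆) e ⊎ LX (∁ X) e → lookup e u ≡ O ⊎ lookup e u ≡ x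
    only {e} (inj₁ p) = ⟪⟫K-false⁻ (trans (cong ⟪ lookup e u ,_⟫K (sym bu)) (orth p LXb)) x≢O
    only {e} (inj₂ p) = ⟪⟫K-false⁻ (trans (⟪⟫K-comm (lookup e u) x)
      (trans (cong ⟪_, lookup e u ⟫K (sym au)) (orth LXa p))) x≢O

    module _ {t v w} (T : Triangle L t u v w) (tu≢x : lookup t u ≢ x) where

      -- A vector nonzero at u would take the value x there, by `only`, and the value of t, by `single-agree`.
      key : ∀ P → u ∉ P → v ∉ P → w ∉ P → P ⊆ X ⊎ P ⊆ ∁ X → c (P ∪ ⁅ u ⁆) ≡ suc (c P)
      key P u∉P v∉P w∉P P⊆ = c-step P u u∉P λ e LPe →
        [ id , (λ eu≡x → contradiction (agrees e LPe eu≡x) tu≢x) ]′ (only (side LPe P⊆))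
        where
        side : ∀ {e} → LX (P ∪ ⁅ u ⁆) e → P ⊆ X ⊎ P ⊆ ∁ X → LX (X ∪ ⁅ u ⁆) e ⊎ LX (∁ X) e
        side p (inj₁ h) = inj₁ (LX-mono (λ i∈ → [ ∪-inj₁ ⁅ u ⁆ ∘ h , (λ { refl → ∈-insert X u }) ]′ (∈-insert⁻ P i∈)) p)
        side p (inj₂ h) = inj₂ (LX-mono (λ i∈ → [ h , (λ { refl → x∉p⇒x∈∁p u∉X }) ]′ (∈-insert⁻ P i∈)) p)
        agrees : ∀ e → LX (P ∪ ⁅ u ⁆) e → lookup e u ≡ x → lookup t u ≡ x
        agrees e (Le , pe) eu≡x = trans (sym (single-agree T Le
          (pe v (∉-insert v∉P (u≢v T ∘ sym))) (pe w (∉-insert w∉P (u≢w T ∘ sym)))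
          λ e≡O → x≢O (trans (sym eu≡x) e≡O))) eu≡x

  abstract
    -- If `v` and `w` lay on the same side, the vector of the other side would vanish at both and so
    -- take at `u` the value of `t`, which is not `x`. If `v` is on the wrong side, `flip` helps.
    crossing : ∀ {u x t v w} (S : Sep u x) → x ≢ O → Triangle L t u v w → lookup t u ≢ x →
               ∃[ S ] (v ∈ Sep.X {u} {x} S × w ∉ Sep.X S)
    crossing {u} {x} {t} {v} {w} S x≢O T tu≢x = go (v ∈? X) (w ∈? X)
      where
      open Sep S
      disagree : ∀ {e} → L e → lookup e u ≡ x → lookup e v ≡ O → lookup e w ≡ O →
                 ∃[ S ] (v ∈ Sep.X {u} {x} S × w ∉ Sep.X S)
      disagree Le eu ev ew =
        contradiction (trans (sym (single-agree T Le ev ew λ e≡O → x≢O (trans (sym eu) e≡O))) eu) tu≢x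
      go : Dec (v ∈ X) → Dec (w ∈ X) → ∃[ S ] (v ∈ Sep.X {u} {x} S × w ∉ Sep.X S)
      go (yes p) (no q) = S , p , q
      go (no p) (yes q) = flip S , x∉p⇒x∈∁p (∉-insert p (u≢v T ∘ sym)) , λ h → x∈∁p⇒x∉p h (∪-inj₁ ⁅ u ⁆ q)
      go (no p) (no q) = disagree (proj₁ LXa) au
        (proj₂ LXa v (∉-insert p (u≢v T ∘ sym))) (proj₂ LXa w (∉-insert q (u≢w T ∘ sym)))
      go (yes p) (yes q) = disagree (proj₁ LXb) bu
        (proj₂ LXb v (x∈p⇒x∉∁p p)) (proj₂ LXb w (x∈p⇒x∉∁p q))

  -- Uncrossing the separations at u and v, as in the proof of Tutte's triangle lemma for matroids.
  module Uncross {u v w x y t} (T : Triangle L t u v w)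
    (S : Sep u x) (x≢O : x ≢ O) (tu≢x : lookup t u ≢ x) (v∈X : v ∈ Sep.X S) (w∉X : w ∉ Sep.X S)
    (S′ : Sep v y) (y≢O : y ≢ O) (tv≢y : lookup t v ≢ y) (u∈Z : u ∈ Sep.X S′) (w∉Z : w ∉ Sep.X S′) where

    open Sep S
    open Sep S′ using () renaming (X to Z; u∉X to v∉Z; 2≤X to 2≤Z; 2≤Y to 2≤Z′; cX to cZ; cXu to cZv)

    -- These are the four quadrants of the two separations, with `v` and `u` taken out of the two
    -- mixed ones; `w` lies in `D`.
    A B C D : Subset n
    A = X ∩ Z
    B = (X ∩ ∁ Z) - v
    C = (Z ∩ ∁ X) - u
    D = ∁ (X ∪ Z)

    u∉A : u ∉ A
    u∉A = u∉X ∘ proj₁ ∘ x∈p∩q⁻ X Z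
    v∉A : v ∉ A
    v∉A = v∉Z ∘ proj₂ ∘ x∈p∩q⁻ X Z
    w∉A : w ∉ A
    w∉A = w∉X ∘ proj₁ ∘ x∈p∩q⁻ X Z
    u∈Z∖X : u ∈ Z ∩ ∁ X
    u∈Z∖X = x∈p∩q⁺ (u∈Z , x∉p⇒x∈∁p u∉X)
    v∈X∖Z : v ∈ X ∩ ∁ Z
    v∈X∖Z = x∈p∩q⁺ (v∈X , x∉p⇒x∈∁p v∉Z)
    B⊆X∖Z : B ⊆ X ∩ ∁ Z
    B⊆X∖Z = proj₁ ∘ ∈-remove⁻ (X ∩ ∁ Z) v
    C⊆Z∖X : C ⊆ Z ∩ ∁ X
    C⊆Z∖X = proj₁ ∘ ∈-remove⁻ (Z ∩ ∁ X) u
    B⊆X : B ⊆ X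
    B⊆X = proj₁ ∘ x∈p∩q⁻ X (∁ Z) ∘ B⊆X∖Z
    C⊆Z : C ⊆ Z
    C⊆Z = proj₁ ∘ x∈p∩q⁻ Z (∁ X) ∘ C⊆Z∖X
    v∉B : v ∉ B
    v∉B h = proj₂ (∈-remove⁻ (X ∩ ∁ Z) v h) refl
    u∉C : u ∉ C
    u∉C h = proj₂ (∈-remove⁻ (Z ∩ ∁ X) u h) refl
    u∉B : u ∉ B
    u∉B = u∉X ∘ B⊆X
    v∉C : v ∉ C
    v∉C = v∉Z ∘ C⊆Z

    cB : c (X ∩ ∁ Z) ≡ suc (c B)
    cB = trans (cong c (sym (remove-insert v∈X∖Z)))
      (key S′ y≢O (swap₁₂ T) tv≢y B v∉B u∉B (w∉X ∘ B⊆X) (inj₂ (proj₂ ∘ x∈p∩q⁻ X (∁ Z) ∘ B⊆X∖Z)))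

    cC : c (Z ∩ ∁ X) ≡ suc (c C)
    cC = trans (cong c (sym (remove-insert u∈Z∖X)))
      (key S x≢O T tu≢x C u∉C v∉C (w∉Z ∘ C⊆Z) (inj₂ (proj₂ ∘ x∈p∩q⁻ Z (∁ X) ∘ C⊆Z∖X)))

    cA : c (A ∪ ⁅ u ⁆) ≡ suc (c A)
    cA = key S x≢O T tu≢x A u∉A v∉A w∉A (inj₁ (proj₁ ∘ x∈p∩q⁻ X Z))

    -- `X` is uncrossed with the complement of `Z`. By `key`, putting `v` back into `B` and `u` back
    -- into `C` raises each connectivity by one, so the bound 2 + 2 loses two.
    cB+cC≤2 : c B + c C ≤ 2
    cB+cC≤2 = by-cancel 2 (ℕₚ.≤-trans (c-submodular X (∁ Z))
        (ℕₚ.≤-reflexive (cong₂ _+_ cX (trans (c-symmetric Z) cZ))))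
      (trans (arr (c B) (c C)) (cong₂ _+_ (trans (sym cC) (trans (cong c (sym Z∖X≡)) (c-symmetric _))) (sym cB))) refl
      where
      arr : ∀ p q → p + q + 2 ≡ suc q + suc p
      arr = solve-∀
      Z∖X≡ : ∁ (X ∪ ∁ Z) ≡ Z ∩ ∁ X
      Z∖X≡ = ⊆-antisym
        (λ h → let h′ = x∈∁p⇒x∉p h in
               x∈p∩q⁺ (x∉∁p⇒x∈p (∉-∪⁻ʳ {X = X} h′) , x∉p⇒x∈∁p (∉-∪⁻ˡ h′)))
        (λ h → let p , q = x∈p∩q⁻ Z (∁ X) h in x∉p⇒x∈∁p (∉-∪ (x∈∁p⇒x∉p q) (x∈p⇒x∉∁p p)))

    -- Here `X ∪ ⁅ u ⁆` is uncrossed with `Z`; their intersection is `A` with `u`, which by `key`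
    -- costs one. Enlarging both sets, as in `cAuv+cD≤4`, bounds instead the triple needed when `A`
    -- is a single vertex.
    cA+cD≤3 : c A + c D ≤ 3
    cA+cD≤3 = by-cancel 1 (ℕₚ.≤-trans (c-submodular (X ∪ ⁅ u ⁆) Z) (ℕₚ.≤-reflexive (cong₂ _+_ cXu cZ)))
      (trans (arr (c A) (c D)) (cong₂ _+_ (trans (c-symmetric (X ∪ Z)) (cong c (sym ∪≡))) (trans (sym cA) (cong c (sym ∩≡))))) refl
      where
      arr : ∀ p q → p + q + 1 ≡ q + suc p
      arr = solve-∀
      ∪≡ : (X ∪ ⁅ u ⁆) ∪ Z ≡ X ∪ Z
      ∪≡ = ⊆-antisym
        (λ h → [ (λ p → [ ∪-inj₁ Z , (λ { refl → ∪-inj₂ X u∈Z }) ]′ (∈-insert⁻ X p)) , ∪-inj₂ X ]′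
                 (x∈p∪q⁻ (X ∪ ⁅ u ⁆) Z h))
        (λ h → [ ∪-inj₁ Z ∘ ∪-inj₁ ⁅ u ⁆ , ∪-inj₂ (X ∪ ⁅ u ⁆) ]′ (x∈p∪q⁻ X Z h))
      ∩≡ : (X ∪ ⁅ u ⁆) ∩ Z ≡ A ∪ ⁅ u ⁆
      ∩≡ = ⊆-antisym
        (λ h → let p , q = x∈p∩q⁻ (X ∪ ⁅ u ⁆) Z h in
               [ (λ r → ∪-inj₁ ⁅ u ⁆ (x∈p∩q⁺ (r , q))) , (λ { refl → ∈-insert A u }) ]′ (∈-insert⁻ X p))
        (λ h → [ (λ r → let p , q = x∈p∩q⁻ X Z r in x∈p∩q⁺ (∪-inj₁ ⁅ u ⁆ p , q))
               , (λ { refl → x∈p∩q⁺ (∈-insert X u , u∈Z) }) ]′ (∈-insert⁻ A h))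

    cAuv+cD≤4 : c ((A ∪ ⁅ u ⁆) ∪ ⁅ v ⁆) + c D ≤ 4
    cAuv+cD≤4 = ℕₚ.≤-trans (ℕₚ.≤-reflexive (trans (ℕₚ.+-comm (c ((A ∪ ⁅ u ⁆) ∪ ⁅ v ⁆)) (c D))
        (cong₂ _+_ (trans (c-symmetric (X ∪ Z)) (cong c (sym ∪≡))) (cong c (sym ∩≡)))))
      (ℕₚ.≤-trans (c-submodular (X ∪ ⁅ u ⁆) (Z ∪ ⁅ v ⁆)) (ℕₚ.≤-reflexive (cong₂ _+_ cXu cZv)))
      where
      ∪≡ : (X ∪ ⁅ u ⁆) ∪ (Z ∪ ⁅ v ⁆) ≡ X ∪ Z
      ∪≡ = ⊆-antisym
        (λ h → [ (λ p → [ ∪-inj₁ Z , (λ { refl → ∪-inj₂ X u∈Z }) ]′ (∈-insert⁻ X p))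
               , (λ p → [ ∪-inj₂ X , (λ { refl → ∪-inj₁ Z v∈X }) ]′ (∈-insert⁻ Z p)) ]′
                 (x∈p∪q⁻ (X ∪ ⁅ u ⁆) (Z ∪ ⁅ v ⁆) h))
        (λ h → [ ∪-inj₁ (Z ∪ ⁅ v ⁆) ∘ ∪-inj₁ ⁅ u ⁆ , ∪-inj₂ (X ∪ ⁅ u ⁆) ∘ ∪-inj₁ ⁅ v ⁆ ]′ (x∈p∪q⁻ X Z h))
      Au = A ∪ ⁅ u ⁆
      ∩≡ : (X ∪ ⁅ u ⁆) ∩ (Z ∪ ⁅ v ⁆) ≡ Au ∪ ⁅ v ⁆
      ∩≡ = ⊆-antisym
        (λ h → let p , q = x∈p∩q⁻ (X ∪ ⁅ u ⁆) (Z ∪ ⁅ v ⁆) h in fwd (∈-insert⁻ X p) (∈-insert⁻ Z q))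
        (λ h → [ (λ r → [ (λ r′ → let p , q = x∈p∩q⁻ X Z r′ in x∈p∩q⁺ (∪-inj₁ ⁅ u ⁆ p , ∪-inj₁ ⁅ v ⁆ q))
                        , (λ { refl → x∈p∩q⁺ (∈-insert X u , ∪-inj₁ ⁅ v ⁆ u∈Z) }) ]′ (∈-insert⁻ A r))
               , (λ { refl → x∈p∩q⁺ (∪-inj₁ ⁅ u ⁆ v∈X , ∈-insert Z v) }) ]′ (∈-insert⁻ Au h))
        where
        fwd : ∀ {i} → i ∈ X ⊎ i ≡ u → i ∈ Z ⊎ i ≡ v → i ∈ Au ∪ ⁅ v ⁆
        fwd (inj₁ p) (inj₁ q) = ∪-inj₁ ⁅ v ⁆ (∪-inj₁ ⁅ u ⁆ (x∈p∩q⁺ (p , q)))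
        fwd (inj₂ refl) _ = ∪-inj₁ ⁅ v ⁆ (∈-insert A u)
        fwd (inj₁ p) (inj₂ refl) = ∈-insert Au v

    2≤∁∌uv : ∀ P → u ∉ P → v ∉ P → 2 ≤ ∣ ∁ P ∣
    2≤∁∌uv P u∉P v∉P = ∈⇒2≤∣∣ (x∉p⇒x∈∁p u∉P) (x∉p⇒x∈∁p v∉P) (u≢v T)

    -- A nonempty `P` has c P ≥ 1, which leaves c Q ≤ 1, too little for two vertices.
    one-each : ∀ P Q → 2 ≤ ∣ ∁ P ∣ → 2 ≤ ∣ ∁ Q ∣ → c P + c Q ≤ 2 → 1 ≤ ∣ P ∣ → 1 ≤ ∣ Q ∣ → ∣ Q ∣ ≤ 1
    one-each P Q ∁P ∁Q h 1≤P 1≤Q = [ (λ r → ℕₚ.≤-trans r cQ≤1) , (λ r → contradiction (ℕₚ.≤-trans r cQ≤1) λ { (s≤s ()) }) ]′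
        (c-lower Q ∁Q)
      where
      1≤cP : 1 ≤ c P
      1≤cP = [ ℕₚ.≤-trans 1≤P , ℕₚ.≤-trans (s≤s z≤n) ]′ (c-lower P ∁P)
      cQ≤1 : c Q ≤ 1
      cQ≤1 = ℕₚ.≤-pred (ℕₚ.≤-trans (ℕₚ.+-monoˡ-≤ (c Q) 1≤cP) h)

    ∣B∣≤1 : 1 ≤ ∣ B ∣ → 1 ≤ ∣ C ∣ → ∣ B ∣ ≤ 1
    ∣B∣≤1 p q = one-each C B (2≤∁∌uv C u∉C v∉C) (2≤∁∌uv B u∉B v∉B)
      (subst (_≤ 2) (ℕₚ.+-comm (c B) (c C)) cB+cC≤2) q p

    ∣C∣≤1 : 1 ≤ ∣ B ∣ → 1 ≤ ∣ C ∣ → ∣ C ∣ ≤ 1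
    ∣C∣≤1 = one-each B C (2≤∁∌uv B u∉B v∉B) (2≤∁∌uv C u∉C v∉C) cB+cC≤2

    big-cover : ∀ (P Q R : Subset n) → P ⊆ Q ∪ R → 2 ≤ ∣ P ∣ → ∣ Q ∣ ≤ 1 → 1 ≤ ∣ R ∣
    big-cover P Q R P⊆ 2≤P Q≤1 = ℕₚ.≤-pred (ℕₚ.≤-trans 2≤P (ℕₚ.≤-trans (p⊆q⇒∣p∣≤∣q∣ P⊆)
      (ℕₚ.≤-trans (∣∪∣≤ Q R) (ℕₚ.+-monoˡ-≤ ∣ R ∣ Q≤1))))

    Conclusion : Set
    Conclusion = ∃[ s ] ∃[ p ] ∃[ q ] (Triangle L s u p q × lookup s u ≡ x)

    conclude : ∀ {Q e} → ∣ Q ∣ ≤ 3 → LX Q e → lookup e u ≡ x → Conclusion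
    conclude h LQe eu with light-triangle h LQe (λ e≡O → x≢O (trans (sym eu) e≡O))
    ... | p , q , E = _ , p , q , E , eu

    -- The far sides have at least two vertices each and lie in `D ∪ C` and `D ∪ B`, so `B` and `C`
    -- are nonempty, hence singletons. Then `∁ X` has at most three vertices, and its vector `b` is
    -- the triangle.
    D-small : ∣ D ∣ ≤ 1 → Conclusion
    D-small D≤1 = conclude (ℕₚ.≤-trans (p⊆q⇒∣p∣≤∣q∣ cover)
        (ℕₚ.≤-trans (∣∪∣≤ (D ∪ C) ⁅ u ⁆)
          (ℕₚ.+-mono-≤ (ℕₚ.≤-trans (∣∪∣≤ D C) (ℕₚ.+-mono-≤ D≤1 (∣C∣≤1 1≤B 1≤C))) (ℕₚ.≤-reflexive (∣⁅x⁆∣≡1 u)))))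
      LXb bu
      where
      Y⊆ : ∁ (X ∪ ⁅ u ⁆) ⊆ D ∪ C
      Y⊆ {i} h = f (i ∈? Z)
        where
        i∉X = ∉-∪⁻ˡ (x∈∁p⇒x∉p h)
        f : Dec (i ∈ Z) → i ∈ D ∪ C
        f (yes i∈Z) = ∪-inj₂ D (x∈p∧x≢y⇒x∈p-y (x∈p∩q⁺ (i∈Z , x∉p⇒x∈∁p i∉X)) λ { refl → x∈∁p⇒x∉p h (∈-insert X u) })
        f (no i∉Z) = ∪-inj₁ C (x∉p⇒x∈∁p (∉-∪ i∉X i∉Z))
      Y′⊆ : ∁ (Z ∪ ⁅ v ⁆) ⊆ D ∪ B
      Y′⊆ {i} h = f (i ∈? X)
        where
        i∉Z = ∉-∪⁻ˡ (x∈∁p⇒x∉p h)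
        f : Dec (i ∈ X) → i ∈ D ∪ B
        f (yes i∈X) = ∪-inj₂ D (x∈p∧x≢y⇒x∈p-y (x∈p∩q⁺ (i∈X , x∉p⇒x∈∁p i∉Z)) λ { refl → x∈∁p⇒x∉p h (∈-insert Z v) })
        f (no i∉X) = ∪-inj₁ B (x∉p⇒x∈∁p (∉-∪ i∉X i∉Z))
      1≤C : 1 ≤ ∣ C ∣
      1≤C = big-cover _ D C Y⊆ 2≤Y D≤1
      1≤B : 1 ≤ ∣ B ∣
      1≤B = big-cover _ D B Y′⊆ 2≤Z′ D≤1
      cover : ∁ X ⊆ (D ∪ C) ∪ ⁅ u ⁆
      cover {i} h = [ ∪-inj₁ ⁅ u ⁆ ∘ Y⊆ , (λ { refl → ∈-insert (D ∪ C) u }) ]′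
        (∈-insert⁻ (∁ (X ∪ ⁅ u ⁆)) (subst (i ∈_) (sym (∁-insert u∉X)) h))

    -- Now the near sides force `B` and `C` to be singletons: `X` consists of `v` and `B`, so `a` is
    -- supported on at most three vertices.
    A-empty : ∣ A ∣ ≤ 0 → Conclusion
    A-empty A≤0 = conclude (ℕₚ.≤-trans (ℕₚ.≤-reflexive (∣insert∣ u∉X)) (s≤s (ℕₚ.≤-trans (p⊆q⇒∣p∣≤∣q∣ X⊆)
        (ℕₚ.≤-trans (∣∪∣≤ (A ∪ ⁅ v ⁆) B) (ℕₚ.+-mono-≤ (Ap v) (∣B∣≤1 1≤B 1≤C)))))) LXa au
      where
      Ap : ∀ i → ∣ A ∪ ⁅ i ⁆ ∣ ≤ 1
      Ap i = ℕₚ.≤-trans (∣∪∣≤ A ⁅ i ⁆) (ℕₚ.+-mono-≤ A≤0 (ℕₚ.≤-reflexive (∣⁅x⁆∣≡1 i)))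
      X⊆ : X ⊆ (A ∪ ⁅ v ⁆) ∪ B
      X⊆ {i} i∈X = f (i ∈? Z) (i Finₚ.≟ v)
        where
        f : Dec (i ∈ Z) → Dec (i ≡ v) → i ∈ (A ∪ ⁅ v ⁆) ∪ B
        f (yes i∈Z) _ = ∪-inj₁ B (∪-inj₁ ⁅ v ⁆ (x∈p∩q⁺ (i∈X , i∈Z)))
        f _ (yes refl) = ∪-inj₁ B (∈-insert A v)
        f (no i∉Z) (no i≢v) = ∪-inj₂ (A ∪ ⁅ v ⁆) (x∈p∧x≢y⇒x∈p-y (x∈p∩q⁺ (i∈X , x∉p⇒x∈∁p i∉Z)) i≢v)
      Z⊆ : Z ⊆ (A ∪ ⁅ u ⁆) ∪ C
      Z⊆ {i} i∈Z = f (i ∈? X) (i Finₚ.≟ u)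
        where
        f : Dec (i ∈ X) → Dec (i ≡ u) → i ∈ (A ∪ ⁅ u ⁆) ∪ C
        f (yes i∈X) _ = ∪-inj₁ C (∪-inj₁ ⁅ u ⁆ (x∈p∩q⁺ (i∈X , i∈Z)))
        f _ (yes refl) = ∪-inj₁ C (∈-insert A u)
        f (no i∉X) (no i≢u) = ∪-inj₂ (A ∪ ⁅ u ⁆) (x∈p∧x≢y⇒x∈p-y (x∈p∩q⁺ (i∈Z , x∉p⇒x∈∁p i∉X)) i≢u)
      1≤B : 1 ≤ ∣ B ∣
      1≤B = big-cover X (A ∪ ⁅ v ⁆) B X⊆ 2≤X (Ap v)
      1≤C : 1 ≤ ∣ C ∣
      1≤C = big-cover Z (A ∪ ⁅ u ⁆) C Z⊆ 2≤Z (Ap u)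

    -- Connectivity at most 2 on three vertices leaves a nonzero vector. It cannot vanish at `u`,
    -- for it would then live on two vertices, so `only` gives it the value `x`.
    A-single : ∣ A ∣ ≡ 1 → 2 ≤ c D → Conclusion
    A-single A≡1 2≤cD = go (1≤d⇒nonzero {X = Q} 1≤dQ)
      where
      Q = (A ∪ ⁅ u ⁆) ∪ ⁅ v ⁆
      ∣Q∣≡3 : ∣ Q ∣ ≡ 3
      ∣Q∣≡3 = trans (∣insert∣ (∉-insert v∉A (u≢v T ∘ sym))) (cong suc (trans (∣insert∣ u∉A) (cong suc A≡1)))
      cQ≤2 : c Q ≤ 2
      cQ≤2 = ℕₚ.+-cancelʳ-≤ 2 _ _ (ℕₚ.≤-trans (ℕₚ.+-monoʳ-≤ (c Q) 2≤cD) cAuv+cD≤4)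
      1≤dQ : 1 ≤ d Q
      1≤dQ = ℕₚ.+-cancelˡ-≤ 2 1 _ (ℕₚ.≤-trans (ℕₚ.≤-reflexive (sym (trans (c+d Q) ∣Q∣≡3))) (ℕₚ.+-monoˡ-≤ (d Q) cQ≤2))
      Q⊆ : Q ⊆ X ∪ ⁅ u ⁆
      Q⊆ h = [ (λ p → [ ∪-inj₁ ⁅ u ⁆ ∘ proj₁ ∘ x∈p∩q⁻ X Z , (λ { refl → ∈-insert X u }) ]′ (∈-insert⁻ A p))
             , (λ { refl → ∪-inj₁ ⁅ u ⁆ v∈X }) ]′ (∈-insert⁻ (A ∪ ⁅ u ⁆) h)
      ∣Av∣≤2 : ∣ A ∪ ⁅ v ⁆ ∣ ≤ 2
      ∣Av∣≤2 = ℕₚ.≤-reflexive (trans (∣insert∣ v∉A) (cong suc A≡1))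
      LAv : ∀ {e} → LX Q e → lookup e u ≡ O → LX (A ∪ ⁅ v ⁆) e
      LAv {e} LQe eu≡O = proj₁ LQe , λ j j∉ → f j j∉ (j Finₚ.≟ u)
        where
        f : ∀ j → j ∉ A ∪ ⁅ v ⁆ → Dec (j ≡ u) → lookup e j ≡ O
        f j j∉ (yes refl) = eu≡O
        f j j∉ (no j≢u) = proj₂ LQe j (∉-∪ (∉-insert (∉-∪⁻ˡ j∉) j≢u) (∉-∪⁻ʳ {X = A} j∉))
      go : ∃[ e ] (LX Q e × ∃[ i ] lookup e i ≢ O) → Conclusion
      go (e , LQe , i , ei≢O) = conclude (ℕₚ.≤-reflexive ∣Q∣≡3) LQe
        ([ (λ eu≡O → contradiction (light⇒zero ∣Av∣≤2 (LAv LQe eu≡O) i) ei≢O) , id ]′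
          (only S x≢O (inj₁ (LX-mono Q⊆ LQe))))

    abstract
      uncross : Conclusion
      uncross with 2 ℕₚ.≤? ∣ D ∣
      ... | no D≱2 = D-small (ℕₚ.≤-pred (ℕₚ.≰⇒> D≱2))
      ... | yes 2≤D = go ∣ A ∣ refl
        where
        2≤cD : 2 ≤ c D
        2≤cD = 2≤c D 2≤D (subst (λ Q → 2 ≤ ∣ Q ∣) (sym (∁-involutive (X ∪ Z))) (∈⇒2≤∣∣ (∪-inj₂ X u∈Z) (∪-inj₁ Z v∈X) (u≢v T)))
        cA≤1 : c A ≤ 1
        cA≤1 = ℕₚ.+-cancelʳ-≤ 2 _ _ (ℕₚ.≤-trans (ℕₚ.+-monoʳ-≤ (c A) 2≤cD) cA+cD≤3)
        A≤1 : ∣ A ∣ ≤ 1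
        A≤1 = [ (λ r → ℕₚ.≤-trans r cA≤1) , (λ r → contradiction (ℕₚ.≤-trans r cA≤1) λ { (s≤s ()) }) ]′
          (c-lower A (2≤∁∌uv A u∉A v∉A))
        go : ∀ k → ∣ A ∣ ≡ k → Conclusion
        go 0 e = A-empty (ℕₚ.≤-reflexive e)
        go 1 e = A-single e 2≤cD
        go (suc (suc k)) e = contradiction (subst (_≤ 1) e A≤1) λ { (s≤s ()) }

  abstract
    tutte : ∀ {u v w x y t} → Triangle L t u v w → Sep u x → x ≢ O → lookup t u ≢ x →
            Sep v y → y ≢ O → lookup t v ≢ y →
            ∃[ s ] ∃[ p ] ∃[ q ] (Triangle L s u p q × lookup s u ≡ x)
    tutte T S x≢O tu≢x S′ y≢O tv≢y with crossing S x≢O T tu≢x | crossing S′ y≢O (swap₁₂ T) tv≢y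
    ... | R , v∈ , w∉ | R′ , u∈ , w∉′ = Uncross.uncross T R x≢O tu≢x v∈ w∉ R′ y≢O tv≢y u∈ w∉′

-- Elementary minors

∣insertAt∣ : ∀ {n} (X : Subset n) v → ∣ insertAt X v false ∣ ≡ ∣ X ∣
∣insertAt∣ X zero = refl
∣insertAt∣ (true ∷ X) (suc v) = cong suc (∣insertAt∣ X v)
∣insertAt∣ (false ∷ X) (suc v) = ∣insertAt∣ X v

removeAt-⊕ : ∀ {n} (a b : Vec K (suc n)) v → removeAt (a ⊕ b) v ≡ removeAt a v ⊕ removeAt b v
removeAt-⊕ (x ∷ a) (y ∷ b) zero = refl
removeAt-⊕ (x ∷ a@(_ ∷ _)) (y ∷ b@(_ ∷ _)) (suc v) = cong ((x +K y) ∷_) (removeAt-⊕ a b v)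

removeAt-replicate : ∀ {n} {A : Set} (x : A) (v : Fin (suc n)) → removeAt (replicate (suc n) x) v ≡ replicate n x
removeAt-replicate x zero = refl
removeAt-replicate {suc n} x (suc v) = cong (x ∷_) (removeAt-replicate x v)

lookup-removeAt : ∀ {n} {A : Set} (xs : Vec A (suc n)) v j → lookup (removeAt xs v) j ≡ lookup xs (punchIn v j)
lookup-removeAt (x ∷ xs) zero j = refl
lookup-removeAt (x ∷ xs@(_ ∷ _)) (suc v) zero = refl
lookup-removeAt (x ∷ xs@(_ ∷ _)) (suc v) (suc j) = lookup-removeAt xs v j

punchIn-cases : ∀ {n} (v i : Fin (suc n)) → i ≡ v ⊎ ∃[ j ] i ≡ punchIn v j
punchIn-cases v i with v Finₚ.≟ i
... | yes p = inj₁ (sym p)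
... | no p = inj₂ (punchOut p , sym (Finₚ.punchIn-punchOut p))

module _ {m : ℕ} (X : Subset m) (v : Fin (suc m)) where

  v∉insertAt : v ∉ insertAt X v false
  v∉insertAt = lookup⇒∉ (Vecₚ.insertAt-lookup X v false)

  insertAt-insert : insertAt X v false ∪ ⁅ v ⁆ ≡ insertAt X v true
  insertAt-insert = lookup-ext λ i → f i (punchIn-cases v i)
    where
    f : ∀ i → i ≡ v ⊎ ∃[ j ] i ≡ punchIn v j →
        lookup (insertAt X v false ∪ ⁅ v ⁆) i ≡ lookup (insertAt X v true) i
    f i (inj₁ refl) = trans (∈⇒lookup (∈-insert (insertAt X v false) v)) (sym (Vecₚ.insertAt-lookup X v true))
    f i (inj₂ (j , refl)) = begin
      lookup (insertAt X v false ∪ ⁅ v ⁆) i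
        ≡⟨ Vecₚ.lookup-zipWith _∨_ i (insertAt X v false) ⁅ v ⁆ ⟩
      lookup (insertAt X v false) i ∨ lookup ⁅ v ⁆ i
        ≡⟨ cong₂ _∨_ (Vecₚ.insertAt-punchIn X v false j)
             (∉⇒lookup (x≢y⇒x∉⁅y⁆ (Finₚ.punchInᵢ≢i v j))) ⟩
      lookup X j ∨ false ≡⟨ Boolₚ.∨-identityʳ _ ⟩
      lookup X j                   ≡⟨ Vecₚ.insertAt-punchIn X v true j ⟨
      lookup (insertAt X v true) i ∎
      where open ≡-Reasoning

  ∣∁insertAt∣ : ∣ ∁ (insertAt X v false ∪ ⁅ v ⁆) ∣ ≡ ∣ ∁ X ∣
  ∣∁insertAt∣ = trans (cong (λ Z → ∣ ∁ Z ∣) insertAt-insert)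
    (trans (cong ∣_∣ (Vecₚ.map-insertAt not true X v)) (∣insertAt∣ (∁ X) v))

  punchIn-∈⁻ : ∀ {j} → punchIn v j ∈ insertAt X v false ∪ ⁅ v ⁆ → j ∈ X
  punchIn-∈⁻ {j} h = Vecₚ.lookup⇒[]= j X (begin
    lookup X j                                ≡⟨ Vecₚ.insertAt-punchIn X v true j ⟨
    lookup (insertAt X v true) (punchIn v j)  ≡⟨ cong (λ Z → lookup Z (punchIn v j)) insertAt-insert ⟨
    lookup (insertAt X v false ∪ ⁅ v ⁆) (punchIn v j) ≡⟨ ∈⇒lookup h ⟩
    true                                      ∎)
    where open ≡-Reasoning

  punchIn-∈ : ∀ {j} → j ∈ X → punchIn v j ∈ insertAt X v false ∪ ⁅ v ⁆
  punchIn-∈ {j} h = ∪-inj₁ ⁅ v ⁆ (Vecₚ.lookup⇒[]= (punchIn v j) (insertAt X v false)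
    (trans (Vecₚ.insertAt-punchIn X v false j) (∈⇒lookup h)))

HasDim-pos : ∀ {n e u} {W : Vec K n → Set} {a} → HasDim W e → W a → lookup a u ≢ O → 1 ≤ e
HasDim-pos {e = suc e} _ _ _ = s≤s z≤n
HasDim-pos {e = 0} {u} (B , _ , span) Wa a≢O with to (span _) Wa
HasDim-pos {e = 0} {u} ([] , _ , span) Wa a≢O | [] , refl = contradiction (lookup-𝟎 u) a≢O

module Minors {m : ℕ} (L : Vec K (suc m) → Set) (sys : IsotropicSystem (suc m) L)
              (5≤n : 5 ≤ suc m) (tc : ThreeConnected L) where

  open ThreeConn L sys 5≤n tc public

  module _ (v : Fin (suc m)) (x : K) (x≢O : x ≢ O) where

    P Q : Subset m → Subset (suc m)
    P X = insertAt X v false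
    Q X = P X ∪ ⁅ v ⁆

    -- Deleting the coordinate `v` maps this space bijectively onto the vectors of the minor
    -- supported in `X`: no nonzero vector of `L` lives on `v` alone.
    M : Subset m → Vec K (suc m) → Set
    M X = LX (Q X) ∩Ker proj₁ (coord v x)

    data Increment (X : Subset m) (e : ℕ) : Set where
      same : e ≡ d (P X) → Increment X e
      more : e ≡ suc (d (P X)) → ∀ a → LX (Q X) a → lookup a v ≡ x → Increment X e

    abstract
      minor-dim′ : ∀ X → ∃[ e ] (HasDim (M X) e × Increment X e)
      minor-dim′ X with step-HasDim (P X) v x (v∉insertAt X v) x≢O
      ... | e , hd , _ , inj₁ (p , _) = e , hd , same p
      ... | e , hd , _ , inj₂ (p , a , q , r) = e , hd , more p a q r

    minor-dim : Subset m → ℕ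
    minor-dim X = proj₁ (minor-dim′ X)

    minor-zero : ∀ {a} → L a → removeAt a v ≡ 𝟎 → a ≡ 𝟎
    minor-zero {a} La e = lookup-ext λ i → trans
      (light⇒zero {⁅ v ⁆} (ℕₚ.≤-trans (ℕₚ.≤-reflexive (∣⁅x⁆∣≡1 v)) (s≤s z≤n))
        (La , λ i i∉ → f i i∉ (punchIn-cases v i)) i) (sym (lookup-𝟎 i))
      where
      f : ∀ i → i ∉ ⁅ v ⁆ → i ≡ v ⊎ ∃[ j ] i ≡ punchIn v j → lookup a i ≡ O
      f i i∉ (inj₁ refl) = contradiction (x∈⁅x⁆ v) i∉
      f i i∉ (inj₂ (j , refl)) =
        trans (sym (lookup-removeAt a v j)) (trans (cong (λ b → lookup b j) e) (lookup-𝟎 j))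

    minor-SuppIn : ∀ X → (λ b → ∃[ a ] (M X a × removeAt a v ≡ b)) ≐ SuppIn (Minor L v x) X
    minor-SuppIn X b = mk⇔
      (λ { (a , ((La , pa) , z) , refl) → (a , La , ⟪⟫K-false⁻ z x≢O , refl) , λ {j} j∈ → fwd a pa j j∈ (j ∈? X) })
      (λ { ((a , La , z , refl) , h) →
           a , ((La , λ i i∉ → bwd a h i i∉ (punchIn-cases v i)) , [ ⟪O,⟫K x , (λ e → trans (cong ⟪_, x ⟫K e) (⟪⟫K-same x)) ]′ z) , refl })
      where
      fwd : ∀ a → (∀ i → i ∉ Q X → lookup a i ≡ O) → ∀ j → j ∈ supp (removeAt a v) → Dec (j ∈ X) → j ∈ X
      fwd a pa j j∈ (yes p) = p
      fwd a pa j j∈ (no p) = contradiction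
        (trans (lookup-removeAt a v j) (pa (punchIn v j) (p ∘ punchIn-∈⁻ X v))) (supp-∈ (removeAt a v) j∈)
      bwd : ∀ a → supp (removeAt a v) ⊆ X → ∀ i → i ∉ Q X → i ≡ v ⊎ ∃[ j ] i ≡ punchIn v j → lookup a i ≡ O
      bwd a h i i∉ (inj₁ refl) = contradiction (∈-insert (P X) v) i∉
      bwd a h i i∉ (inj₂ (j , refl)) with lookup a (punchIn v j) ≟K O
      ... | yes p = p
      ... | no p = contradiction (punchIn-∈ X v (h (∈-supp (removeAt a v)
                     (λ e → p (trans (sym (lookup-removeAt a v j)) e))))) i∉

    minor-HasDim : ∀ X → HasDim (SuppIn (Minor L v x) X) (minor-dim X)
    minor-HasDim X = HasDim-cong (minor-SuppIn X) (HasDim-image (λ a → removeAt a v)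
      (removeAt-replicate O v) (λ a b → removeAt-⊕ a b v) (λ { a ((La , _) , _) → minor-zero La })
      (proj₁ (proj₂ (minor-dim′ X))))

    -- A numerical form of `IsSeparation`, decidable because `minor-dim` is a number; a search over
    -- all subsets then settles 3-connectivity of the minor.
    Separates : ℕ → Subset m → Set
    Separates k X = k ≤ ∣ X ∣ × k ≤ ∣ ∁ X ∣ × ∣ X ∣ < k + minor-dim X

    separates? : ∀ k X → Dec (Separates k X)
    separates? k X = (k ℕₚ.≤? ∣ X ∣) ×-dec ((k ℕₚ.≤? ∣ ∁ X ∣) ×-dec (∣ X ∣ ℕₚ.<? k + minor-dim X))

    Separates⇒IsSeparation : ∀ k X → Separates k X → IsSeparation (Minor L v x) k X
    Separates⇒IsSeparation k X (p , q , r) = p , q , minor-dim X , minor-HasDim X , r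

    IsSeparation⇒Separates : ∀ k X → IsSeparation (Minor L v x) k X → Separates k X
    IsSeparation⇒Separates k X (p , q , e , hd , r) = p , q ,
      subst (λ e → ∣ X ∣ < k + e) (HasDim-unique (λ a → mk⇔ id id) hd (minor-HasDim X)) r

    ∣P∣ : ∀ X → ∣ P X ∣ ≡ ∣ X ∣
    ∣P∣ X = ∣insertAt∣ X v

    ∣∁P∣ : ∀ X → ∣ ∁ (P X) ∣ ≡ suc ∣ ∁ X ∣
    ∣∁P∣ X = trans (cong ∣_∣ (sym (∁-insert (v∉insertAt X v))))
      (trans (∣insert∣ (λ h → x∈∁p⇒x∉p h (∈-insert (P X) v))) (cong suc (∣∁insertAt∣ X v)))

    minor-dim≤ : ∀ X → minor-dim X ≤ suc (d (P X))
    minor-dim≤ X with proj₂ (proj₂ (minor-dim′ X))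
    ... | same p = ℕₚ.≤-trans (ℕₚ.≤-reflexive p) (ℕₚ.n≤1+n _)
    ... | more p _ _ _ = ℕₚ.≤-reflexive p

    c+minor-dim : ∀ {k X} → ∣ X ∣ < k + minor-dim X → c (P X) + d (P X) < k + minor-dim X
    c+minor-dim {k} {X} h = subst (_< k + minor-dim X) (sym (trans (c+d (P X)) (∣P∣ X))) h

    -- Otherwise c (P X) ≤ 1 forces ∣P X∣ ≤ 1, so `Q X` has at most two vertices and carries only
    -- zero, while ∣X∣ ≥ 1 asks for a positive dimension.
    no-1-separation : ∀ X → ¬ Separates 1 X
    no-1-separation X (p , q , r) = absurd (1≤d⇒nonzero {Q X} 1≤dQ)
      where
      cP≤1 : c (P X) ≤ 1
      cP≤1 = ℕₚ.+-cancelʳ-≤ (d (P X)) _ _ (ℕₚ.≤-trans (ℕₚ.≤-pred (c+minor-dim {1} {X} r)) (minor-dim≤ X))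
      ∣P∣≤1 : ∣ P X ∣ ≤ 1
      ∣P∣≤1 = [ (λ h → ℕₚ.≤-trans h cP≤1) , (λ h → contradiction (ℕₚ.≤-trans h cP≤1) λ { (s≤s ()) }) ]′
        (c-lower (P X) (subst (2 ≤_) (sym (∣∁P∣ X)) (s≤s q)))
      ∣Q∣≤2 : ∣ Q X ∣ ≤ 2
      ∣Q∣≤2 = ℕₚ.≤-trans (ℕₚ.≤-reflexive (∣insert∣ (v∉insertAt X v))) (s≤s ∣P∣≤1)
      1≤dQ : 1 ≤ d (Q X)
      1≤dQ = ℕₚ.≤-trans (ℕₚ.≤-trans p (ℕₚ.≤-pred r))
        (HasDim-mono (λ a → proj₁) (proj₁ (proj₂ (minor-dim′ X))) (d-HasDim (Q X)))
      absurd : ¬ (∃[ a ] (LX (Q X) a × ∃[ u ] lookup a u ≢ O))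
      absurd (a , LQa , u , a≢O) = a≢O (light⇒zero ∣Q∣≤2 LQa u)

    -- As c (P X) ≥ 2 and the dimension in the minor exceeds d (P X) by at most one, every
    -- inequality is tight. The extra dimension gives `a`. By symmetry of `c` the dimension also
    -- jumps when `v` joins the far side, which gives `b`, and isotropy with `a` forces its value to
    -- be `x`.
    2-separation⇒Sep : ∀ X → Separates 2 X → Sep v x
    2-separation⇒Sep X (p , q , r) = go (proj₂ (proj₂ (minor-dim′ X)))
      where
      2≤P : 2 ≤ ∣ P X ∣
      2≤P = subst (2 ≤_) (sym (∣P∣ X)) p
      2≤∁Q : 2 ≤ ∣ ∁ (Q X) ∣
      2≤∁Q = subst (2 ≤_) (sym (∣∁insertAt∣ X v)) q
      2≤cP : 2 ≤ c (P X)
      2≤cP = 2≤c (P X) 2≤P (subst (2 ≤_) (sym (∣∁P∣ X)) (ℕₚ.m≤n⇒m≤1+n q))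
      h : c (P X) + d (P X) ≤ 1 + minor-dim X
      h = ℕₚ.≤-pred (c+minor-dim {2} {X} r)
      v∉P = v∉insertAt X v
      go : Increment X (minor-dim X) → Sep v x
      go (same e) = contradiction (ℕₚ.≤-trans 2≤cP (ℕₚ.+-cancelʳ-≤ (d (P X)) _ 1
        (ℕₚ.≤-trans h (ℕₚ.≤-reflexive (cong suc e))))) λ { (s≤s ()) }
      go (more e a LQa av) = record
        { X = P X ; u∉X = v∉P ; 2≤X = 2≤P ; 2≤Y = 2≤∁Q ; cX = cP≡2 ; cXu = cQ≡2
        ; a = a ; LXa = LQa ; au = av
        ; b = proj₁ b′ ; LXb = LXb ; bu = bv }
        where
        cP≡2 : c (P X) ≡ 2
        cP≡2 = ℕₚ.≤-antisym (ℕₚ.+-cancelʳ-≤ (d (P X)) _ _ (ℕₚ.≤-trans h (ℕₚ.≤-reflexive (cong suc e)))) 2≤cP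
        1+d≤dQ : suc (d (P X)) ≤ d (Q X)
        1+d≤dQ = d-step≥1 (P X) v v∉P LQa (λ a≡O → x≢O (trans (sym av) a≡O))
        2≤Q : 2 ≤ ∣ Q X ∣
        2≤Q = ℕₚ.≤-trans 2≤P (∣p∣≤∣p∪q∣ (P X) ⁅ v ⁆)
        cQ≡2 : c (Q X) ≡ 2
        cQ≡2 = ℕₚ.≤-antisym (subst (c (Q X) ≤_) cP≡2 (ℕₚ.+-cancelʳ-≤ (suc (d (P X))) _ _ (begin
            c (Q X) + suc (d (P X)) ≤⟨ ℕₚ.+-monoʳ-≤ (c (Q X)) 1+d≤dQ ⟩
            c (Q X) + d (Q X)       ≡⟨ c+d (Q X) ⟩
            ∣ Q X ∣                 ≡⟨ ∣insert∣ v∉P ⟩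
            suc ∣ P X ∣             ≡⟨ cong suc (c+d (P X)) ⟨
            suc (c (P X) + d (P X)) ≡⟨ ℕₚ.+-suc _ _ ⟨
            c (P X) + suc (d (P X)) ∎)))
          (2≤c (Q X) 2≤Q 2≤∁Q)
          where open ℕₚ.≤-Reasoning
        R = ∁ (Q X)
        v∉R : v ∉ R
        v∉R h = x∈∁p⇒x∉p h (∈-insert (P X) v)
        dR< : d R < d (R ∪ ⁅ v ⁆)
        dR< = ℕₚ.≤-reflexive (ℕₚ.+-cancelˡ-≡ 2 _ _ (begin
          2 + suc (d R)                       ≡⟨ cong (_+ suc (d R)) (trans (c-symmetric (Q X)) cQ≡2) ⟨
          c R + suc (d R)                     ≡⟨ ℕₚ.+-suc _ _ ⟩
          suc (c R + d R)                     ≡⟨ cong suc (c+d R) ⟩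
          suc ∣ R ∣                           ≡⟨ ∣insert∣ v∉R ⟨
          ∣ R ∪ ⁅ v ⁆ ∣                       ≡⟨ c+d (R ∪ ⁅ v ⁆) ⟨
          c (R ∪ ⁅ v ⁆) + d (R ∪ ⁅ v ⁆)       ≡⟨ cong (λ Z → c Z + d (R ∪ ⁅ v ⁆)) (∁-insert v∉P) ⟩
          c (∁ (P X)) + d (R ∪ ⁅ v ⁆)         ≡⟨ cong (_+ d (R ∪ ⁅ v ⁆)) (trans (c-symmetric (P X)) cP≡2) ⟩
          2 + d (R ∪ ⁅ v ⁆)                   ∎))
          where open ≡-Reasoning
        b′ : ∃[ b ] (LX (R ∪ ⁅ v ⁆) b × lookup b v ≢ O)
        b′ = d-step-flat⁻ R v v∉R dR<
        LXb : LX (∁ (P X)) (proj₁ b′)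
        LXb = subst (λ Z → LX Z (proj₁ b′)) (∁-insert v∉P) (proj₁ (proj₂ b′))
        bv : lookup (proj₁ b′) v ≡ x
        bv = [ (λ z → contradiction z (proj₂ (proj₂ b′))) , id ]′
          (⟪⟫K-false⁻ (trans (⟪⟫K-comm (lookup (proj₁ b′) v) x)
            (trans (cong ⟪_, lookup (proj₁ b′) v ⟫K (sym av)) (orth LQa LXb))) x≢O)

    abstract
      minor-3-connected? : ThreeConnected (Minor L v x) ⊎ (¬ ThreeConnected (Minor L v x) × Sep v x)
      minor-3-connected? with anySubset? (separates? 2)
      ... | yes (X , s) = inj₂ ((λ tc′ → proj₂ (tc′ X) (Separates⇒IsSeparation 2 X s)) , 2-separation⇒Sep X s)
      ... | no none = inj₁ λ X → (no-1-separation X ∘ IsSeparation⇒Separates 1 X)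
                               , (λ s → none (X , IsSeparation⇒Separates 2 X s))

    -- In the minor `t` becomes a nonzero vector supported on `p` and `q`, which makes these two
    -- vertices a 2-separation.
    triangle-minor : ∀ {t p q} → Triangle L t v p q → lookup t v ≡ x → ¬ ThreeConnected (Minor L v x)
    triangle-minor {t} {p} {q} T tv tc′ = proj₂ (tc′ X) (Separates⇒IsSeparation 2 X
      (ℕₚ.≤-reflexive (sym ∣X∣≡2) , 2≤∁X , subst (_< 2 + minor-dim X) (sym ∣X∣≡2) (ℕₚ.+-monoʳ-≤ 2 1≤e)))
      where
      pq : Subset (suc m)
      pq = ⁅ p ⁆ ∪ ⁅ q ⁆
      X : Subset m
      X = removeAt pq v
      v∉pq : v ∉ pq
      v∉pq = ∉-∪ (x≢y⇒x∉⁅y⁆ (u≢v T)) (x≢y⇒x∉⁅y⁆ (u≢w T))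
      P≡ : P X ≡ pq
      P≡ = trans (cong (insertAt X v) (sym (∉⇒lookup v∉pq))) (Vecₚ.insertAt-removeAt pq v)
      ∣X∣≡2 : ∣ X ∣ ≡ 2
      ∣X∣≡2 = trans (sym (∣P∣ X)) (trans (cong ∣_∣ P≡)
        (trans (∣insert∣ (x≢y⇒x∉⁅y⁆ (v≢w T ∘ sym))) (cong suc (∣⁅x⁆∣≡1 p))))
      2≤∁X : 2 ≤ ∣ ∁ X ∣
      2≤∁X = ℕₚ.+-cancelˡ-≤ 2 2 _ (ℕₚ.≤-trans (ℕₚ.≤-pred 5≤n)
        (ℕₚ.≤-reflexive (trans (sym (∣X∣+∣∁X∣ X)) (cong (_+ ∣ ∁ X ∣) ∣X∣≡2))))
      t∈M : M X t
      t∈M = (inL T , λ i i∉ → off T i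
          (λ { refl → i∉ (∈-insert (P X) v) })
          (λ { refl → i∉ (∪-inj₁ ⁅ v ⁆ (subst (p ∈_) (sym P≡) (∪-inj₁ ⁅ q ⁆ (x∈⁅x⁆ p)))) })
          (λ { refl → i∉ (∪-inj₁ ⁅ v ⁆ (subst (q ∈_) (sym P≡) (∈-insert ⁅ p ⁆ q))) }))
        , trans (cong ⟪_, x ⟫K tv) (⟪⟫K-same x)
      1≤e : 1 ≤ minor-dim X
      1≤e = HasDim-pos (proj₁ (proj₂ (minor-dim′ X))) t∈M (at₁ T)

  N : Fin (suc m) → Set
  N = NonEssential L

  OK : Fin (suc m) → K → Set
  OK v x = ThreeConnected (Minor L v x)

  Bad : Fin (suc m) → K → Set
  Bad v x = x ≢ O × Sep v x

  -- At least two values fail, phrased as the ability to dodge any prescribed `z`: the uncrossing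
  -- needs a failing value other than that of the triangle.
  TwoBad : Fin (suc m) → Set
  TwoBad v = ∀ z → ∃[ x ] (Bad v x × z ≢ x)

  two-bad : ∀ {v} x y → x ≢ y → Bad v x → Bad v y → TwoBad v
  two-bad x y x≢y p q z with z ≟K x
  ... | no z≢x = x , p , z≢x
  ... | yes refl = y , q , x≢y

  abstract
    essential? : ∀ v → N v ⊎ (¬ N v × TwoBad v)
    essential? v with minor-3-connected? v α (λ ()) | minor-3-connected? v β (λ ()) | minor-3-connected? v γ (λ ())
    ... | inj₁ p | inj₁ q | _ = inj₁ (inj₁ (p , q))
    ... | inj₁ p | inj₂ _ | inj₁ r = inj₁ (inj₂ (inj₁ (p , r)))
    ... | inj₂ _ | inj₁ q | inj₁ r = inj₁ (inj₂ (inj₂ (q , r)))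
    ... | inj₂ (p , p′) | inj₂ (q , q′) | _ = inj₂
      ([ p ∘ proj₁ , [ p ∘ proj₁ , q ∘ proj₁ ]′ ]′ , two-bad α β (λ ()) ((λ ()) , p′) ((λ ()) , q′))
    ... | inj₂ (p , p′) | inj₁ q | inj₂ (r , r′) = inj₂
      ([ p ∘ proj₁ , [ r ∘ proj₂ , r ∘ proj₂ ]′ ]′ , two-bad α γ (λ ()) ((λ ()) , p′) ((λ ()) , r′))
    ... | inj₁ p | inj₂ (q , q′) | inj₂ (r , r′) = inj₂
      ([ q ∘ proj₂ , [ r ∘ proj₂ , q ∘ proj₁ ]′ ]′ , two-bad β γ (λ ()) ((λ ()) , q′) ((λ ()) , r′))

  ¬N⇒TwoBad : ∀ {v} → ¬ N v → TwoBad v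
  ¬N⇒TwoBad {v} ¬Nv = [ (λ Nv → contradiction Nv ¬Nv) , proj₂ ]′ (essential? v)

  N⇒OK : ∀ {v} → N v → ∃[ z ] (∀ x → x ≢ O → x ≢ z → OK v x)
  N⇒OK (inj₁ (p , q)) = γ , λ { O h _ → contradiction refl h ; α _ _ → p ; β _ _ → q ; γ _ h → contradiction refl h }
  N⇒OK (inj₂ (inj₁ (p , r))) = β , λ { O h _ → contradiction refl h ; α _ _ → p ; β _ h → contradiction refl h ; γ _ _ → r }
  N⇒OK (inj₂ (inj₂ (q , r))) = α , λ { O h _ → contradiction refl h ; α _ h → contradiction refl h ; β _ _ → q ; γ _ _ → r }

  -- Each of the two values fails by `triangle-minor`, and a non-essential vertex tolerates at most
  -- one failing value.
  disagree⇒¬N : ∀ {v t s p q p′ q′} → Triangle L t v p q → Triangle L s v p′ q′ →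
                lookup t v ≢ lookup s v → ¬ N v
  disagree⇒¬N {v} {t} {s} T S t≢s Nv with N⇒OK Nv
  ... | z , ok with lookup t v ≟K z | lookup s v ≟K z
  ... | yes e | yes f = t≢s (trans e (sym f))
  ... | no e | _ = triangle-minor v (lookup t v) (at₁ T) T refl (ok _ (at₁ T) e)
  ... | yes _ | no f = triangle-minor v (lookup s v) (at₁ S) S refl (ok _ (at₁ S) f)

  abstract
    tutte-essential : ∀ {t u v w} → Triangle L t u v w → ¬ N u → ¬ N v →
      ∃[ s ] ∃[ p ] ∃[ q ] (Triangle L s u p q × lookup s u ≢ lookup t u)
    tutte-essential {t} {u} {v} T ¬Nu ¬Nv with ¬N⇒TwoBad ¬Nu (lookup t u) | ¬N⇒TwoBad ¬Nv (lookup t v)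
    ... | x , (x≢O , S) , tu≢x | y , (y≢O , S′) , tv≢y with tutte T S x≢O tu≢x S′ y≢O tv≢y
    ... | s , p , q , T′ , su≡x = s , p , q , T′ , λ e → tu≢x (trans (sym e) su≡x)

-- Interaction of triangles

⟪,⟫-split : ∀ {n} (a b : Vec K n) u → ⟪ a , b ⟫ ≡ ⟪ lookup a u , lookup b u ⟫K xor ⟪ a [ u ]≔ O , b ⟫
⟪,⟫-split (x ∷ a) (y ∷ b) zero = refl
⟪,⟫-split (x ∷ a) (y ∷ b) (suc u) = trans (cong (⟪ x , y ⟫K xor_) (⟪,⟫-split a b u))
  (shuffle ⟪ x , y ⟫K ⟪ lookup a u , lookup b u ⟫K _)
  where
  shuffle : ∀ p q r → p xor (q xor r) ≡ q xor (p xor r)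
  shuffle false q r = refl
  shuffle true false r = refl
  shuffle true true r = refl

fromVertices : ∀ {n} → List (Fin n) → Subset n
fromVertices [] = ⊥
fromVertices (v ∷ vs) = fromVertices vs ∪ ⁅ v ⁆

data Distinct {n} : List (Fin n) → Set where
  [] : Distinct []
  _∷_ : ∀ {v vs} → All (v ≢_) vs → Distinct vs → Distinct (v ∷ vs)

module _ {n : ℕ} where

  ∉-fromVertices : ∀ {v : Fin n} vs → All (v ≢_) vs → v ∉ fromVertices vs
  ∉-fromVertices [] [] = ∉⊥
  ∉-fromVertices (w ∷ vs) (v≢w ∷ h) = ∉-insert (∉-fromVertices vs h) v≢w

  ∉-fromVertices⁻ : ∀ {v : Fin n} vs → v ∉ fromVertices vs → All (v ≢_) vs
  ∉-fromVertices⁻ [] h = []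
  ∉-fromVertices⁻ (w ∷ vs) h = (λ { refl → h (∈-insert (fromVertices vs) w) }) ∷ ∉-fromVertices⁻ vs (∉-∪⁻ˡ h)

  ∈-fromVertices : ∀ {v : Fin n} {vs} → v ∈ˡ vs → v ∈ fromVertices vs
  ∈-fromVertices {vs = w ∷ vs} (here refl) = ∈-insert (fromVertices vs) w
  ∈-fromVertices {vs = w ∷ vs} (there h) = ∪-inj₁ ⁅ w ⁆ (∈-fromVertices h)

  ∣fromVertices∣ : ∀ {vs : List (Fin n)} → Distinct vs → ∣ fromVertices vs ∣ ≡ length vs
  ∣fromVertices∣ [] = ∣⊥∣≡0 n
  ∣fromVertices∣ {v ∷ vs} (h ∷ hs) = trans (∣insert∣ (∉-fromVertices vs h)) (cong suc (∣fromVertices∣ hs))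

  ⊆∧∣∣≡⇒≡ : ∀ {X Y : Subset n} → X ⊆ Y → ∣ X ∣ ≡ ∣ Y ∣ → X ≡ Y
  ⊆∧∣∣≡⇒≡ {X} {Y} X⊆Y e = ⊆-antisym X⊆Y λ {i} i∈Y → f i i∈Y (i ∈? X)
    where
    f : ∀ i → i ∈ Y → Dec (i ∈ X) → i ∈ X
    f i i∈Y (yes p) = p
    f i i∈Y (no p) = contradiction e (ℕₚ.<⇒≢ (p⊂q⇒∣p∣<∣q∣ (X⊆Y , i , i∈Y , p)))

module Triangles {m : ℕ} (L : Vec K (suc m) → Set) (sys : IsotropicSystem (suc m) L)
                 (5≤n : 5 ≤ suc m) (tc : ThreeConnected L) where

  open Minors L sys 5≤n tc public

  n : ℕ
  n = suc m

  V : Set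
  V = Fin n

  Tri : V → V → V → Set
  Tri u v w = ∃[ t ] Triangle L t u v w

  rot : ∀ {u v w} → Tri u v w → Tri v w u
  rot (t , T) = t , rotate T

  sw : ∀ {u v w} → Tri u v w → Tri u w v
  sw (t , T) = t , swap₂₃ T

  sw₁ : ∀ {u v w} → Tri u v w → Tri v u w
  sw₁ (t , T) = t , swap₁₂ T

  abstract
    meet : ∀ {a b} → L a → L b → ∀ u → ⟪ lookup a u , lookup b u ⟫K ≡ true →
           ∃[ i ] (i ≢ u × ⟪ lookup a i , lookup b i ⟫K ≡ true)
    meet {a} {b} La Lb u e with Finₚ.any? (λ i → ¬? (i Finₚ.≟ u) ×-dec (⟪ lookup a i , lookup b i ⟫K Boolₚ.≟ true))
    ... | yes p = p
    ... | no none = contradiction (trans (sym e) (L-single La Lb u λ i i≢u → f i i≢u)) λ ()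
      where
      f : ∀ i → i ≢ u → ⟪ lookup a i , lookup b i ⟫K ≡ false
      f i i≢u with ⟪ lookup a i , lookup b i ⟫K in eq
      ... | false = refl
      ... | true = contradiction (i , i≢u , eq) none

  -- The number of vertices at which two vectors of L disagree is even.
  L-third : ∀ {a b} → L a → L b → ∀ u v w → u ≢ v → w ≢ u → w ≢ v →
    ⟪ lookup a u , lookup b u ⟫K ≡ true → ⟪ lookup a v , lookup b v ⟫K ≡ true →
    (∀ i → i ≢ u → i ≢ v → i ≢ w → ⟪ lookup a i , lookup b i ⟫K ≡ false) →
    ⟪ lookup a w , lookup b w ⟫K ≡ false
  L-third {a} {b} La Lb u v w u≢v w≢u w≢v e f h with ⟪ lookup a w , lookup b w ⟫K in eq
  ... | false = refl
  ... | true = contradiction (trans (sym (L-iso La Lb)) odd) λ ()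
    where
    open ≡-Reasoning
    a′ = a [ u ]≔ O
    a″ = a′ [ v ]≔ O
    at : ∀ i → i ≢ u → i ≢ v → lookup a″ i ≡ lookup a i
    at i i≢u i≢v = trans (Vecₚ.lookup∘update′ i≢v a′ O) (Vecₚ.lookup∘update′ i≢u a O)
    others : ∀ i → i ≢ w → Dec (i ≡ u) → Dec (i ≡ v) → ⟪ lookup a″ i , lookup b i ⟫K ≡ false
    others i i≢w _ (yes refl) = ⟪O,⟫K _ (Vecₚ.lookup∘update v a′ O)
    others i i≢w (yes refl) (no i≢v) = ⟪O,⟫K _ (trans (Vecₚ.lookup∘update′ i≢v a′ O) (Vecₚ.lookup∘update u a O))
    others i i≢w (no i≢u) (no i≢v) = trans (cong ⟪_, lookup b i ⟫K (at i i≢u i≢v)) (h i i≢u i≢v i≢w)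
    odd : ⟪ a , b ⟫ ≡ true
    odd = begin
      ⟪ a , b ⟫                                         ≡⟨ ⟪,⟫-split a b u ⟩
      ⟪ lookup a u , lookup b u ⟫K xor ⟪ a′ , b ⟫       ≡⟨ cong₂ _xor_ e (⟪,⟫-split a′ b v) ⟩
      true xor (⟪ lookup a′ v , lookup b v ⟫K xor ⟪ a″ , b ⟫)
        ≡⟨ cong (λ x → true xor (⟪ x , lookup b v ⟫K xor ⟪ a″ , b ⟫)) (Vecₚ.lookup∘update′ (u≢v ∘ sym) a O) ⟩
      true xor (⟪ lookup a v , lookup b v ⟫K xor ⟪ a″ , b ⟫) ≡⟨ cong (λ x → true xor (x xor ⟪ a″ , b ⟫)) f ⟩
      true xor (true xor ⟪ a″ , b ⟫)
        ≡⟨ cong (λ x → true xor (true xor x)) (⟪,⟫-single a″ b w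
             (trans (cong ⟪_, lookup b w ⟫K (at w w≢u w≢v)) eq) λ i i≢w → others i i≢w (i Finₚ.≟ u) (i Finₚ.≟ v)) ⟩
      true ∎

  corner : ∀ {t u v w i} → Triangle L t u v w → lookup t i ≢ O → i ≢ u → i ≡ v ⊎ i ≡ w
  corner {v = v} {w} {i} T ti i≢u with i Finₚ.≟ v | i Finₚ.≟ w
  ... | yes p | _ = inj₁ p
  ... | no _ | yes q = inj₂ q
  ... | no p | no q = contradiction (off T i i≢u p q) ti

  abstract
    -- By isotropy a disagreement is never alone, and both triangles are nonzero where they
    -- disagree.
    clash : ∀ {t s u v w p q} → Triangle L t u v w → Triangle L s u p q → lookup t u ≢ lookup s u →
            ∃[ i ] ((i ≡ v ⊎ i ≡ w) × (i ≡ p ⊎ i ≡ q) × lookup t i ≢ lookup s i)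
    clash {u = u} T S t≢s with meet (inL T) (inL S) u (⟪⟫K-true (at₁ T) (at₁ S) t≢s)
    ... | i , i≢u , e with ⟪⟫K-true⁻ e
    ... | ti , si , t≢si = i , corner T ti i≢u , corner S si i≢u , t≢si

  LV : List V → Vec K n → Set
  LV vs = LX (fromVertices vs)

  dV : List V → ℕ
  dV vs = d (fromVertices vs)

  ∈LV : ∀ vs {t u v w} → Triangle L t u v w → u ∈ˡ vs → v ∈ˡ vs → w ∈ˡ vs → LV vs t
  ∈LV vs T u∈ v∈ w∈ = inL T , λ i i∉ →
    off T i (λ { refl → i∉ (∈-fromVertices u∈) }) (λ { refl → i∉ (∈-fromVertices v∈) }) (λ { refl → i∉ (∈-fromVertices w∈) })

  pattern 0th = here refl
  pattern 1st = there 0th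
  pattern 2nd = there 1st
  pattern 3rd = there 2nd
  pattern 4th = there 3rd

  dV≥1 : ∀ v vs {a} → All (v ≢_) vs → LV (v ∷ vs) a → lookup a v ≢ O → 1 + dV vs ≤ dV (v ∷ vs)
  dV≥1 v vs v∉ = d-step≥1 (fromVertices vs) v (∉-fromVertices vs v∉)

  dV≥2 : ∀ v vs {a b} → All (v ≢_) vs → LV (v ∷ vs) a → LV (v ∷ vs) b →
         lookup a v ≢ O → lookup b v ≢ O → lookup a v ≢ lookup b v → 2 + dV vs ≤ dV (v ∷ vs)
  dV≥2 v vs v∉ = d-step≥2 (fromVertices vs) v (∉-fromVertices vs v∉)

  1≤dV : ∀ {t u v w} → Triangle L t u v w → 1 ≤ dV (u ∷ v ∷ w ∷ [])
  1≤dV {u = u} {v} {w} T = ℕₚ.≤-trans (s≤s z≤n)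
    (dV≥1 u (v ∷ w ∷ []) (u≢v T ∷ u≢w T ∷ []) (∈LV (u ∷ v ∷ w ∷ []) T 0th 1st 2nd) (at₁ T))

  -- This is c ≥ 2 read as a cap on dimension. Dense configurations of triangles are excluded by
  -- counting dimensions vertex by vertex, with `dV≥1` and `dV≥2`, until the cap is exceeded.
  dependent : ∀ {vs} → Distinct vs → 2 ≤ length vs → 2 + length vs ≤ n → 2 + d (fromVertices vs) ≤ length vs
  dependent {vs} dist h h′ = subst (2 + d X ≤_) (∣fromVertices∣ dist)
    (subst (2 + d X ≤_) (c+d X) (ℕₚ.+-monoˡ-≤ (d X) (2≤c X (subst (2 ≤_) (sym (∣fromVertices∣ dist)) h)
      (ℕₚ.+-cancelˡ-≤ (length vs) 2 _ (begin
        length vs + 2           ≡⟨ ℕₚ.+-comm _ 2 ⟩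
        2 + length vs           ≤⟨ h′ ⟩
        n                       ≡⟨ ∣X∣+∣∁X∣ X ⟨
        ∣ X ∣ + ∣ ∁ X ∣         ≡⟨ cong (_+ ∣ ∁ X ∣) (∣fromVertices∣ dist) ⟩
        length vs + ∣ ∁ X ∣     ∎)))))
    where
    open ℕₚ.≤-Reasoning
    X = fromVertices vs

  -- Two values at `u` would give dimension two on three vertices.
  same-support : ∀ {t s u v w} → Triangle L t u v w → Triangle L s u v w → lookup t u ≡ lookup s u
  same-support {t} {s} {u} {v} {w} T S with lookup t u ≟K lookup s u
  ... | yes p = p
  ... | no t≢s = contradiction
    (ℕₚ.≤-trans (s≤s (s≤s (dV≥2 u (v ∷ w ∷ []) (u≢v T ∷ u≢w T ∷ [])
        (∈LV (u ∷ v ∷ w ∷ []) T 0th 1st 2nd) (∈LV (u ∷ v ∷ w ∷ []) S 0th 1st 2nd) (at₁ T) (at₁ S) t≢s)))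
      (dependent {u ∷ v ∷ w ∷ []} ((u≢v T ∷ u≢w T ∷ []) ∷ (v≢w T ∷ []) ∷ [] ∷ []) (s≤s (s≤s z≤n)) 5≤n))
    λ { (s≤s (s≤s (s≤s ()))) }

  -- Equality at `u` would force equality at `v` by isotropy, and the sum would be a nonzero vector
  -- supported on `p` and `q`.
  share₂ : ∀ {t s u v p q} → Triangle L t u v p → Triangle L s u v q → p ≢ q → lookup t u ≢ lookup s u
  share₂ {t} {s} {u} {v} {p} {q} T S p≢q tu≡su = at₃ T (trans (sym a≡) (light⇒zero {fromVertices (p ∷ q ∷ [])}
      (ℕₚ.≤-reflexive (∣fromVertices∣ {vs = p ∷ q ∷ []} ((p≢q ∷ []) ∷ [] ∷ []))) (L-⊕ (inL T) (inL S) , vanishes) p))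
    where
    sp : lookup s p ≡ O
    sp = off S p (u≢w T ∘ sym) (v≢w T ∘ sym) p≢q
    tv≡sv : lookup t v ≡ lookup s v
    tv≡sv = [ (λ z → contradiction z (at₂ T)) , id ]′ (⟪⟫K-false⁻ (L-single (inL T) (inL S) v f) (at₂ S))
      where
      f : ∀ i → i ≢ v → ⟪ lookup t i , lookup s i ⟫K ≡ false
      f i i≢v with i Finₚ.≟ u | i Finₚ.≟ p
      ... | yes refl | _ = trans (cong ⟪ lookup t u ,_⟫K (sym tu≡su)) (⟪⟫K-same (lookup t u))
      ... | no _ | yes refl = ⟪,O⟫K (lookup t p) sp
      ... | no i≢u | no i≢p = ⟪O,⟫K (lookup s i) (off T i i≢u i≢v i≢p)
    a≡ : lookup (t ⊕ s) p ≡ lookup t p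
    a≡ = trans (lookup-⊕ p t s) (trans (cong (lookup t p +K_) sp) (+K-identityʳ _))
    vanishes : ∀ i → i ∉ fromVertices (p ∷ q ∷ []) → lookup (t ⊕ s) i ≡ O
    vanishes i i∉ with ∉-fromVertices⁻ (p ∷ q ∷ []) i∉ | i Finₚ.≟ u | i Finₚ.≟ v
    ... | _ | yes refl | _ = trans (lookup-⊕ i t s) (trans (cong (_+K lookup s i) tu≡su) (+K-self (lookup s i)))
    ... | _ | no _ | yes refl = trans (lookup-⊕ i t s) (trans (cong (_+K lookup s i) tv≡sv) (+K-self (lookup s i)))
    ... | i≢p ∷ i≢q ∷ [] | no i≢u | no i≢v =
      trans (lookup-⊕ i t s) (cong₂ _+K_ (off T i i≢u i≢v i≢p) (off S i i≢u i≢v i≢q))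

  agree : ∀ {t s u v w p q} → Triangle L t u v w → Triangle L s u p q →
          v ≢ p → v ≢ q → w ≢ p → w ≢ q → lookup t u ≡ lookup s u
  agree T S v≢p v≢q w≢p w≢q = single-agree′ S T v≢p v≢q w≢p w≢q
    where
    single-agree′ : ∀ {t s u v w p q} → Triangle L s u p q → Triangle L t u v w →
      v ≢ p → v ≢ q → w ≢ p → w ≢ q → lookup t u ≡ lookup s u
    single-agree′ S T a b c d = single-agree S (inL T)
      (off T _ (u≢v S ∘ sym) (a ∘ sym) (c ∘ sym)) (off T _ (u≢w S ∘ sym) (b ∘ sym) (d ∘ sym)) (at₁ T)

  abstract
    -- The triangle from `tutte-essential` disagrees at `u`, so by `clash` it shares a second
    -- vertex; its third vertex is new by `same-support`.
    tight : ∀ {u v w} → Tri u v w → ¬ N u → ¬ N v →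
            ∃[ z ] (z ≢ u × z ≢ v × z ≢ w × (Tri u v z ⊎ Tri u w z))
    tight {u} {v} {w} (t , T) ¬Nu ¬Nv with tutte-essential T ¬Nu ¬Nv
    ... | s , p , q , S , s≢t with clash T S (s≢t ∘ sym)
    ... | i , inj₁ refl , inj₁ refl , _ = q , u≢w S ∘ sym , v≢w S ∘ sym ,
          (λ { refl → s≢t (same-support S T) }) , inj₁ (s , S)
    ... | i , inj₁ refl , inj₂ refl , _ = p , u≢v S ∘ sym , v≢w S ,
          (λ { refl → s≢t (same-support (swap₂₃ S) T) }) , inj₁ (s , swap₂₃ S)
    ... | i , inj₂ refl , inj₁ refl , _ = q , u≢w S ∘ sym ,
          (λ { refl → s≢t (same-support (swap₂₃ S) T) }) , v≢w S ∘ sym , inj₂ (s , S)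
    ... | i , inj₂ refl , inj₂ refl , _ = p , u≢v S ∘ sym ,
          (λ { refl → s≢t (same-support S T) }) , v≢w S , inj₂ (s , swap₂₃ S)

  -- One dimension from the triangle without `a` and two from the distinct values at `a` make 3 on
  -- four vertices, where 2 are allowed. Two more vertices must lie outside, whence the 6.
  three-of-four : 6 ≤ n → ∀ {a b c d} → Tri b c d → Tri a b c → Tri a b d → Data.Empty.⊥
  three-of-four 6≤n {a} {b} {c} {e} (t₁ , T₁) (t₂ , T₂) (t₃ , T₃) = ℕₚ.<⇒≱ (s≤s (s≤s (s≤s (s≤s (s≤s z≤n)))))
    (ℕₚ.≤-trans (s≤s (s≤s (ℕₚ.≤-trans (s≤s (s≤s (1≤dV T₁))) 2≤step)))
      (dependent {abce} (a≢ ∷ (u≢v T₁ ∷ u≢w T₁ ∷ []) ∷ (v≢w T₁ ∷ []) ∷ [] ∷ []) (s≤s (s≤s z≤n)) 6≤n))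
    where
    abce = a ∷ b ∷ c ∷ e ∷ []
    a≢ : All (a ≢_) (b ∷ c ∷ e ∷ [])
    a≢ = u≢v T₂ ∷ u≢w T₂ ∷ u≢w T₃ ∷ []
    2≤step : 2 + dV (b ∷ c ∷ e ∷ []) ≤ dV abce
    2≤step = dV≥2 a (b ∷ c ∷ e ∷ []) a≢
      (∈LV abce T₂ 0th 1st 2nd) (∈LV abce T₃ 0th 1st 3rd) (at₁ T₂) (at₁ T₃) (share₂ T₂ T₃ (v≢w T₁))

  -- Starting from `h q r`, the vertex `p` adds one dimension and `s` adds two: 4 on five vertices,
  -- where 3 are allowed. Two more outside give the 7.
  no-wheel : 7 ≤ n → ∀ {h p q r s} → Tri h p q → Tri h q r → Tri h r s → Tri h s p → p ≢ r → q ≢ s → Data.Empty.⊥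
  no-wheel 7≤n {h} {p} {q} {r} {s} (t₁ , T₁) (t₂ , T₂) (t₃ , T₃) (t₄ , T₄) p≢r q≢s =
    ℕₚ.<⇒≱ (s≤s (s≤s (s≤s (s≤s (s≤s (s≤s z≤n))))))
    (ℕₚ.≤-trans (s≤s (s≤s (ℕₚ.≤-trans (s≤s (s≤s (ℕₚ.≤-trans (s≤s (1≤dV T₂)) 1≤step))) 2≤step)))
      (dependent {sphqr} (s≢ ∷ p≢ ∷ (u≢v T₂ ∷ u≢w T₂ ∷ []) ∷ (v≢w T₂ ∷ []) ∷ [] ∷ []) (s≤s (s≤s z≤n)) 7≤n))
    where
    hqr = h ∷ q ∷ r ∷ []
    phqr = p ∷ hqr
    sphqr = s ∷ phqr
    p≢ : All (p ≢_) hqr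
    p≢ = (u≢v T₁ ∘ sym) ∷ v≢w T₁ ∷ p≢r ∷ []
    s≢ : All (s ≢_) phqr
    s≢ = v≢w T₄ ∷ (u≢w T₃ ∘ sym) ∷ (q≢s ∘ sym) ∷ (v≢w T₃ ∘ sym) ∷ []
    1≤step : 1 + dV hqr ≤ dV phqr
    1≤step = dV≥1 p hqr p≢ (∈LV phqr T₁ 1st 0th 2nd) (at₂ T₁)
    2≤step : 2 + dV phqr ≤ dV sphqr
    2≤step = dV≥2 s phqr s≢ (∈LV sphqr T₃ 2nd 4th 0th) (∈LV sphqr T₄ 2nd 0th 1st)
      (at₃ T₃) (at₂ T₄) (share₂ (rotate (rotate T₃)) (swap₁₂ T₄) (p≢r ∘ sym))

  module _ {u v w : V} (u≢v : u ≢ v) (u≢w : u ≢ w) (v≢w : v ≢ w) where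

    full-triangle : ∀ {e i} → LV (u ∷ v ∷ w ∷ []) e → lookup e i ≢ O → Triangle L e u v w
    full-triangle {e} {i} LXe ei = record
      { inL = proj₁ LXe
      ; at₁ = nonzero v w (λ j j≢u → λ { (j≢v ∷ j≢w ∷ []) → j≢u ∷ j≢v ∷ j≢w ∷ [] }) ((v≢w ∷ []) ∷ [] ∷ [])
      ; at₂ = nonzero u w (λ j j≢v → λ { (j≢u ∷ j≢w ∷ []) → j≢u ∷ j≢v ∷ j≢w ∷ [] }) ((u≢w ∷ []) ∷ [] ∷ [])
      ; at₃ = nonzero u v (λ j j≢w → λ { (j≢u ∷ j≢v ∷ []) → j≢u ∷ j≢v ∷ j≢w ∷ [] }) ((u≢v ∷ []) ∷ [] ∷ [])
      ; off = λ j j≢u j≢v j≢w → proj₂ LXe j (∉-fromVertices (u ∷ v ∷ w ∷ []) (j≢u ∷ j≢v ∷ j≢w ∷ []))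
      ; u≢v = u≢v ; u≢w = u≢w ; v≢w = v≢w }
      where
      nonzero : ∀ p q {r} → (∀ j → j ≢ r → All (j ≢_) (p ∷ q ∷ []) → All (j ≢_) (u ∷ v ∷ w ∷ [])) →
                Distinct (p ∷ q ∷ []) → lookup e r ≢ O
      nonzero p q {r} h dist er≡O = ei (light⇒zero {fromVertices (p ∷ q ∷ [])} (ℕₚ.≤-reflexive (∣fromVertices∣ dist))
        (proj₁ LXe , λ j j∉ → f j (∉-fromVertices⁻ (p ∷ q ∷ []) j∉) (j Finₚ.≟ r)) i)
        where
        f : ∀ j → All (j ≢_) (p ∷ q ∷ []) → Dec (j ≡ r) → lookup e j ≡ O
        f j _ (yes refl) = er≡O
        f j j≢ (no j≢r) = proj₂ LXe j (∉-fromVertices (u ∷ v ∷ w ∷ []) (h j j≢r j≢))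

    -- With its converse `Tri⇒c≤2` this expresses triangles through connectivity alone, so that
    -- symmetry of `c` can produce new ones on complements.
    c≤2⇒Tri : c (fromVertices (u ∷ v ∷ w ∷ [])) ≤ 2 → Tri u v w
    c≤2⇒Tri h with 1≤d⇒nonzero {fromVertices (u ∷ v ∷ w ∷ [])} (ℕₚ.+-cancelˡ-≤ 2 1 _
      (ℕₚ.≤-trans (ℕₚ.≤-reflexive (sym (trans (c+d (fromVertices (u ∷ v ∷ w ∷ [])))
        (∣fromVertices∣ {vs = u ∷ v ∷ w ∷ []} ((u≢v ∷ u≢w ∷ []) ∷ (v≢w ∷ []) ∷ [] ∷ []))))) (ℕₚ.+-monoˡ-≤ _ h)))
    ... | e , LXe , i , ei = e , full-triangle LXe ei

  Tri⇒c≤2 : ∀ {u v w} → Tri u v w → c (fromVertices (u ∷ v ∷ w ∷ [])) ≤ 2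
  Tri⇒c≤2 {u} {v} {w} (t , T) = ℕₚ.+-cancelʳ-≤ 1 _ _ (begin
    c X + 1   ≤⟨ ℕₚ.+-monoʳ-≤ (c X) (1≤dV T) ⟩
    c X + d X ≡⟨ c+d X ⟩
    ∣ X ∣     ≡⟨ ∣fromVertices∣ {vs = u ∷ v ∷ w ∷ []} ((u≢v T ∷ u≢w T ∷ []) ∷ (v≢w T ∷ []) ∷ [] ∷ []) ⟩
    3         ∎)
    where
    open ℕₚ.≤-Reasoning
    X = fromVertices (u ∷ v ∷ w ∷ [])

-- Cyclic systems

abstract
  σ : ∀ {m} → Fin (suc m) → Fin (suc m)
  σ {m} i with suc (toℕ i) ℕₚ.<? suc m
  ... | yes p = fromℕ< p
  ... | no _ = zero

  toℕ-σ : ∀ {m} (i : Fin (suc m)) → toℕ (σ i) ≡ suc (toℕ i) ⊎ (suc (toℕ i) ≡ suc m × σ i ≡ zero)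
  toℕ-σ {m} i with suc (toℕ i) ℕₚ.<? suc m
  ... | yes p = inj₁ (Finₚ.toℕ-fromℕ< p)
  ... | no p = inj₂ (ℕₚ.≤-antisym (Finₚ.toℕ<n i) (ℕₚ.≮⇒≥ p) , refl)

σ-surjective : ∀ {m} (j : Fin (suc m)) → ∃[ i ] σ i ≡ j
σ-surjective {m} zero = fromℕ m , [ (λ e → contradiction (Finₚ.toℕ<n (σ (fromℕ m)))
  (ℕₚ.≤⇒≯ (ℕₚ.≤-reflexive (trans (cong suc (sym (Finₚ.toℕ-fromℕ m))) (sym e))))) , proj₂ ]′ (toℕ-σ (fromℕ m))
σ-surjective {suc m} (suc j) = inject₁ j , [ (λ e → Finₚ.toℕ-injective (trans e (cong suc (Finₚ.toℕ-inject₁ j))))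
  , (λ (e , _) → contradiction (Finₚ.toℕ<n j)
      (ℕₚ.≤⇒≯ (ℕₚ.≤-reflexive (sym (trans (sym (Finₚ.toℕ-inject₁ j)) (ℕₚ.suc-injective e)))))) ]′ (toℕ-σ (inject₁ j))

σ^ : ∀ {m} → ℕ → Fin (suc m) → Fin (suc m)
σ^ zero i = i
σ^ (suc k) i = σ (σ^ k i)

toℕ-σ^ : ∀ {m} k (i : Fin (suc m)) → k ≤ suc m →
         toℕ (σ^ k i) ≡ k + toℕ i ⊎ suc m + toℕ (σ^ k i) ≡ k + toℕ i
toℕ-σ^ zero i h = inj₁ refl
toℕ-σ^ {m} (suc k) i h with toℕ-σ^ k i (ℕₚ.<⇒≤ h) | toℕ-σ (σ^ k i)
... | inj₁ e | inj₁ f = inj₁ (trans f (cong suc e))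
... | inj₁ e | inj₂ (f , g) = inj₂ (trans (cong (λ j → suc m + toℕ j) g)
      (trans (ℕₚ.+-identityʳ _) (trans (sym f) (cong suc e))))
... | inj₂ e | inj₁ f = inj₂ (trans (cong (suc m +_) f) (trans (ℕₚ.+-suc (suc m) _) (cong suc e)))
... | inj₂ e | inj₂ (f , g) = contradiction e (ℕₚ.>⇒≢ (s≤s (begin
  k + toℕ i            ≤⟨ ℕₚ.+-mono-≤ (ℕₚ.≤-pred h) (ℕₚ.≤-pred (Finₚ.toℕ<n i)) ⟩
  m + m                ≡⟨ cong (m +_) (ℕₚ.suc-injective f) ⟨
  m + toℕ (σ^ k i)     ∎)))
  where open ℕₚ.≤-Reasoning

σ^-≢ : ∀ {m} k (i : Fin (suc m)) → 1 ≤ k → k ≤ m → σ^ k i ≢ i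
σ^-≢ {m} k i 1≤k k≤m e with toℕ-σ^ k i (ℕₚ.m≤n⇒m≤1+n k≤m)
... | inj₁ f = ℕₚ.<⇒≢ (ℕₚ.+-monoˡ-≤ (toℕ i) 1≤k) (trans (cong toℕ (sym e)) f)
... | inj₂ f = ℕₚ.<⇒≢ (ℕₚ.+-monoˡ-< (toℕ i) (s≤s k≤m)) (trans (sym f) (cong (λ j → suc m + toℕ j) e))

∃-surjective : ∀ {m} (f : Fin (suc m) → Fin (suc m)) → Injective _≡_ _≡_ f → ∀ v → ∃[ i ] f i ≡ v
∃-surjective {m} f inj v with Finₚ.any? (λ i → f i Finₚ.≟ v)
... | yes p = p
... | no none = contradiction
  (Finₚ.injective⇒≤ {f = λ i → punchOut (avoids i)} λ e → inj (Finₚ.punchOut-injective (avoids _) (avoids _) e)) ℕₚ.1+n≰n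
  where
  avoids : ∀ i → v ≢ f i
  avoids i e = none (i , sym e)

module _ {m : ℕ} where

  σ-from-suc : ∀ {i j : Fin (suc m)} → toℕ j ≡ suc (toℕ i) → j ≡ σ i
  σ-from-suc {i} {j} e with toℕ-σ i
  ... | inj₁ f = Finₚ.toℕ-injective (trans e (sym f))
  ... | inj₂ (f , _) = contradiction (trans e f) (ℕₚ.<⇒≢ (Finₚ.toℕ<n j))

  σ-from-last : ∀ {i j : Fin (suc m)} → toℕ j ≡ 0 → suc (toℕ i) ≡ suc m → j ≡ σ i
  σ-from-last {i} {j} e f with toℕ-σ i
  ... | inj₁ g = contradiction (trans g f) (ℕₚ.<⇒≢ (Finₚ.toℕ<n (σ i)))
  ... | inj₂ (_ , g) = trans (Finₚ.toℕ-injective e) (sym g)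

  CycAdj⇒σ : ∀ {i j : Fin (suc m)} → CycAdj i j → j ≡ σ i ⊎ i ≡ σ j
  CycAdj⇒σ (inj₁ e) = inj₁ (σ-from-suc e)
  CycAdj⇒σ (inj₂ (inj₁ e)) = inj₂ (σ-from-suc e)
  CycAdj⇒σ (inj₂ (inj₂ (inj₁ (e , f)))) = inj₂ (σ-from-last e f)
  CycAdj⇒σ (inj₂ (inj₂ (inj₂ (e , f)))) = inj₁ (σ-from-last e f)

  σ⇒CycAdj : ∀ {i j : Fin (suc m)} → j ≡ σ i ⊎ i ≡ σ j → CycAdj i j
  σ⇒CycAdj {i} (inj₁ refl) with toℕ-σ i
  ... | inj₁ e = inj₁ e
  ... | inj₂ (e , f) = inj₂ (inj₂ (inj₂ (cong toℕ f , e)))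
  σ⇒CycAdj {j = j} (inj₂ refl) with toℕ-σ j
  ... | inj₁ e = inj₂ (inj₁ e)
  ... | inj₂ (e , f) = inj₂ (inj₂ (inj₁ (cong toℕ f , e)))

nth : ∀ {A : Set} → A → List A → ℕ → A
nth x [] i = x
nth x (y ∷ ys) zero = y
nth x (y ∷ ys) (suc i) = nth x ys i

All-nth : ∀ {A : Set} {P : A → Set} {x} {ys} → All P ys → ∀ i → i < length ys → P (nth x ys i)
All-nth (p ∷ ps) zero h = p
All-nth (p ∷ ps) (suc i) (s≤s h) = All-nth ps i h

nth-injective : ∀ {n} {x : Fin n} {ys} → Distinct ys → ∀ {i j} → i < length ys → j < length ys →
                nth x ys i ≡ nth x ys j → i ≡ j
nth-injective (p ∷ ps) {zero} {zero} h k e = refl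
nth-injective (p ∷ ps) {zero} {suc j} h (s≤s k) e = contradiction e (All-nth p j k)
nth-injective (p ∷ ps) {suc i} {zero} (s≤s h) k e = contradiction (sym e) (All-nth p i h)
nth-injective (p ∷ ps) {suc i} {suc j} (s≤s h) (s≤s k) e = cong suc (nth-injective ps h k e)

module CyclicSystems {m : ℕ} (L : Vec K (suc m) → Set) (sys : IsotropicSystem (suc m) L)
                     (5≤n : 5 ≤ suc m) (tc : ThreeConnected L) where

  open Triangles L sys 5≤n tc public

  -- The triangle on i, σ i, σ (σ i) is the fundamental vector of σ i.
  module _ (f : Fin n → V) (f-inj : Injective _≡_ _≡_ f) (T : ∀ i → Tri (f i) (f (σ i)) (f (σ (σ i)))) where

    private
      t : Fin n → Vec K n
      t i = proj₁ (T i)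

      Tt : ∀ i → Triangle L (t i) (f i) (f (σ i)) (f (σ (σ i)))
      Tt i = proj₂ (T i)

      inv : V → Fin n
      inv v = proj₁ (∃-surjective f f-inj v)

      f∘inv : ∀ v → f (inv v) ≡ v
      f∘inv v = proj₂ (∃-surjective f f-inj v)

      -- The Eulerian vector takes at each vertex the value of the triangle that starts there. The
      -- triangle ending there agrees, since the two meet in that vertex only (five vertices are
      -- needed for this), and the one centred there disagrees by `share₂`.
      a : Vec K n
      a = tabulate (λ v → lookup (t (inv v)) v)

      at-f : ∀ i → lookup a (f i) ≡ lookup (t i) (f i)
      at-f i = trans (Vecₚ.lookup∘tabulate (λ v → lookup (t (inv v)) v) (f i)) (cong (λ k → lookup (t k) (f i)) (f-inj (f∘inv (f i))))

      a≢O : ∀ i → lookup a (f i) ≢ O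
      a≢O i e = at₁ (Tt i) (trans (sym (at-f i)) e)

      apart : ∀ k {i} → 1 ≤ k → k ≤ 4 → f (σ^ k i) ≢ f i
      apart k {i} 1≤k k≤4 e = σ^-≢ k i 1≤k (ℕₚ.≤-trans k≤4 (ℕₚ.≤-pred 5≤n)) (f-inj e)

      on : ∀ i → ⟪ lookup (t i) (f (σ i)) , lookup a (f (σ i)) ⟫K ≡ true
      on i = ⟪⟫K-true (at₂ (Tt i)) (a≢O (σ i)) λ e →
        share₂ (rotate (Tt i)) (Tt (σ i)) (apart 3 {i} (s≤s z≤n) (s≤s (s≤s (s≤s z≤n))) ∘ sym) (trans e (at-f (σ i)))

      off-at : ∀ i k → k ≢ σ i → ⟪ lookup (t i) (f k) , lookup a (f k) ⟫K ≡ false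
      off-at i k k≢σi with k Finₚ.≟ i | k Finₚ.≟ σ (σ i)
      ... | yes refl | _ = trans (cong ⟪ lookup (t i) (f i) ,_⟫K (at-f i)) (⟪⟫K-same (lookup (t i) (f i)))
      ... | no _ | yes refl = trans (cong ⟪ lookup (t i) (f k) ,_⟫K (trans (at-f k) (sym agrees)))
              (⟪⟫K-same (lookup (t i) (f k)))
        where
        agrees : lookup (t i) (f k) ≡ lookup (t k) (f k)
        agrees = agree (rotate (rotate (Tt i))) (Tt k)
          (apart 3 (s≤s z≤n) (s≤s (s≤s (s≤s z≤n))) ∘ sym)
          (apart 4 (s≤s z≤n) ℕₚ.≤-refl ∘ sym)
          (apart 2 (s≤s z≤n) (s≤s (s≤s z≤n)) ∘ sym)
          (apart 3 (s≤s z≤n) (s≤s (s≤s (s≤s z≤n))) ∘ sym)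
      ... | no k≢i | no k≢σσi = ⟪O,⟫K _ (off (Tt i) (f k) (k≢i ∘ f-inj) (k≢σi ∘ f-inj) (k≢σσi ∘ f-inj))

      -- If `e` agreed with `a` at `f (σ i)`, that would be its only disagreement with `t i`,
      -- against isotropy. This gives both that `a` is Eulerian and that fundamental vectors are
      -- unique.
      zero-at : ∀ {e} → L e → (∀ k → ⟪ lookup e (f k) , lookup a (f k) ⟫K ≡ false) → ∀ k → lookup e (f k) ≡ O
      zero-at {e} Le h k with σ-surjective k
      ... | i , refl with ⟪⟫K-false⁻ (h (σ i)) (a≢O (σ i))
      ...   | inj₁ z = z
      ...   | inj₂ z = contradiction (trans (sym (on i))
              (trans (⟪⟫K-comm (lookup (t i) (f (σ i))) _) (trans (cong ⟪_, lookup (t i) (f (σ i)) ⟫K (sym z))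
                (L-single Le (inL (Tt i)) (f (σ i)) others)))) λ ()
        where
        others : ∀ v → v ≢ f (σ i) → ⟪ lookup e v , lookup (t i) v ⟫K ≡ false
        others v v≢ with ∃-surjective f f-inj v
        ... | l , refl with ⟪⟫K-false⁻ (h l) (a≢O l)
        ...   | inj₁ z = ⟪O,⟫K _ z
        ...   | inj₂ z = trans (cong ⟪_, lookup (t i) (f l) ⟫K z)
                  (trans (⟪⟫K-comm (lookup a (f l)) _) (off-at i l λ { refl → v≢ refl }))

      eulerian : Eulerian L a
      eulerian = complete , λ { X (v , v∈X) LaX → complete v (trans (sym (inside-at X v v∈X))
          (trans (cong (lookup (restrict a X)) (sym (f∘inv v))) (zero-at LaX (λ k → orthogonal X (f k)) (inv v)))) }
        where
        complete : Complete a
        complete v e = a≢O (inv v) (trans (cong (lookup a) (f∘inv v)) e)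
        at : ∀ X v → lookup (restrict a X) v ≡ (if lookup X v then lookup a v else O)
        at X v = Vecₚ.lookup∘tabulate (λ i → if lookup X i then lookup a i else O) v
        inside-at : ∀ X v → v ∈ X → lookup (restrict a X) v ≡ lookup a v
        inside-at X v v∈X = trans (at X v) (cong (λ z → if z then lookup a v else O) (∈⇒lookup v∈X))
        orthogonal : ∀ X v → ⟪ lookup (restrict a X) v , lookup a v ⟫K ≡ false
        orthogonal X v rewrite at X v with lookup X v
        ... | true = ⟪⟫K-same (lookup a v)
        ... | false = refl

      fundamental : ∀ {b} i → L b → ⟪ lookup b (f (σ i)) , lookup a (f (σ i)) ⟫K ≡ true →
        (∀ u → u ≢ f (σ i) → ⟪ lookup b u , lookup a u ⟫K ≡ false) → ∀ k → lookup b (f k) ≡ lookup (t i) (f k)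
      fundamental {b} i Lb b-on b-off k = +K≡O⇒≡ _ _ (trans (sym (lookup-⊕ (f k) b (t i)))
        (zero-at (L-⊕ Lb (inL (Tt i))) (λ l → trans (cong ⟪_, lookup a (f l) ⟫K (lookup-⊕ (f l) b (t i)))
          (trans (⟪⟫K-+K (lookup b (f l)) _ _) (both l (l Finₚ.≟ σ i)))) k))
        where
        both : ∀ l → Dec (l ≡ σ i) →
          ⟪ lookup b (f l) , lookup a (f l) ⟫K xor ⟪ lookup (t i) (f l) , lookup a (f l) ⟫K ≡ false
        both l (yes refl) = cong₂ _xor_ b-on (on i)
        both l (no l≢) = cong₂ _xor_ (b-off (f l) (l≢ ∘ f-inj)) (off-at i l l≢)

      adjacent⇒ : ∀ j l → FundAdj L a (f j) (f l) → CycAdj j l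
      adjacent⇒ j l (fj≢fl , b , Lb , b-on , b-off , bl) with σ-surjective j
      ... | i , refl with corner (Tt i) (λ e → bl (trans (fundamental i Lb b-on b-off l) e))
      ...   | h with l Finₚ.≟ i
      ...     | yes refl = σ⇒CycAdj (inj₂ refl)
      ...     | no l≢i with h (l≢i ∘ f-inj)
      ...       | inj₁ e = contradiction (sym e) fj≢fl
      ...       | inj₂ e = σ⇒CycAdj (inj₁ (f-inj e))

      witness : ∀ i {l} → f (σ i) ≢ f l → lookup (t i) (f l) ≢ O → FundAdj L a (f (σ i)) (f l)
      witness i ≢l tl = ≢l , t i , inL (Tt i) , on i , others , tl
        where
        others : ∀ u → u ≢ f (σ i) → ⟪ lookup (t i) u , lookup a u ⟫K ≡ false
        others u u≢ with ∃-surjective f f-inj u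
        ... | k , refl = off-at i k λ { refl → u≢ refl }

      adjacent⇐ : ∀ j l → CycAdj j l → FundAdj L a (f j) (f l)
      adjacent⇐ j l adj with CycAdj⇒σ adj
      ... | inj₂ refl = witness l (apart 1 ℕₚ.≤-refl (s≤s z≤n)) (at₁ (Tt l))
      ... | inj₁ refl with σ-surjective j
      ...   | i , refl = witness i (apart 1 ℕₚ.≤-refl (s≤s z≤n) ∘ sym) (at₃ (Tt i))

    triangle-cycle⇒Cyclic : Cyclic L
    triangle-cycle⇒Cyclic = a , eulerian , 5≤n , f , f-inj , λ j l → mk⇔ (adjacent⇒ j l) (adjacent⇐ j l)

  path-cycle⇒Cyclic : (g : ℕ → V) → (∀ {i j} → i < n → j < n → g i ≡ g j → i ≡ j) →
    (∀ i → 2 + i < n → Tri (g i) (g (1 + i)) (g (2 + i))) →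
    (∀ i → 2 + i ≡ n → Tri (g i) (g (1 + i)) (g 0)) → (∀ i → 1 + i ≡ n → Tri (g i) (g 0) (g 1)) → Cyclic L
  path-cycle⇒Cyclic g g-inj T T′ T″ = triangle-cycle⇒Cyclic (g ∘ toℕ)
      (λ {i} {j} e → Finₚ.toℕ-injective (g-inj (Finₚ.toℕ<n i) (Finₚ.toℕ<n j) e)) go
    where
    put : ∀ {i p q p′ q′} → p ≡ p′ → q ≡ q′ → Tri (g i) (g p′) (g q′) → Tri (g i) (g p) (g q)
    put refl refl x = x
    go : ∀ (i : Fin n) → Tri (g (toℕ i)) (g (toℕ (σ i))) (g (toℕ (σ (σ i))))
    go i with toℕ-σ i | toℕ-σ (σ i)
    ... | inj₁ e | inj₁ e′ = put e (trans e′ (cong suc e))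
            (T (toℕ i) (subst (_< n) (trans e′ (cong suc e)) (Finₚ.toℕ<n (σ (σ i)))))
    ... | inj₁ e | inj₂ (e′ , z) = put e (cong toℕ z) (T′ (toℕ i) (trans (cong suc (sym e)) e′))
    ... | inj₂ (e , z) | inj₁ e′ = put (cong toℕ z) (trans e′ (cong (suc ∘ toℕ) z)) (T″ (toℕ i) e)
    ... | inj₂ (e , z) | inj₂ (e′ , _) =
          contradiction 5≤n (ℕₚ.<⇒≱ (subst (_< 5) (trans (cong (suc ∘ toℕ) (sym z)) e′) (s≤s (s≤s z≤n))))

  -- The complement of a triple has two vertices, hence connectivity at most 2, so every triple is a
  -- triangle and any cyclic order works.
  5-cyclic : n ≡ 5 → Cyclic L
  5-cyclic n≡5 = triangle-cycle⇒Cyclic id id λ i → all-triples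
      (σ^-≢ 1 i (s≤s z≤n) (m≥ (s≤s z≤n)) ∘ sym) (σ^-≢ 2 i (s≤s z≤n) (m≥ (s≤s (s≤s z≤n))) ∘ sym)
      (σ^-≢ 1 (σ i) (s≤s z≤n) (m≥ (s≤s z≤n)) ∘ sym)
    where
    m≥ : ∀ {k} → k ≤ 4 → k ≤ m
    m≥ h = ℕₚ.≤-trans h (ℕₚ.≤-pred 5≤n)
    all-triples : ∀ {u v w : V} → u ≢ v → u ≢ w → v ≢ w → Tri u v w
    all-triples {u} {v} {w} u≢v u≢w v≢w = c≤2⇒Tri u≢v u≢w v≢w (begin
      c X       ≡⟨ c-symmetric X ⟨
      c (∁ X)   ≤⟨ subst (c (∁ X) ≤_) (c+d (∁ X)) (ℕₚ.m≤m+n _ _) ⟩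
      ∣ ∁ X ∣   ≡⟨ ℕₚ.+-cancelˡ-≡ 3 _ _ (trans (cong (_+ ∣ ∁ X ∣)
                     (sym (∣fromVertices∣ {vs = u ∷ v ∷ w ∷ []} ((u≢v ∷ u≢w ∷ []) ∷ (v≢w ∷ []) ∷ [] ∷ []))))
                     (trans (∣X∣+∣∁X∣ X) n≡5)) ⟩
      2         ∎)
      where
      open ℕₚ.≤-Reasoning
      X = fromVertices (u ∷ v ∷ w ∷ [])

  -- By symmetry of the connectivity function.
  complement : n ≡ 6 → ∀ {u v w x y z} → Distinct (u ∷ v ∷ w ∷ x ∷ y ∷ z ∷ []) → Tri u v w → Tri x y z
  complement n≡6 {u} {v} {w} {x} {y} {z}
    ((_ ∷ _ ∷ u≢x ∷ u≢y ∷ u≢z ∷ []) ∷ (_ ∷ v≢x ∷ v≢y ∷ v≢z ∷ []) ∷ (w≢x ∷ w≢y ∷ w≢z ∷ [])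
     ∷ (x≢y ∷ x≢z ∷ []) ∷ (y≢z ∷ []) ∷ [] ∷ []) T =
    c≤2⇒Tri x≢y x≢z y≢z (subst (_≤ 2) (trans (sym (c-symmetric X)) (cong c ∁X≡Y)) (Tri⇒c≤2 T))
    where
    X = fromVertices (u ∷ v ∷ w ∷ [])
    Y = fromVertices (x ∷ y ∷ z ∷ [])
    uvw : Distinct (u ∷ v ∷ w ∷ [])
    uvw = let t = proj₂ T in (u≢v t ∷ u≢w t ∷ []) ∷ (v≢w t ∷ []) ∷ [] ∷ []
    ∁X≡Y : ∁ X ≡ Y
    ∁X≡Y = sym (⊆∧∣∣≡⇒≡ Y⊆∁X (ℕₚ.+-cancelˡ-≡ 3 _ _ (begin
      3 + ∣ Y ∣     ≡⟨ cong (3 +_) (∣fromVertices∣ ((x≢y ∷ x≢z ∷ []) ∷ (y≢z ∷ []) ∷ [] ∷ [])) ⟩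
      6             ≡⟨ n≡6 ⟨
      n             ≡⟨ ∣X∣+∣∁X∣ X ⟨
      ∣ X ∣ + ∣ ∁ X ∣ ≡⟨ cong (_+ ∣ ∁ X ∣) (∣fromVertices∣ uvw) ⟩
      3 + ∣ ∁ X ∣   ∎)))
      where
      open ≡-Reasoning
      Y⊆∁X : Y ⊆ ∁ X
      Y⊆∁X {i} i∈Y = x∉p⇒x∈∁p λ i∈X → contradiction i∈Y (∉-fromVertices (x ∷ y ∷ z ∷ []) (apart i i∈X))
        where
        apart : ∀ i → i ∈ X → All (i ≢_) (x ∷ y ∷ z ∷ [])
        apart i i∈X with i Finₚ.≟ u | i Finₚ.≟ v | i Finₚ.≟ w
        ... | yes refl | _ | _ = u≢x ∷ u≢y ∷ u≢z ∷ []
        ... | no _ | yes refl | _ = v≢x ∷ v≢y ∷ v≢z ∷ []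
        ... | no _ | no _ | yes refl = w≢x ∷ w≢y ∷ w≢z ∷ []
        ... | no i≢u | no i≢v | no i≢w =
              contradiction i∈X (∉-fromVertices (u ∷ v ∷ w ∷ []) (i≢u ∷ i≢v ∷ i≢w ∷ []))

  -- Six vertices: two triangles that share a pair make the system cyclic.

  module Six (n≡6 : n ≡ 6) {a b c d : V} where

    6≤n : 6 ≤ n
    6≤n = ℕₚ.≤-reflexive (sym n≡6)

    module _ {p q : V} (abc : Tri a b c) (bcd : Tri b c d) (a≢d : a ≢ d)
             (p∉ : All (p ≢_) (a ∷ b ∷ c ∷ d ∷ [])) (q∉ : All (q ≢_) (a ∷ b ∷ c ∷ d ∷ [])) (p≢q : p ≢ q) where

      private
        a≢b = u≢v (proj₂ abc)
        a≢c = u≢w (proj₂ abc)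
        b≢c = v≢w (proj₂ abc)
        b≢d = u≢w (proj₂ bcd)
        c≢d = v≢w (proj₂ bcd)
        split : ∀ {p} → All (p ≢_) (a ∷ b ∷ c ∷ d ∷ []) → a ≢ p × b ≢ p × c ≢ p × d ≢ p
        split (pa ∷ pb ∷ pc ∷ pd ∷ []) = pa ∘ sym , pb ∘ sym , pc ∘ sym , pd ∘ sym
        a≢p = proj₁ (split p∉)
        b≢p = proj₁ (proj₂ (split p∉))
        c≢p = proj₁ (proj₂ (proj₂ (split p∉)))
        d≢p = proj₂ (proj₂ (proj₂ (split p∉)))
        a≢q = proj₁ (split q∉)
        b≢q = proj₁ (proj₂ (split q∉))
        c≢q = proj₁ (proj₂ (proj₂ (split q∉)))
        d≢q = proj₂ (proj₂ (proj₂ (split q∉)))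

      dpq : Tri d p q
      dpq = complement n≡6 ((a≢b ∷ a≢c ∷ a≢d ∷ a≢p ∷ a≢q ∷ []) ∷ (b≢c ∷ b≢d ∷ b≢p ∷ b≢q ∷ [])
        ∷ (c≢d ∷ c≢p ∷ c≢q ∷ []) ∷ (d≢p ∷ d≢q ∷ []) ∷ (p≢q ∷ []) ∷ [] ∷ []) abc

      apq : Tri a p q
      apq = complement n≡6 ((b≢c ∷ b≢d ∷ (a≢b ∘ sym) ∷ b≢p ∷ b≢q ∷ []) ∷ (c≢d ∷ (a≢c ∘ sym) ∷ c≢p ∷ c≢q ∷ [])
        ∷ ((a≢d ∘ sym) ∷ d≢p ∷ d≢q ∷ []) ∷ (a≢p ∷ a≢q ∷ []) ∷ (p≢q ∷ []) ∷ [] ∷ []) bcd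

      -- In the cyclic order a, c, b, d, p, q only the triple q, a, c is still missing, and it is
      -- the complement of `b d p`.
      six-cycle : Tri b d p → Cyclic L
      six-cycle bdp = path-cycle⇒Cyclic (nth a vs) (λ {i} {j} i<n j<n → nth-injective acbdpq (below i<n) (below j<n))
        edges (λ i e → last-edge i (trans e n≡6)) (λ i e → wrap-edge i (trans e n≡6))
        where
        vs = a ∷ c ∷ b ∷ d ∷ p ∷ q ∷ []
        acbdpq : Distinct vs
        acbdpq = (a≢c ∷ a≢b ∷ a≢d ∷ a≢p ∷ a≢q ∷ []) ∷ ((b≢c ∘ sym) ∷ c≢d ∷ c≢p ∷ c≢q ∷ [])
          ∷ (b≢d ∷ b≢p ∷ b≢q ∷ []) ∷ (d≢p ∷ d≢q ∷ []) ∷ (p≢q ∷ []) ∷ [] ∷ []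
        below : ∀ {i} → i < n → i < 6
        below {i} = subst (i <_) n≡6
        edges : ∀ i → 2 + i < n → Tri (nth a vs i) (nth a vs (1 + i)) (nth a vs (2 + i))
        edges 0 _ = sw abc
        edges 1 _ = sw₁ bcd
        edges 2 _ = bdp
        edges 3 _ = dpq
        edges (suc (suc (suc (suc i)))) h = contradiction (below h) λ { (s≤s (s≤s (s≤s (s≤s (s≤s (s≤s ())))))) }
        last-edge : ∀ i → 2 + i ≡ 6 → Tri (nth a vs i) (nth a vs (1 + i)) a
        last-edge 4 refl = rot apq
        wrap-edge : ∀ i → 1 + i ≡ 6 → Tri (nth a vs i) a c
        wrap-edge 5 refl = rot (rot (complement n≡6 ((b≢d ∷ b≢p ∷ (a≢b ∘ sym) ∷ b≢c ∷ b≢q ∷ [])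
          ∷ (d≢p ∷ (a≢d ∘ sym) ∷ (c≢d ∘ sym) ∷ d≢q ∷ []) ∷ ((a≢p ∘ sym) ∷ (c≢p ∘ sym) ∷ p≢q ∷ [])
          ∷ (a≢c ∷ a≢q ∷ []) ∷ (c≢q ∷ []) ∷ [] ∷ []) bdp))

      -- Its complement `a c d` would be a third triangle on a, b, c, d.
      no-bpq : ¬ Tri b p q
      no-bpq bpq = three-of-four 6≤n (sw₁ bcd) (sw abc) (complement n≡6 (
        (b≢p ∷ b≢q ∷ (a≢b ∘ sym) ∷ b≢c ∷ b≢d ∷ []) ∷ (p≢q ∷ (a≢p ∘ sym) ∷ (c≢p ∘ sym) ∷ (d≢p ∘ sym) ∷ [])
        ∷ ((a≢q ∘ sym) ∷ (c≢q ∘ sym) ∷ (d≢q ∘ sym) ∷ []) ∷ (a≢c ∷ a≢d ∷ []) ∷ (c≢d ∷ []) ∷ [] ∷ []) bpq)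

      -- Four vertices have the connectivity of the remaining two, at most 2, hence dimension at
      -- least 2; `d p q` accounts for only one.
      beyond-dpq : ∃[ y ] (LV (b ∷ d ∷ p ∷ q ∷ []) y × lookup y b ≢ O)
      beyond-dpq = d-step-flat⁻ (fromVertices (d ∷ p ∷ q ∷ [])) b
          (∉-fromVertices (d ∷ p ∷ q ∷ []) (b≢d ∷ b≢p ∷ b≢q ∷ [])) (ℕₚ.≤-trans (s≤s d≤1) 2≤d)
        where
        bdpq : Distinct (b ∷ d ∷ p ∷ q ∷ [])
        bdpq = (b≢d ∷ b≢p ∷ b≢q ∷ []) ∷ (d≢p ∷ d≢q ∷ []) ∷ (p≢q ∷ []) ∷ [] ∷ []
        d≤1 : dV (d ∷ p ∷ q ∷ []) ≤ 1
        d≤1 = ℕₚ.≤-pred (ℕₚ.≤-pred (dependent {d ∷ p ∷ q ∷ []} ((d≢p ∷ d≢q ∷ []) ∷ (p≢q ∷ []) ∷ [] ∷ []) (s≤s (s≤s z≤n)) 5≤n))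
        X = fromVertices (b ∷ d ∷ p ∷ q ∷ [])
        2≤d : 2 ≤ dV (b ∷ d ∷ p ∷ q ∷ [])
        2≤d = ℕₚ.+-cancelˡ-≤ 2 2 _ (begin
          4             ≡⟨ ∣fromVertices∣ bdpq ⟨
          ∣ X ∣         ≡⟨ c+d X ⟨
          C.c X + C.d X     ≤⟨ ℕₚ.+-monoˡ-≤ (C.d X) (begin
            C.c X         ≡⟨ c-symmetric X ⟨
            C.c (∁ X)     ≤⟨ subst (C.c (∁ X) ≤_) (c+d (∁ X)) (ℕₚ.m≤m+n _ _) ⟩
            ∣ ∁ X ∣       ≡⟨ ℕₚ.+-cancelˡ-≡ 4 _ _ (trans (cong (_+ ∣ ∁ X ∣) (sym (∣fromVertices∣ bdpq))) (trans (∣X∣+∣∁X∣ X) n≡6)) ⟩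
            2             ∎) ⟩
          2 + C.d X       ∎)
          where
          open ℕₚ.≤-Reasoning
          module C = Connectivity L sys

      module _ {y} (LVy : LV (b ∷ d ∷ p ∷ q ∷ []) y) (yb : lookup y b ≢ O) where

        private
          w = proj₁ dpq
          W = proj₂ dpq
          wb : lookup w b ≡ O
          wb = off W b b≢d b≢p b≢q

        Reduced : V → Set
        Reduced r = ∃[ z ] (L z × lookup z r ≡ O × lookup z b ≢ O ×
                            (∀ i → i ≢ b → i ≢ d → i ≢ p → i ≢ q → lookup z i ≡ O))

        -- Either `y` vanishes at `r` already, or it agrees with `w` there and the sum vanishes. The
        -- value at `b` survives since `w` is zero there.
        reduce : ∀ r → lookup w r ≢ O → ⟪ lookup y r , lookup w r ⟫K ≡ false → Reduced r
        reduce r wr e = [ keep , add ]′ (⟪⟫K-false⁻ e wr)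
          where
          yO : ∀ i → i ≢ b → i ≢ d → i ≢ p → i ≢ q → lookup y i ≡ O
          yO i i≢b i≢d i≢p i≢q = proj₂ LVy i (∉-fromVertices (b ∷ d ∷ p ∷ q ∷ []) (i≢b ∷ i≢d ∷ i≢p ∷ i≢q ∷ []))
          keep : lookup y r ≡ O → Reduced r
          keep yr = y , proj₁ LVy , yr , yb , yO
          add : lookup y r ≡ lookup w r → Reduced r
          add yr = y ⊕ w , L-⊕ (proj₁ LVy) (inL W) ,
            trans (lookup-⊕ r y w) (trans (cong (_+K lookup w r) yr) (+K-self (lookup w r))) ,
            (λ e → yb (trans (sym (+K-identityʳ _)) (trans (cong (lookup y b +K_) (sym wb)) (trans (sym (lookup-⊕ b y w)) e)))) ,
            λ i i≢b i≢d i≢p i≢q → trans (lookup-⊕ i y w) (cong₂ _+K_ (yO i i≢b i≢d i≢p i≢q) (off W i i≢d i≢p i≢q))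

        restricted : ∀ {r s t} → b ≢ s → b ≢ t → s ≢ t →
          (∀ i → i ≢ r → i ≢ s → i ≢ t → i ≢ d × i ≢ p × i ≢ q) → Reduced r → Tri b s t
        restricted {r} {s} {t} b≢s b≢t s≢t others (z , Lz , zr , zb , h) =
          z , full-triangle b≢s b≢t s≢t (Lz , λ i i∉ → f i (∉-fromVertices⁻ (b ∷ s ∷ t ∷ []) i∉) (i Finₚ.≟ r)) zb
          where
          f : ∀ i → All (i ≢_) (b ∷ s ∷ t ∷ []) → Dec (i ≡ r) → lookup z i ≡ O
          f i _ (yes refl) = zr
          f i (i≢b ∷ i≢s ∷ i≢t ∷ []) (no i≢r) =
            let i≢d , i≢p , i≢q = others i i≢r i≢s i≢t in h i i≢b i≢d i≢p i≢q

        -- By `L-third`, `y` and `w` cannot disagree at all of d, p and q, so one of these can be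
        -- eliminated from `y`. Eliminating `d` would leave the excluded `b p q`.
        third-vertex : Dec (⟪ lookup y p , lookup w p ⟫K ≡ false) → Dec (⟪ lookup y q , lookup w q ⟫K ≡ false) →
                       Tri b d p ⊎ Tri b d q
        third-vertex (yes e) _ = inj₂ (restricted b≢d b≢q d≢q (λ i x y z → y , x , z) (reduce p (at₂ W) e))
        third-vertex (no _) (yes e) = inj₁ (restricted b≢d b≢p d≢p (λ i x y z → y , z , x) (reduce q (at₃ W) e))
        third-vertex (no e) (no e′) = contradiction
          (restricted b≢p b≢q p≢q (λ i x y z → x , y , z) (reduce d (at₁ W)
            (L-third (proj₁ LVy) (inL W) p q d p≢q d≢p d≢q (Boolₚ.¬-not e) (Boolₚ.¬-not e′)
              λ i i≢p i≢q i≢d → ⟪,O⟫K _ (off W i i≢d i≢p i≢q))))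
          no-bpq

      choose : Tri b d p ⊎ Tri b d q
      choose = let y , LVy , yb = beyond-dpq ; w = proj₁ dpq in
        third-vertex LVy yb (⟪ lookup y p , lookup w p ⟫K Boolₚ.≟ false) (⟪ lookup y q , lookup w q ⟫K Boolₚ.≟ false)

    6-cyclic : Tri a b c → Tri b c d → a ≢ d → Cyclic L
    6-cyclic abc@(_ , T) bcd@(_ , S) a≢d = go (nonempty-∣∣ R 1≤R)
      where
      R = ∁ (fromVertices (a ∷ b ∷ c ∷ d ∷ []))
      abcd : Distinct (a ∷ b ∷ c ∷ d ∷ [])
      abcd = (u≢v T ∷ u≢w T ∷ a≢d ∷ []) ∷ (u≢v S ∷ u≢w S ∷ []) ∷ (v≢w S ∷ []) ∷ [] ∷ []
      ∣R∣≡2 : ∣ R ∣ ≡ 2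
      ∣R∣≡2 = ℕₚ.+-cancelˡ-≡ 4 _ _ (trans (cong (_+ ∣ R ∣) (sym (∣fromVertices∣ abcd)))
        (trans (∣X∣+∣∁X∣ (fromVertices (a ∷ b ∷ c ∷ d ∷ []))) n≡6))
      1≤R : 1 ≤ ∣ R ∣
      1≤R = ℕₚ.≤-trans (s≤s z≤n) (ℕₚ.≤-reflexive (sym ∣R∣≡2))
      outside-abcd : ∀ {i} → i ∈ R → All (i ≢_) (a ∷ b ∷ c ∷ d ∷ [])
      outside-abcd i∈R = ∉-fromVertices⁻ (a ∷ b ∷ c ∷ d ∷ []) (x∈∁p⇒x∉p i∈R)
      finish : ∀ {p q} → p ∈ R → q ∈ R → p ≢ q → Cyclic L
      finish p∈ q∈ p≢q = [ six-cycle abc bcd a≢d (outside-abcd p∈) (outside-abcd q∈) p≢q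
                         , six-cycle abc bcd a≢d (outside-abcd q∈) (outside-abcd p∈) (p≢q ∘ sym) ]′
        (choose abc bcd a≢d (outside-abcd p∈) (outside-abcd q∈) p≢q)
      go : Nonempty R → Cyclic L
      go (p , p∈R) with nonempty-∣∣ (R - p) (ℕₚ.≤-pred (ℕₚ.≤-reflexive (trans (sym ∣R∣≡2) (∣remove∣ p∈R))))
      ... | q , q∈ = finish p∈R (proj₁ (∈-remove⁻ R p q∈)) (proj₂ (∈-remove⁻ R p q∈) ∘ sym)

-- Triangles, windmills, tripods and tables

four-colours : ∀ x y z w → x ≢ O → y ≢ O → z ≢ O → w ≢ O → x ≢ y → x ≢ z → y ≢ z →
               w ≢ x → w ≢ y → w ≢ z → Data.Empty.⊥
four-colours = from-yes (∀K? λ x → ∀K? λ y → ∀K? λ z → ∀K? λ w →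
  ¬? (x ≟K O) →-dec (¬? (y ≟K O) →-dec (¬? (z ≟K O) →-dec (¬? (w ≟K O) →-dec (¬? (x ≟K y) →-dec (¬? (x ≟K z) →-dec
  (¬? (y ≟K z) →-dec (¬? (w ≟K x) →-dec (¬? (w ≟K y) →-dec (¬? (w ≟K z) →-dec no (λ ())))))))))))

module _ {n : ℕ} where

  tri⁻ : ∀ {a b c i : Fin n} → i ∈ tri a b c → i ≡ a ⊎ i ≡ b ⊎ i ≡ c
  tri⁻ {a} {b} {c} h with x∈p∪q⁻ ⁅ a ⁆ (⁅ b ⁆ ∪ ⁅ c ⁆) h
  ... | inj₁ p = inj₁ (x∈⁅y⁆⇒x≡y a p)
  ... | inj₂ p with x∈p∪q⁻ ⁅ b ⁆ ⁅ c ⁆ p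
  ...   | inj₁ q = inj₂ (inj₁ (x∈⁅y⁆⇒x≡y b q))
  ...   | inj₂ q = inj₂ (inj₂ (x∈⁅y⁆⇒x≡y c q))

  tri₁ : ∀ {a b c : Fin n} → a ∈ tri a b c
  tri₁ {a} {b} {c} = ∪-inj₁ (⁅ b ⁆ ∪ ⁅ c ⁆) (x∈⁅x⁆ a)

  tri₂ : ∀ {a b c : Fin n} → b ∈ tri a b c
  tri₂ {a} {b} {c} = ∪-inj₂ ⁅ a ⁆ (∪-inj₁ ⁅ c ⁆ (x∈⁅x⁆ b))

  tri₃ : ∀ {a b c : Fin n} → c ∈ tri a b c
  tri₃ {a} {b} {c} = ∪-inj₂ ⁅ a ⁆ (∪-inj₂ ⁅ b ⁆ (x∈⁅x⁆ c))

  tri-⊆ : ∀ {a b c} {X : Subset n} → a ∈ X → b ∈ X → c ∈ X → tri a b c ⊆ X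
  tri-⊆ p q r h = [ (λ { refl → p }) , [ (λ { refl → q }) , (λ { refl → r }) ]′ ]′ (tri⁻ h)

  tri-swap₂₃ : ∀ (a b c : Fin n) → tri a b c ≡ tri a c b
  tri-swap₂₃ a b c = ⊆-antisym (tri-⊆ {X = tri a c b} tri₁ tri₃ tri₂) (tri-⊆ {X = tri a b c} tri₁ tri₃ tri₂)

  tri-rotate : ∀ (a b c : Fin n) → tri a b c ≡ tri b c a
  tri-rotate a b c = ⊆-antisym (tri-⊆ {X = tri b c a} tri₃ tri₁ tri₂) (tri-⊆ {X = tri a b c} tri₂ tri₃ tri₁)

  tri-swap₁₂ : ∀ (a b c : Fin n) → tri a b c ≡ tri b a c
  tri-swap₁₂ a b c = trans (tri-rotate a b c) (tri-swap₂₃ b c a)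

module Hypergraph {m : ℕ} (L : Vec K (suc m) → Set) (sys : IsotropicSystem (suc m) L)
                  (5≤n : 5 ≤ suc m) (tc : ThreeConnected L) where

  open CyclicSystems L sys 5≤n tc public

  E : Subset n → Set
  E = Edge L

  triangle-supp : ∀ {t u v w} → Triangle L t u v w → supp t ≡ tri u v w
  triangle-supp {t} {u} {v} {w} T = ⊆-antisym (λ {i} i∈ → f i i∈ (i Finₚ.≟ u))
      (tri-⊆ {X = supp t} (∈-supp t (at₁ T)) (∈-supp t (at₂ T)) (∈-supp t (at₃ T)))
    where
    f : ∀ i → i ∈ supp t → Dec (i ≡ u) → i ∈ tri u v w
    f i i∈ (yes refl) = tri₁
    f i i∈ (no i≢u) = [ (λ { refl → tri₂ {a = u} }) , (λ { refl → tri₃ {a = u} }) ]′ (corner T (supp-∈ t i∈) i≢u)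

  ∣tri∣ : ∀ {u v w : V} → u ≢ v → u ≢ w → v ≢ w → ∣ tri u v w ∣ ≡ 3
  ∣tri∣ {u} {v} {w} u≢v u≢w v≢w = trans (cong ∣_∣ (⊆-antisym
      (tri-⊆ {X = fromVertices (u ∷ v ∷ w ∷ [])} (∈-fromVertices {vs = u ∷ v ∷ w ∷ []} 0th)
        (∈-fromVertices {vs = u ∷ v ∷ w ∷ []} 1st) (∈-fromVertices {vs = u ∷ v ∷ w ∷ []} 2nd))
      (λ {i} i∈ → f i i∈ (i Finₚ.≟ u) (i Finₚ.≟ v) (i Finₚ.≟ w))))
    (∣fromVertices∣ {vs = u ∷ v ∷ w ∷ []} ((u≢v ∷ u≢w ∷ []) ∷ (v≢w ∷ []) ∷ [] ∷ []))
    where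
    f : ∀ i → i ∈ fromVertices (u ∷ v ∷ w ∷ []) → Dec (i ≡ u) → Dec (i ≡ v) → Dec (i ≡ w) → i ∈ tri u v w
    f i i∈ (yes refl) _ _ = tri₁
    f i i∈ _ (yes refl) _ = tri₂ {a = u}
    f i i∈ _ _ (yes refl) = tri₃ {a = u}
    f i i∈ (no p) (no q) (no r) = contradiction i∈ (∉-fromVertices (u ∷ v ∷ w ∷ []) (p ∷ q ∷ r ∷ []))

  Tri⇒E : ∀ {u v w} → Tri u v w → E (tri u v w)
  Tri⇒E (t , T) = t , inL T , trans (cong ∣_∣ (triangle-supp T)) (∣tri∣ (u≢v T) (u≢w T) (v≢w T)) , triangle-supp T

  edge-at : ∀ {e u} → E e → u ∈ e → ∃[ v ] ∃[ w ] (Tri u v w × e ≡ tri u v w)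
  edge-at {u = u} (t , Lt , ∣t∣ , refl) u∈ with supp-triangle Lt (supp-∈ t u∈) (ℕₚ.≤-reflexive ∣t∣)
  ... | v , w , T = v , w , (t , T) , triangle-supp T

  edge-at₂ : ∀ {e u v} → E e → u ∈ e → v ∈ e → u ≢ v → ∃[ w ] (Tri u v w × e ≡ tri u v w)
  edge-at₂ {u = u} Ee u∈ v∈ u≢v with edge-at Ee u∈
  ... | p , q , T , refl with tri⁻ v∈
  ...   | inj₁ e = contradiction (sym e) u≢v
  ...   | inj₂ (inj₁ refl) = q , T , refl
  ...   | inj₂ (inj₂ refl) = p , sw T , tri-swap₂₃ u p q

  some-vertex : ∀ {e} → E e → ∃[ u ] u ∈ e
  some-vertex {e} (t , Lt , ∣t∣ , refl) = nonempty-∣∣ (supp t) (ℕₚ.≤-trans (s≤s z≤n) (ℕₚ.≤-reflexive (sym ∣t∣)))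

  abstract
    -- A nonzero vector on three vertices is a triangle by `full-triangle`, so a positive dimension
    -- decides. The later searches over configurations of triangles rest on this.
    Tri? : ∀ u v w → Dec (Tri u v w)
    Tri? u v w = map′ to′ (λ (t , T) → u≢v T , u≢w T , v≢w T , 1≤dV T)
      (¬? (u Finₚ.≟ v) ×-dec (¬? (u Finₚ.≟ w) ×-dec (¬? (v Finₚ.≟ w) ×-dec (1 ℕₚ.≤? dV (u ∷ v ∷ w ∷ [])))))
      where
      to′ : u ≢ v × u ≢ w × v ≢ w × 1 ≤ dV (u ∷ v ∷ w ∷ []) → Tri u v w
      to′ (p , q , r , h) with 1≤d⇒nonzero {fromVertices (u ∷ v ∷ w ∷ [])} h
      ... | e , LXe , i , ei = e , full-triangle p q r LXe ei

  share-essential : ∀ {u v p q} → Tri u v p → Tri u v q → p ≢ q → ¬ N u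
  share-essential (t , T) (s , S) p≢q = disagree⇒¬N T S (share₂ T S p≢q)

  clash-essential : ∀ {t s u v w p q} → Triangle L t u v w → Triangle L s u p q → lookup t u ≢ lookup s u → ¬ N v ⊎ ¬ N w
  clash-essential T S t≢s with clash T S t≢s
  ... | i , inj₁ refl , inj₁ refl , d = inj₁ (disagree⇒¬N (swap₁₂ T) (swap₁₂ S) d)
  ... | i , inj₁ refl , inj₂ refl , d = inj₁ (disagree⇒¬N (swap₁₂ T) (rotate (rotate S)) d)
  ... | i , inj₂ refl , inj₁ refl , d = inj₂ (disagree⇒¬N (rotate (rotate T)) (swap₁₂ S) d)
  ... | i , inj₂ refl , inj₂ refl , d = inj₂ (disagree⇒¬N (rotate (rotate T)) (rotate (rotate S)) d)

  triangleEdge : ∀ {e} → E e → InN N e → TriangleEdge E N e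
  triangleEdge {e} Ee inN = Ee , inN , λ e′ Ee′ ∣∩∣≡2 → absurd e′ Ee′ ∣∩∣≡2
    where
    absurd : ∀ e′ → E e′ → ∣ e ∩ e′ ∣ ≢ 2
    absurd e′ Ee′ ∣∩∣≡2 with nonempty-∣∣ (e ∩ e′) (ℕₚ.≤-trans (s≤s z≤n) (ℕₚ.≤-reflexive (sym ∣∩∣≡2)))
    ... | u , u∈ with nonempty-∣∣ ((e ∩ e′) - u) (ℕₚ.≤-pred (ℕₚ.≤-reflexive (trans (sym ∣∩∣≡2) (∣remove∣ u∈))))
    ... | v , v∈ with x∈p∩q⁻ e e′ u∈ | ∈-remove⁻ (e ∩ e′) u v∈
    ... | u∈e , u∈e′ | v∈∩ , v≢u with x∈p∩q⁻ e e′ v∈∩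
    ... | v∈e , v∈e′ with edge-at₂ Ee u∈e v∈e (v≢u ∘ sym) | edge-at₂ Ee′ u∈e′ v∈e′ (v≢u ∘ sym)
    ... | p , T , refl | q , S , refl with p Finₚ.≟ q
    ... | no p≢q = share-essential T S p≢q (inN u u∈e)
    ... | yes refl with () ← trans (sym ∣∩∣≡2) (trans (cong ∣_∣ (⊆-antisym {i = tri u v p ∩ tri u v p} (proj₁ ∘ x∈p∩q⁻ (tri u v p) (tri u v p)) (λ h → x∈p∩q⁺ (h , h))))
                             (let t = proj₂ T in ∣tri∣ (u≢v t) (u≢w t) (v≢w t)))

  windmillEdge : ∀ {v u w} → Tri v u w → ¬ N v → N u → N w → WindmillEdge E N (tri v u w)
  windmillEdge {v} {u} {w} (t , T) ¬Nv Nu Nw =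
    v , (¬Nv , (_ , Tri⇒E (t , T) , tri₁) , blades , meet-in-v) , Tri⇒E (t , T) , tri₁
    where
    -- Were `p` essential too, there would be a triangle with a second value at `v`. Then `T`
    -- disagrees with one of the two at `v`, and `clash-essential` makes `u` or `w` essential.
    tip : ∀ {p q} → Tri v p q → N p
    tip {p} (s , S) = [ id , (λ (¬Np , _) → contradiction S (absurd ¬Np)) ]′ (essential? p)
      where
      absurd : ¬ N p → ¬ Triangle L s v p _
      absurd ¬Np S with tutte-essential S ¬Nv ¬Np
      ... | r , _ , _ , R , r≢s with lookup t v ≟K lookup s v
      ... | no t≢s = [ (λ k → k Nu) , (λ k → k Nw) ]′ (clash-essential T S t≢s)
      ... | yes t≡s = [ (λ k → k Nu) , (λ k → k Nw) ]′ (clash-essential T R λ e → r≢s (trans (sym e) t≡s))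
    tips : ∀ {p q} → Tri v p q → N p × N q
    tips S = tip S , tip (sw S)
    around : ∀ e → E e → v ∈ e → ∀ i → i ∈ e → i ≢ v → N i
    around e Ee v∈ i i∈ i≢v with edge-at₂ Ee v∈ i∈ (i≢v ∘ sym)
    ... | q , S , _ = tip S
    blades : ∀ e → E e → v ∈ e → InN N (e ∩ ∁ ⁅ v ⁆) × (∀ e′ → E e′ → (e ∩ ∁ ⁅ v ⁆) ⊆ e′ → e′ ≡ e)
    blades e Ee v∈ = (λ i i∈ → let p , q = x∈p∩q⁻ e (∁ ⁅ v ⁆) i∈ in
        around e Ee v∈ i p λ { refl → x∈∁p⇒x∉p q (x∈⁅x⁆ v) }) , unique
      where
      unique : ∀ e′ → E e′ → (e ∩ ∁ ⁅ v ⁆) ⊆ e′ → e′ ≡ e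
      unique e′ Ee′ ⊆e′ with edge-at Ee v∈
      ... | p , q , S , refl with S | edge-at₂ Ee′ (⊆e′ (x∈p∩q⁺ (tri₂ {a = v} , x∉p⇒x∈∁p (x≢y⇒x∉⁅y⁆ (u≢v (proj₂ S) ∘ sym)))))
                                                  (⊆e′ (x∈p∩q⁺ (tri₃ {a = v} , x∉p⇒x∈∁p (x≢y⇒x∉⁅y⁆ (u≢w (proj₂ S) ∘ sym))))) (v≢w (proj₂ S))
      ... | _ | r , R , refl with v Finₚ.≟ r
      ... | yes refl = sym (tri-rotate v p q)
      ... | no v≢r = contradiction (proj₁ (tips S)) (share-essential (rot S) R v≢r)
    meet-in-v : ∀ e e′ → E e → E e′ → v ∈ e → v ∈ e′ → e ≢ e′ → e ∩ e′ ≡ ⁅ v ⁆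
    meet-in-v e e′ Ee Ee′ v∈ v∈′ e≢e′ = ⊆-antisym (λ {i} i∈ → only-v i i∈ (i Finₚ.≟ v))
        (λ i∈ → case-v (x∈⁅y⁆⇒x≡y v i∈))
      where
      case-v : ∀ {i} → i ≡ v → i ∈ e ∩ e′
      case-v refl = x∈p∩q⁺ (v∈ , v∈′)
      only-v : ∀ i → i ∈ e ∩ e′ → Dec (i ≡ v) → i ∈ ⁅ v ⁆
      only-v i _ (yes refl) = x∈⁅x⁆ v
      only-v i i∈ (no i≢v) with x∈p∩q⁻ e e′ i∈
      ... | i∈e , i∈e′ with edge-at₂ Ee v∈ i∈e (i≢v ∘ sym) | edge-at₂ Ee′ v∈′ i∈e′ (i≢v ∘ sym)
      ... | p , S , refl | q , R , refl with p Finₚ.≟ q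
      ... | yes refl = contradiction refl e≢e′
      ... | no p≢q = contradiction (tip S) (share-essential (sw₁ S) (sw₁ R) p≢q)

  record Trip (v w : V) : Set where
    constructor trip
    field
      x y z : V
      x≢y : x ≢ y
      x≢z : x ≢ z
      y≢z : y ≢ z
      vwx : Tri v w x
      vwy : Tri v w y
      vwz : Tri v w z

  record Tab (p q r : V) : Set where
    constructor tab
    field
      x y z : V
      pqr : Tri p q r
      pqx : Tri p q x
      qry : Tri q r y
      prz : Tri p r z
      x≢r : x ≢ r
      y≢p : y ≢ p
      z≢q : z ≢ q

  -- These are the centres of tripods and tables. At any other vertex `h`, a pair containing `h`
  -- lies in at most two edges.
  Special : V → Set
  Special v = (∃[ w ] Trip v w) ⊎ (∃[ q ] ∃[ r ] Tab v q r)

  abstract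
    special? : ∀ v → Dec (Special v)
    special? v = Finₚ.any? (λ w → trip? w) ⊎-dec Finₚ.any? (λ q → Finₚ.any? λ r → tab? q r)
      where
      trip? : ∀ w → Dec (Trip v w)
      trip? w = map′ (λ (a , b , c , p , q , r , x , y , z) → trip a b c p q r x y z)
                     (λ { (trip a b c p q r x y z) → a , b , c , p , q , r , x , y , z })
        (Finₚ.any? λ a → Finₚ.any? λ b → Finₚ.any? λ c → ¬? (a Finₚ.≟ b) ×-dec (¬? (a Finₚ.≟ c) ×-dec (¬? (b Finₚ.≟ c)
          ×-dec (Tri? v w a ×-dec (Tri? v w b ×-dec Tri? v w c)))))
      tab? : ∀ q r → Dec (Tab v q r)
      tab? q r = map′ (λ (a , b , c , f , x , y , z , i , j , k) → tab a b c f x y z i j k)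
                      (λ { (tab a b c f x y z i j k) → a , b , c , f , x , y , z , i , j , k })
        (Finₚ.any? λ a → Finₚ.any? λ b → Finₚ.any? λ c → Tri? v q r ×-dec (Tri? v q a ×-dec (Tri? q r b
          ×-dec (Tri? v r c ×-dec (¬? (a Finₚ.≟ r) ×-dec (¬? (b Finₚ.≟ v) ×-dec ¬? (c Finₚ.≟ q)))))))

  trip-sym : ∀ {v w} → Trip v w → Trip w v
  trip-sym (trip a b c p q r x y z) = trip a b c p q r (sw₁ x) (sw₁ y) (sw₁ z)

  tab-rotate : ∀ {p q r} → Tab p q r → Tab q r p
  tab-rotate (tab a b c f x y z i j k) = tab b c a (rot f) y (rot (rot (sw z))) (sw₁ x) j k i

  tab-swap : ∀ {p q r} → Tab p q r → Tab q p r
  tab-swap (tab a b c f x y z i j k) = tab a c b (sw₁ f) (sw₁ x) z y i k j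

  trip-essential : ∀ {v w} → Trip v w → ¬ N v
  trip-essential (trip a b c p q r x y z) = share-essential x y p

  tab-essential : ∀ {p q r} → Tab p q r → ¬ N p
  tab-essential (tab a b c f x y z i j k) = share-essential x f i

  module AtLeastSix (6≤n : 6 ≤ n) where

    -- Avoiding `w`, the triangle `T` must share `x` with one and `y` with the other, so x and y are
    -- p and q, and v, w, p, q carry three triangles.
    two-others : ∀ {v w x y p q t s s′} → Triangle L t v p q → Triangle L s v w x → Triangle L s′ v w y →
      x ≢ y → w ≢ p → w ≢ q → lookup t v ≢ lookup s v → lookup t v ≢ lookup s′ v → Data.Empty.⊥
    two-others {v} {w} {x} {y} {p} {q} {t} T S S′ x≢y w≢p w≢q t≢s t≢s′ = go (hit S t≢s) (hit S′ t≢s′)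
      where
      hit : ∀ {z r} → Triangle L r v w z → lookup t v ≢ lookup r v → z ≡ p ⊎ z ≡ q
      hit R t≢r with clash T R t≢r
      ... | i , h , inj₁ refl , _ = [ (λ e → contradiction e w≢p) , (λ e → contradiction e w≢q) ]′ h
      ... | i , h , inj₂ refl , _ = h
      go : x ≡ p ⊎ x ≡ q → y ≡ p ⊎ y ≡ q → Data.Empty.⊥
      go (inj₁ refl) (inj₁ refl) = x≢y refl
      go (inj₂ refl) (inj₂ refl) = x≢y refl
      go (inj₁ refl) (inj₂ refl) = three-of-four 6≤n (_ , T) (_ , swap₁₂ S) (_ , swap₁₂ S′)
      go (inj₂ refl) (inj₁ refl) = three-of-four 6≤n (_ , T) (_ , swap₁₂ S′) (_ , swap₁₂ S)

    -- The three triangles through `v` and `w` take three different values at `v`, so one avoiding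
    -- `w` disagrees there with at least two of them.
    trip-all : ∀ {v w p q} → Trip v w → Tri v p q → w ≡ p ⊎ w ≡ q
    trip-all {v} {w} {p} {q} (trip a b c a≢b a≢c b≢c (s , A) (s′ , B) (_ , C)) (t , T) with w Finₚ.≟ p | w Finₚ.≟ q
    ... | yes e | _ = inj₁ e
    ... | no _ | yes e = inj₂ e
    ... | no w≢p | no w≢q with lookup t v ≟K lookup s v | lookup t v ≟K lookup s′ v
    ...   | no ≢a | no ≢b = contradiction (two-others T A B a≢b w≢p w≢q ≢a ≢b) λ ()
    ...   | yes ≡a | _ = contradiction (two-others T B C b≢c w≢p w≢q
              (λ e → share₂ A B a≢b (trans (sym ≡a) e)) (λ e → share₂ A C a≢c (trans (sym ≡a) e))) λ ()
    ...   | no ≢a | yes ≡b = contradiction (two-others T A C a≢c w≢p w≢q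
              ≢a (λ e → share₂ B C b≢c (trans (sym ≡b) e))) λ ()

    trip-third : ∀ {v w x} → ((trip a b c _ _ _ _ _ _) : Trip v w) → Tri v w x → x ≡ a ⊎ x ≡ b ⊎ x ≡ c
    trip-third {x = x} (trip a b c a≢b a≢c b≢c (_ , A) (_ , B) (_ , C)) (_ , X)
      with x Finₚ.≟ a | x Finₚ.≟ b | x Finₚ.≟ c
    ... | yes e | _ | _ = inj₁ e
    ... | no _ | yes e | _ = inj₂ (inj₁ e)
    ... | no _ | no _ | yes e = inj₂ (inj₂ e)
    ... | no x≢a | no x≢b | no x≢c = contradiction (four-colours _ _ _ _ (at₁ A) (at₁ B) (at₁ C) (at₁ X)
          (share₂ A B a≢b) (share₂ A C a≢c) (share₂ B C b≢c) (share₂ X A x≢a) (share₂ X B x≢b) (share₂ X C x≢c)) λ ()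

    -- For an essential `a`, `tight` would give an edge containing `a` and exactly one of `v` and
    -- `w`, against `trip-all`.
    trip-end : ∀ {v w a} → Trip v w → Tri v w a → N a
    trip-end {v} {w} {a} P T with essential? a
    ... | inj₁ Na = Na
    ... | inj₂ (¬Na , _) with tight (rot (rot T)) ¬Na (trip-essential P)
    ...   | z , z≢a , z≢v , z≢w , inj₁ S = [ (λ { refl → contradiction refl (v≢w (proj₂ T)) })
              , (λ { refl → contradiction refl z≢w }) ]′ (trip-all P (sw₁ S))
    ...   | z , z≢a , z≢v , z≢w , inj₂ S = [ (λ { refl → contradiction refl (u≢w (proj₂ T)) })
              , (λ { refl → contradiction refl z≢v }) ]′ (trip-all (trip-sym P) (sw₁ S))

    tripodEdge : ∀ {e v w} → Trip v w → E e → v ∈ e → TripodEdge E N e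
    tripodEdge {e} {v} {w} P@(trip a b c a≢b a≢c b≢c A B C) Ee v∈ =
      v , w , (u≢v (proj₂ A) , trip-essential P , trip-essential (trip-sym P)
        , (g , (λ {i} {j} → g-injective i j) , λ e′ → mk⇔ (λ (Ee′ , h) → proj₁ (index Ee′ h) , sym (proj₂ (index Ee′ h)))
                  λ { (i , refl) → Tri⇒E (Gi i) , inj₁ tri₁ })
        , λ e′ Ee′ h → all-in e′ (index Ee′ h)) , Ee , inj₁ v∈
      where
      x : Fin 3 → V
      x 0F = a
      x 1F = b
      x 2F = c
      g : Fin 3 → Subset n
      g i = tri v w (x i)
      Gi : ∀ i → Tri v w (x i)
      Gi 0F = A
      Gi 1F = B
      Gi 2F = C
      x-injective : ∀ i j → x i ≡ x j → i ≡ j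
      x-injective 0F 0F _ = refl
      x-injective 0F 1F e = contradiction e a≢b
      x-injective 0F 2F e = contradiction e a≢c
      x-injective 1F 0F e = contradiction (sym e) a≢b
      x-injective 1F 1F _ = refl
      x-injective 1F 2F e = contradiction e b≢c
      x-injective 2F 0F e = contradiction (sym e) a≢c
      x-injective 2F 1F e = contradiction (sym e) b≢c
      x-injective 2F 2F _ = refl
      g-injective : ∀ i j → g i ≡ g j → i ≡ j
      g-injective i j e with tri⁻ (subst (x i ∈_) e (tri₃ {a = v} {w}))
      ... | inj₁ p = contradiction (sym p) (u≢w (proj₂ (Gi i)))
      ... | inj₂ (inj₁ p) = contradiction (sym p) (v≢w (proj₂ (Gi i)))
      ... | inj₂ (inj₂ p) = x-injective i j p
      third : ∀ {y} → Tri v w y → ∃[ i ] tri v w y ≡ g i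
      third S = [ (λ { refl → 0F , refl }) , [ (λ { refl → 1F , refl }) , (λ { refl → 2F , refl }) ]′ ]′ (trip-third P S)
      index : ∀ {e′} → E e′ → v ∈ e′ ⊎ w ∈ e′ → ∃[ i ] e′ ≡ g i
      index {e′} Ee′ (inj₁ v∈) with edge-at Ee′ v∈
      ... | p , q , S , refl with trip-all P S
      ...   | inj₁ refl = third S
      ...   | inj₂ refl = let i , h = third (sw S) in i , trans (tri-swap₂₃ v p q) h
      index {e′} Ee′ (inj₂ w∈) with edge-at Ee′ w∈
      ... | p , q , S , refl with trip-all (trip-sym P) S
      ...   | inj₁ refl = let i , h = third (sw₁ S) in i , trans (tri-swap₁₂ w p q) h
      ...   | inj₂ refl = let i , h = third (rot (rot S)) in i , trans (tri-rotate w p q) (trans (tri-rotate p q w) h)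
      all-in : ∀ e′ → ∃[ i ] e′ ≡ g i → v ∈ e′ × w ∈ e′ × (∀ u → u ∈ e′ → N u ⊎ u ≡ v ⊎ u ≡ w)
      all-in _ (i , refl) = tri₁ , tri₂ {a = v} , λ u u∈ → cls u (tri⁻ u∈)
        where
        cls : ∀ u → u ≡ v ⊎ u ≡ w ⊎ u ≡ x i → N u ⊎ u ≡ v ⊎ u ≡ w
        cls u (inj₁ p) = inj₂ (inj₁ p)
        cls u (inj₂ (inj₁ p)) = inj₂ (inj₂ p)
        cls u (inj₂ (inj₂ refl)) = inj₁ (trip-end P (Gi i))

    tab-no-trip : ∀ {p q r w} → Tab p q r → ¬ Trip p w
    tab-no-trip (tab a b c f x y z a≢r b≢p c≢q) P with trip-all P f
    ... | inj₁ refl = [ (λ e → v≢w (proj₂ f) e) , (λ e → c≢q (sym e)) ]′ (trip-all P z)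
    ... | inj₂ refl = [ (λ e → v≢w (proj₂ f) (sym e)) , (λ e → a≢r (sym e)) ]′ (trip-all P x)

    tab-pair : ∀ {p q r x} → ((tab a _ _ _ _ _ _ _ _ _) : Tab p q r) → Tri p q x → x ≡ r ⊎ x ≡ a
    tab-pair {r = r} {x} t@(tab a b c f A B C a≢r _ _) X with x Finₚ.≟ r | x Finₚ.≟ a
    ... | yes e | _ = inj₁ e
    ... | no _ | yes e = inj₂ e
    ... | no x≢r | no x≢a = contradiction (trip r a x (a≢r ∘ sym) (x≢r ∘ sym) (x≢a ∘ sym) f A X) (tab-no-trip t)

    tab-a≢b : ∀ {p q r} → ((tab a b _ _ _ _ _ _ _ _) : Tab p q r) → a ≢ b
    tab-a≢b (tab a b c f A B C a≢r _ _) refl = three-of-four 6≤n B f A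

  module AtLeastSeven (7≤n : 7 ≤ n) where

    open AtLeastSix (ℕₚ.<⇒≤ 7≤n) public

    data AtTab (q r a c x y : V) : Set where
      qr : x ≡ q → y ≡ r → AtTab q r a c x y
      qa : x ≡ q → y ≡ a → AtTab q r a c x y
      rc : x ≡ r → y ≡ c → AtTab q r a c x y

    -- A triangle at `p` that avoids `q` and `r` agrees with `p q r` there, hence disagrees with
    -- `p q a` and `p r c` and must contain `a` and `c`. That closes a wheel around `p` with rim q,
    -- r, c, a.
    tab-all : ∀ {p q r x y} → ((tab a _ c _ _ _ _ _ _ _) : Tab p q r) → Tri p x y →
              AtTab q r a c x y ⊎ AtTab q r a c y x
    tab-all {p} {q} {r} {x} {y} t@(tab a b c f A B C a≢r b≢p c≢q) X
      with x Finₚ.≟ q | y Finₚ.≟ q | x Finₚ.≟ r | y Finₚ.≟ r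
    ... | yes refl | _ | _ | _ = inj₁ ([ qr refl , qa refl ]′ (tab-pair t X))
    ... | no _ | yes refl | _ | _ = inj₂ ([ qr refl , qa refl ]′ (tab-pair t (sw X)))
    ... | no _ | no _ | yes refl | _ = [ (λ e → inj₂ (qr e refl)) , (λ e → inj₁ (rc refl e)) ]′
            (tab-pair (tab-swap (tab-rotate (tab-rotate t))) X)
    ... | no _ | no _ | no _ | yes refl = [ (λ e → inj₁ (qr e refl)) , (λ e → inj₂ (rc refl e)) ]′
            (tab-pair (tab-swap (tab-rotate (tab-rotate t))) (sw X))
    ... | no x≢q | no y≢q | no x≢r | no y≢r = contradiction wheel id
      where
      tX = proj₁ X
      X≡f : lookup tX p ≡ lookup (proj₁ f) p
      X≡f = agree (proj₂ X) (proj₂ f) x≢q x≢r y≢q y≢r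
      a∈ : a ≡ x ⊎ a ≡ y
      a∈ with clash (proj₂ X) (proj₂ A) (λ e → share₂ (proj₂ A) (proj₂ f) a≢r (trans (sym e) X≡f))
      ... | i , h , inj₁ refl , _ = [ (λ e → contradiction (sym e) x≢q) , (λ e → contradiction (sym e) y≢q) ]′ h
      ... | i , h , inj₂ refl , _ = h
      c∈ : c ≡ x ⊎ c ≡ y
      c∈ with clash (proj₂ X) (proj₂ C) (λ e → share₂ (proj₂ C) (swap₂₃ (proj₂ f)) c≢q (trans (sym e) X≡f))
      ... | i , h , inj₁ refl , _ = [ (λ e → contradiction (sym e) x≢r) , (λ e → contradiction (sym e) y≢r) ]′ h
      ... | i , h , inj₂ refl , _ = h
      a≢c : a ≢ c
      a≢c = tab-a≢b (tab-swap t)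
      wheel : Data.Empty.⊥
      wheel with a∈ | c∈
      ... | inj₁ refl | inj₁ refl = a≢c refl
      ... | inj₂ refl | inj₂ refl = a≢c refl
      ... | inj₁ refl | inj₂ refl = no-wheel 7≤n f C (sw X) (sw A) (c≢q ∘ sym) (a≢r ∘ sym)
      ... | inj₂ refl | inj₁ refl = no-wheel 7≤n f C X (sw A) (c≢q ∘ sym) (a≢r ∘ sym)

    -- Contrapositively, a triangle through two ordinary vertices has an ordinary third one; this
    -- keeps growing paths free of special vertices.
    special-spreads : ∀ {v p q} → Special v → Tri v p q → Special p ⊎ Special q
    special-spreads (inj₁ (w , P)) T = [ (λ { refl → inj₁ (inj₁ (_ , trip-sym P)) })
                                       , (λ { refl → inj₂ (inj₁ (_ , trip-sym P)) }) ]′ (trip-all P T)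
    special-spreads (inj₂ (q , r , t)) T = [ inj₁ ∘ at , inj₂ ∘ at ]′ (tab-all t T)
      where
      at : ∀ {a c x y} → AtTab q r a c x y → Special x
      at (qr refl _) = inj₂ (_ , _ , tab-rotate t)
      at (qa refl _) = inj₂ (_ , _ , tab-rotate t)
      at (rc refl _) = inj₂ (_ , _ , tab-rotate (tab-rotate t))

    -- For an essential `a`, `tight` would add an edge at `p` or `q` that is missing from the list
    -- in `tab-all`.
    tab-end : ∀ {p q r} → ((tab a _ _ _ _ _ _ _ _ _) : Tab p q r) → N a
    tab-end {p} {q} {r} t@(tab a b c f A B C a≢r b≢p c≢q) with essential? a
    ... | inj₁ Na = Na
    ... | inj₂ (¬Na , _) with tight (rot (rot A)) ¬Na (tab-essential t)
    ...   | z , z≢a , z≢p , z≢q , inj₁ S = contradiction ([ bad , bad′ ]′ (tab-all t (sw₁ S))) id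
            where
            a≢q = v≢w (proj₂ A) ∘ sym
            bad : AtTab q r a c a z → Data.Empty.⊥
            bad (qr e _) = a≢q e
            bad (qa e _) = a≢q e
            bad (rc e _) = a≢r e
            bad′ : AtTab q r a c z a → Data.Empty.⊥
            bad′ (qr _ e) = a≢r e
            bad′ (qa e _) = z≢q e
            bad′ (rc _ e) = tab-a≢b (tab-swap t) e
    ...   | z , z≢a , z≢p , z≢q , inj₂ S = contradiction ([ bad , bad′ ]′ (tab-all (tab-swap t) (sw₁ S))) id
            where
            a≢p = u≢w (proj₂ A) ∘ sym
            bad : AtTab p r a b a z → Data.Empty.⊥
            bad (qr e _) = a≢p e
            bad (qa e _) = a≢p e
            bad (rc e _) = a≢r e
            bad′ : AtTab p r a b z a → Data.Empty.⊥
            bad′ (qr _ e) = a≢r e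
            bad′ (qa e _) = z≢p e
            bad′ (rc _ e) = tab-a≢b t e

    tableEdge : ∀ {e p q r} → Tab p q r → E e → p ∈ e → TableEdge E N e
    tableEdge {e} {p} {q} {r} t@(tab a b c f A B C a≢r b≢p c≢q) Ee p∈ =
      F , (Tri⇒E f , essential , (g , (λ {i} {j} → g-injective i j) , λ e′ → mk⇔
              (λ (Ee′ , h) → let i , eq = index Ee′ h in i , sym eq) (λ { (i , refl) → Tri⇒E (Gi i) , meets i }))
          , (λ e′ Ee′ h → let i , eq = index Ee′ h in
              subst (λ e′ → 2 ≤ ∣ e′ ∩ F ∣ × InN N (e′ ∩ ∁ F)) (sym eq) (2≤meet i , ends i))
          , λ e′ e″ Ee′ h Ee″ h″ e≢ eq → let i , p = index Ee′ h ; j , q = index Ee″ h″ in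
              e≢ (trans p (trans (cong g (rest-injective i j (trans (cong (_∩ ∁ F) (sym p)) (trans eq (cong (_∩ ∁ F) q))))) (sym q))))
        , Ee , (p , x∈p∩q⁺ (p∈ , tri₁))
      where
      F : Subset n
      F = tri p q r
      essential : ∀ u → u ∈ F → ¬ N u
      essential u u∈ = [ (λ { refl → tab-essential t }) , [ (λ { refl → tab-essential (tab-rotate t) })
        , (λ { refl → tab-essential (tab-rotate (tab-rotate t)) }) ]′ ]′ (tri⁻ u∈)
      fst snd last : Fin 4 → V
      fst 0F = p
      fst 1F = p
      fst 2F = q
      fst 3F = p
      snd 0F = q
      snd 1F = q
      snd 2F = r
      snd 3F = r
      last 0F = r
      last 1F = a
      last 2F = b
      last 3F = c
      g : Fin 4 → Subset n
      g i = tri (fst i) (snd i) (last i)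
      Gi : ∀ i → Tri (fst i) (snd i) (last i)
      Gi 0F = f
      Gi 1F = A
      Gi 2F = B
      Gi 3F = C
      fst∈ : ∀ i → fst i ∈ F
      fst∈ 0F = tri₁
      fst∈ 1F = tri₁
      fst∈ 2F = tri₂ {a = p}
      fst∈ 3F = tri₁
      snd∈ : ∀ i → snd i ∈ F
      snd∈ 0F = tri₂ {a = p}
      snd∈ 1F = tri₂ {a = p}
      snd∈ 2F = tri₃ {a = p}
      snd∈ 3F = tri₃ {a = p}
      meets : ∀ i → Nonempty (g i ∩ F)
      meets i = fst i , x∈p∩q⁺ (tri₁ , fst∈ i)
      2≤meet : ∀ i → 2 ≤ ∣ g i ∩ F ∣
      2≤meet i = ∈⇒2≤∣∣ (x∈p∩q⁺ (tri₁ , fst∈ i)) (x∈p∩q⁺ (tri₂ {a = fst i} , snd∈ i)) (u≢v (proj₂ (Gi i)))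
      -- Index `0F` is the central edge itself. Its part outside `F` is empty, which still tells it
      -- apart from the other three edges.
      last∉ : ∀ i → last i ∉ F ⊎ i ≡ 0F
      last∉ 0F = inj₂ refl
      last∉ 1F = inj₁ λ h → [ (λ e → u≢w (proj₂ A) (sym e)) , [ (λ e → v≢w (proj₂ A) (sym e)) , a≢r ]′ ]′ (tri⁻ h)
      last∉ 2F = inj₁ λ h → [ b≢p , [ (λ e → u≢w (proj₂ B) (sym e)) , (λ e → v≢w (proj₂ B) (sym e)) ]′ ]′ (tri⁻ h)
      last∉ 3F = inj₁ λ h → [ (λ e → u≢w (proj₂ C) (sym e)) , [ c≢q , (λ e → v≢w (proj₂ C) (sym e)) ]′ ]′ (tri⁻ h)
      in-rest : ∀ i {u} → u ∈ g i ∩ ∁ F → u ≡ last i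
      in-rest i u∈ with x∈p∩q⁻ (g i) (∁ F) u∈
      ... | u∈g , u∉F with tri⁻ u∈g
      ...   | inj₁ refl = contradiction (fst∈ i) (x∈∁p⇒x∉p u∉F)
      ...   | inj₂ (inj₁ refl) = contradiction (snd∈ i) (x∈∁p⇒x∉p u∉F)
      ...   | inj₂ (inj₂ e) = e
      last∈ : ∀ i → last i ∉ F → last i ∈ g i ∩ ∁ F
      last∈ i h = x∈p∩q⁺ (tri₃ {a = fst i} , x∉p⇒x∈∁p h)
      last-injective : ∀ i j → last i ≡ last j → last i ∉ F → last j ∉ F → i ≡ j
      last-injective 0F _ _ h _ = contradiction (tri₃ {a = p}) h
      last-injective _ 0F _ _ h = contradiction (tri₃ {a = p}) h
      last-injective 1F 1F _ _ _ = refl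
      last-injective 1F 2F e _ _ = contradiction e (tab-a≢b t)
      last-injective 1F 3F e _ _ = contradiction e (tab-a≢b (tab-swap t))
      last-injective 2F 1F e _ _ = contradiction (sym e) (tab-a≢b t)
      last-injective 2F 2F _ _ _ = refl
      last-injective 2F 3F e _ _ = contradiction e (tab-a≢b (tab-rotate t))
      last-injective 3F 1F e _ _ = contradiction (sym e) (tab-a≢b (tab-swap t))
      last-injective 3F 2F e _ _ = contradiction (sym e) (tab-a≢b (tab-rotate t))
      last-injective 3F 3F _ _ _ = refl
      rest-injective : ∀ i j → g i ∩ ∁ F ≡ g j ∩ ∁ F → i ≡ j
      rest-injective i j eq with last∉ i | last∉ j
      ... | inj₂ refl | inj₂ refl = refl
      ... | inj₂ refl | inj₁ h = contradiction
            (subst (_∈ F) (sym (in-rest 0F (subst (last j ∈_) (sym eq) (last∈ j h)))) (tri₃ {a = p})) h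
      ... | inj₁ h | inj₂ refl = contradiction
            (subst (_∈ F) (sym (in-rest 0F (subst (last i ∈_) eq (last∈ i h)))) (tri₃ {a = p})) h
      ... | inj₁ h | inj₁ k = last-injective i j (in-rest j (subst (last i ∈_) eq (last∈ i h))) h k
      g-injective : ∀ i j → g i ≡ g j → i ≡ j
      g-injective i j e = rest-injective i j (cong (_∩ ∁ F) e)
      ends : ∀ i → InN N (g i ∩ ∁ F)
      ends i u u∈ = subst N (sym (in-rest i u∈)) (last-N i (subst (_∉ F) (in-rest i u∈) (x∈∁p⇒x∉p (proj₂ (x∈p∩q⁻ (g i) (∁ F) u∈)))))
        where
        last-N : ∀ i → last i ∉ F → N (last i)
        last-N 0F h = contradiction (tri₃ {a = p}) h
        last-N 1F _ = tab-end t
        last-N 2F _ = tab-end (tab-rotate t)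
        last-N 3F _ = tab-end (tab-swap (tab-rotate (tab-rotate t)))
      at-p : ∀ {x y} → AtTab q r a c x y → ∃[ i ] tri p x y ≡ g i
      at-p (qr refl refl) = 0F , refl
      at-p (qa refl refl) = 1F , refl
      at-p (rc refl refl) = 3F , refl
      at-q : ∀ {x y} → AtTab r p b a x y → ∃[ i ] tri q x y ≡ g i
      at-q (qr refl refl) = 0F , trans (tri-rotate q r p) (tri-rotate r p q)
      at-q (qa refl refl) = 2F , refl
      at-q (rc refl refl) = 1F , tri-swap₁₂ q p a
      at-r : ∀ {x y} → AtTab p q c b x y → ∃[ i ] tri r x y ≡ g i
      at-r (qr refl refl) = 0F , tri-rotate r p q
      at-r (qa refl refl) = 3F , tri-swap₁₂ r p c
      at-r (rc refl refl) = 2F , tri-swap₁₂ r q b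
      flipped : ∀ {u x y} → ∃[ i ] tri u y x ≡ g i → ∃[ i ] tri u x y ≡ g i
      flipped {u} {x} {y} (i , e) = i , trans (tri-swap₂₃ u x y) e
      index : ∀ {e′} → E e′ → Nonempty (e′ ∩ F) → ∃[ i ] e′ ≡ g i
      index {e′} Ee′ (u , u∈) with x∈p∩q⁻ e′ F u∈
      ... | u∈e , u∈F with edge-at Ee′ u∈e
      ...   | x , y , X , refl = [ (λ { refl → [ at-p , flipped ∘ at-p ]′ (tab-all t X) })
              , [ (λ { refl → [ at-q , flipped ∘ at-q ]′ (tab-all (tab-rotate t) X) })
                , (λ { refl → [ at-r , flipped ∘ at-r ]′ (tab-all (tab-rotate (tab-rotate t)) X) }) ]′ ]′ (tri⁻ u∈F)

    special-edge : ∀ {e v} → Special v → E e → v ∈ e → TripodEdge E N e ⊎ TableEdge E N e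
    special-edge (inj₁ (w , P)) Ee v∈ = inj₁ (tripodEdge P Ee v∈)
    special-edge (inj₂ (q , r , t)) Ee v∈ = inj₂ (tableEdge t Ee v∈)

-- Tight paths

module Paths {m : ℕ} (L : Vec K (suc m) → Set) (sys : IsotropicSystem (suc m) L)
             (5≤n : 5 ≤ suc m) (tc : ThreeConnected L) (¬cyclic : ¬ Cyclic L) (7≤n : 7 ≤ suc m) where

  open Hypergraph L sys 5≤n tc
  open AtLeastSeven 7≤n

  no-third : ∀ {h p x y z} → ¬ Special h → Tri h p x → Tri h p y → x ≢ y → Tri h p z → z ≡ x ⊎ z ≡ y
  no-third {x = x} {y} {z} ¬S X Y x≢y Z with z Finₚ.≟ x | z Finₚ.≟ y
  ... | yes e | _ = inj₁ e
  ... | no _ | yes e = inj₂ e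
  ... | no z≢x | no z≢y = contradiction (inj₁ (_ , trip _ _ _ x≢y (z≢x ∘ sym) (z≢y ∘ sym) X Y Z)) ¬S

  data Inner (a b c d x y : V) : Set where
    ab : x ≡ a → y ≡ b → Inner a b c d x y
    bc : x ≡ b → y ≡ c → Inner a b c d x y
    cd : x ≡ c → y ≡ d → Inner a b c d x y

  -- Edges through `b` or `c` are covered by `no-third`. Any other edge at `h` agrees with `b h c`
  -- there, so it disagrees with the two outer triangles, contains `a` and `d`, and closes a wheel.
  inner : ∀ {a b h c d x y} → ¬ Special h → Tri a b h → Tri b h c → Tri h c d → a ≢ c → a ≢ d → b ≢ d →
          Tri h x y → Inner a b c d x y ⊎ Inner a b c d y x
  inner {a} {b} {h} {c} {d} {x} {y} ¬S T₁′ T₂′ T₃ a≢c a≢d b≢d X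
    with x Finₚ.≟ b | y Finₚ.≟ b | x Finₚ.≟ c | y Finₚ.≟ c
  ... | yes refl | _ | _ | _ = [ (λ e → inj₂ (ab e refl)) , (λ e → inj₁ (bc refl e)) ]′
          (no-third ¬S (sw (rot (rot T₁′))) (sw₁ T₂′) a≢c X)
  ... | _ | yes refl | _ | _ = [ (λ e → inj₁ (ab e refl)) , (λ e → inj₂ (bc refl e)) ]′
          (no-third ¬S (sw (rot (rot T₁′))) (sw₁ T₂′) a≢c (sw X))
  ... | _ | _ | yes refl | _ = [ (λ e → inj₂ (bc e refl)) , (λ e → inj₁ (cd refl e)) ]′
          (no-third ¬S (rot T₂′) T₃ b≢d X)
  ... | _ | _ | _ | yes refl = [ (λ e → inj₁ (bc e refl)) , (λ e → inj₂ (cd refl e)) ]′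
          (no-third ¬S (rot T₂′) T₃ b≢d (sw X))
  ... | no x≢b | no y≢b | no x≢c | no y≢c = contradiction (wheel a∈ d∈) id
    where
    T₁ : Tri h b a
    T₁ = sw (rot (rot T₁′))
    T₂ : Tri h b c
    T₂ = sw₁ T₂′
    X≡T₂ : lookup (proj₁ X) h ≡ lookup (proj₁ T₂) h
    X≡T₂ = agree (proj₂ X) (proj₂ T₂) x≢b x≢c y≢b y≢c
    a∈ : a ≡ x ⊎ a ≡ y
    a∈ with clash (proj₂ X) (proj₂ T₁) (λ e → share₂ (proj₂ T₁) (proj₂ T₂) a≢c (trans (sym e) X≡T₂))
    ... | i , p , inj₁ refl , _ = [ (λ e → contradiction (sym e) x≢b) , (λ e → contradiction (sym e) y≢b) ]′ p
    ... | i , p , inj₂ refl , _ = p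
    d∈ : d ≡ x ⊎ d ≡ y
    d∈ with clash (proj₂ X) (proj₂ T₃) (λ e → share₂ (proj₂ T₃) (proj₂ (sw T₂)) (b≢d ∘ sym) (trans (sym e) X≡T₂))
    ... | i , p , inj₁ refl , _ = [ (λ e → contradiction (sym e) x≢c) , (λ e → contradiction (sym e) y≢c) ]′ p
    ... | i , p , inj₂ refl , _ = p
    wheel : a ≡ x ⊎ a ≡ y → d ≡ x ⊎ d ≡ y → Data.Empty.⊥
    wheel (inj₁ refl) (inj₁ e) = a≢d (sym e)
    wheel (inj₂ refl) (inj₂ e) = a≢d (sym e)
    wheel (inj₁ refl) (inj₂ refl) = no-wheel 7≤n (sw T₁) T₂ T₃ (sw X) a≢c b≢d
    wheel (inj₂ refl) (inj₁ refl) = no-wheel 7≤n (sw T₁) T₂ T₃ X a≢c b≢d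

  up : (ℕ → V) → ℕ → List V
  up h zero = []
  up h (suc l) = h l ∷ up h l

  length-up : ∀ h l → length (up h l) ≡ l
  length-up h zero = refl
  length-up h (suc l) = cong suc (length-up h l)

  ∈up : ∀ h {i} l → i < l → h i ∈ˡ up h l
  ∈up h {i} (suc l) (s≤s i≤l) with i ℕₚ.≟ l
  ... | yes refl = here refl
  ... | no i≢l = there (∈up h l (ℕₚ.≤∧≢⇒< i≤l i≢l))

  module Segment (h : ℕ → V) (k : ℕ) (inj : ∀ {i j} → i < k → j < k → h i ≡ h j → i ≡ j)
                 (T : ∀ i → 2 + i < k → Tri (h i) (h (1 + i)) (h (2 + i))) where

    ∉up : ∀ {j} l → l ≤ j → j < k → All (h j ≢_) (up h l)
    ∉up zero _ _ = []
    ∉up (suc l) l<j j<k = (λ e → ℕₚ.<⇒≢ l<j (sym (inj j<k (ℕₚ.<-trans l<j j<k) e))) ∷ ∉up l (ℕₚ.<⇒≤ l<j) j<k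

    distinct-up : ∀ l → l ≤ k → Distinct (up h l)
    distinct-up zero _ = []
    distinct-up (suc l) l<k = ∉up l ℕₚ.≤-refl l<k ∷ distinct-up l (ℕₚ.<⇒≤ l<k)

    ∣up∣ : ∀ l → l ≤ k → ∣ fromVertices (up h l) ∣ ≡ l
    ∣up∣ l l≤k = trans (∣fromVertices∣ (distinct-up l l≤k)) (length-up h l)

    dV-up : ∀ l → 2 + l ≤ k → l ≤ dV (up h (2 + l))
    dV-up zero _ = z≤n
    dV-up (suc l) 3+l≤k = ℕₚ.≤-trans (s≤s (dV-up l (ℕₚ.<⇒≤ 3+l≤k)))
      (dV≥1 (h (2 + l)) (up h (2 + l)) (∉up (2 + l) ℕₚ.≤-refl 3+l≤k)
        (∈LV (up h (3 + l)) (proj₂ (T l 3+l≤k)) 2nd 1st 0th) (at₃ (proj₂ (T l 3+l≤k))))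

  -- Only the values of `g` up to `suc k` matter; indices in `ℕ` reduce prepending and reversing to
  -- plain arithmetic.
  record Path (k : ℕ) (g : ℕ → V) : Set where
    field
      inj : ∀ {i j} → i ≤ suc k → j ≤ suc k → g i ≡ g j → i ≡ j
      edge : ∀ i → i < k → Tri (g i) (g (1 + i)) (g (2 + i))
      plain : ∀ i → i ≤ suc k → ¬ Special (g i)

    apart : ∀ {i j} → i ≤ suc k → j ≤ suc k → i ≢ j → g i ≢ g j
    apart p q i≢j e = i≢j (inj p q e)

    interior : ∀ {x y} i → 2 + i < k → Tri (g (2 + i)) x y →
      Inner (g i) (g (1 + i)) (g (3 + i)) (g (4 + i)) x y ⊎ Inner (g i) (g (1 + i)) (g (3 + i)) (g (4 + i)) y x
    interior i 2+i<k = inner (plain (2 + i) 2+i≤) (edge i (ℕₚ.<-trans (ℕₚ.m<n+m i {2} (s≤s z≤n)) 2+i<k))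
        (edge (1 + i) (ℕₚ.<⇒≤ 2+i<k)) (edge (2 + i) 2+i<k)
        (apart i≤ (ℕₚ.m≤n⇒m≤1+n 2+i<k) λ ()) (apart i≤ (s≤s 2+i<k) λ ())
        (apart (ℕₚ.<⇒≤ 2+i≤) (s≤s 2+i<k) λ ())
      where
      2+i≤ : 2 + i ≤ suc k
      2+i≤ = ℕₚ.m≤n⇒m≤1+n (ℕₚ.<⇒≤ 2+i<k)
      i≤ : i ≤ suc k
      i≤ = ℕₚ.≤-trans (ℕₚ.m≤n+m i 2) 2+i≤

  open Path

  size : ∀ {k g} → Path k g → 2 + k ≤ n
  size {k} {g} P = subst (_≤ n) (S.∣up∣ (2 + k) ℕₚ.≤-refl) (∣p∣≤n (fromVertices (up g (2 + k))))
    where module S = Segment g (2 + k) (λ p q → inj P (ℕₚ.≤-pred p) (ℕₚ.≤-pred q)) (λ i p → edge P i (ℕₚ.≤-pred (ℕₚ.≤-pred p)))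

  -- If a path closes up, then its vertices but the last carry a subspace of codimension at most one,
  -- so the path covers V; by duality the triangle missing from a cycle is there too.
  module Closing {k g} (P : Path (3 + k) g) (C : Tri (g 0) (g 1) (g (4 + k))) where

    module S = Segment g (5 + k) (λ p q → inj P (ℕₚ.≤-pred p) (ℕₚ.≤-pred q))
                       (λ i p → edge P i (ℕₚ.≤-pred (ℕₚ.≤-pred p)))
    module S′ = Segment (g ∘ suc) (4 + k) (λ p q e → ℕₚ.suc-injective (inj P p q e))
                        (λ i p → edge P (suc i) (ℕₚ.≤-pred p))

    T₁ : Tri (g (1 + k)) (g (2 + k)) (g (3 + k))
    T₁ = edge P (1 + k) (ℕₚ.n≤1+n _)
    T₂ : Tri (g (2 + k)) (g (3 + k)) (g (4 + k))
    T₂ = edge P (2 + k) (ℕₚ.n<1+n _)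

    ≤k+4 : ∀ {i} → i ≤ 4 → i + k ≤ 4 + k
    ≤k+4 = ℕₚ.+-monoˡ-≤ k

    0≢ : ∀ {i} → i ≤ 3 → g 0 ≢ g (suc (i + k))
    0≢ h = apart P z≤n (≤k+4 (s≤s h)) λ ()

    1≢ : ∀ {i} → i ≤ 2 → g 1 ≢ g (suc (suc (i + k)))
    1≢ h = apart P (s≤s z≤n) (≤k+4 (s≤s (s≤s h))) λ ()

    -- `C` and `T₂` meet only in the last vertex and agree there, so their sum lives on the earlier
    -- vertices. At `g (3 + k)` it has the value of `T₂`, other than that of `T₁`, so this vertex
    -- adds two dimensions.
    s : Vec K n
    s = proj₁ C ⊕ proj₁ T₂

    cancels : lookup s (g (4 + k)) ≡ O
    cancels = trans (lookup-⊕ _ (proj₁ C) (proj₁ T₂)) (trans (cong (_+K lookup (proj₁ T₂) (g (4 + k)))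
      (agree (rotate (rotate (proj₂ C))) (rotate (rotate (proj₂ T₂)))
        (0≢ (s≤s z≤n)) (0≢ (s≤s (s≤s z≤n))) (1≢ z≤n) (1≢ (s≤s z≤n))))
      (+K-self (lookup (proj₁ T₂) (g (4 + k)))))

    s∈ : LV (up g (4 + k)) s
    s∈ = L-⊕ (inL (proj₂ C)) (inL (proj₂ T₂)) , λ i i∉ → f i (∉-fromVertices⁻ (up g (4 + k)) i∉) (i Finₚ.≟ g (4 + k))
      where
      f : ∀ i → All (i ≢_) (up g (4 + k)) → Dec (i ≡ g (4 + k)) → lookup s i ≡ O
      f i _ (yes refl) = cancels
      f i i≢ (no i≢last) = trans (lookup-⊕ i (proj₁ C) (proj₁ T₂)) (cong₂ _+K_
          (off (proj₂ C) i (not-at (s≤s z≤n)) (not-at (s≤s (s≤s z≤n))) i≢last)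
          (off (proj₂ T₂) i (not-at (ℕₚ.+-monoˡ-≤ k (s≤s (s≤s (s≤s (z≤n {1})))))) (not-at ℕₚ.≤-refl) i≢last))
        where
        not-at : ∀ {j} → j < 4 + k → i ≢ g j
        not-at {j} j< refl = contradiction (∈-fromVertices (∈up g (4 + k) j<)) (∉-fromVertices (up g (4 + k)) i≢)

    at-k : lookup s (g (3 + k)) ≡ lookup (proj₁ T₂) (g (3 + k))
    at-k = trans (lookup-⊕ _ (proj₁ C) (proj₁ T₂)) (cong (_+K lookup (proj₁ T₂) (g (3 + k)))
      (off (proj₂ C) _ (0≢ (s≤s (s≤s z≤n)) ∘ sym) (1≢ (s≤s z≤n) ∘ sym)
        (apart P (ℕₚ.n≤1+n _) ℕₚ.≤-refl (ℕₚ.1+n≢n ∘ sym))))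

    3+k≤d : 3 + k ≤ dV (up g (4 + k))
    3+k≤d = ℕₚ.≤-trans (s≤s (s≤s (S.dV-up (1 + k) (ℕₚ.+-monoˡ-≤ k (s≤s (s≤s (s≤s (z≤n {2}))))))))
      (dV≥2 (g (3 + k)) (up g (3 + k)) (S.∉up (3 + k) ℕₚ.≤-refl (ℕₚ.n≤1+n _))
        (∈LV (up g (4 + k)) (proj₂ T₁) 2nd 1st 0th) s∈ (at₃ (proj₂ T₁))
        (λ e → at₂ (proj₂ T₂) (trans (sym at-k) e))
        λ e → share₂ (rotate (rotate (swap₁₂ (proj₂ T₁)))) (swap₁₂ (proj₂ T₂))
          (apart P (≤k+4 (s≤s z≤n)) ℕₚ.≤-refl (ℕₚ.<⇒≢ (ℕₚ.+-monoˡ-< k {1} {4} (s≤s (s≤s z≤n))))) (trans e at-k))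

    -- Dimension `3 + k` on `4 + k` vertices means connectivity at most 1, so fewer than two
    -- vertices lie outside; `size` is the converse bound.
    n≡ : n ≡ 5 + k
    n≡ = ℕₚ.≤-antisym (ℕₚ.≮⇒≥ λ 5+k<n → ℕₚ.1+n≰n (ℕₚ.≤-trans (s≤s (s≤s 3+k≤d))
        (subst (2 + dV (up g (4 + k)) ≤_) (length-up g (4 + k))
          (dependent {up g (4 + k)} (S.distinct-up (4 + k) (ℕₚ.n≤1+n _))
            (s≤s (s≤s z≤n)) (subst (λ l → 2 + l ≤ n) (sym (length-up g (4 + k))) 5+k<n)))))
      (size P)

    last-triangle : Tri (g (3 + k)) (g (4 + k)) (g 0)
    last-triangle = c≤2⇒Tri k≢k+1 (0≢ (s≤s (s≤s z≤n)) ∘ sym) (0≢ ℕₚ.≤-refl ∘ sym)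
        (subst (_≤ 2) (trans (sym (c-symmetric X)) (cong c ∁X≡Y)) cX≤2)
      where
      k≢k+1 : g (3 + k) ≢ g (4 + k)
      k≢k+1 = apart P (ℕₚ.n≤1+n _) ℕₚ.≤-refl (ℕₚ.1+n≢n ∘ sym)
      X = fromVertices (up (g ∘ suc) (2 + k))
      Y = fromVertices (g (3 + k) ∷ g (4 + k) ∷ g 0 ∷ [])
      2+k≤ : 2 + k ≤ 4 + k
      2+k≤ = ≤k+4 (s≤s (s≤s z≤n))
      ∣X∣ : ∣ X ∣ ≡ 2 + k
      ∣X∣ = S′.∣up∣ (2 + k) 2+k≤
      cX≤2 : c X ≤ 2
      cX≤2 = ℕₚ.+-cancelʳ-≤ k _ _ (ℕₚ.≤-trans (ℕₚ.+-monoʳ-≤ (c X) (S′.dV-up k 2+k≤))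
        (ℕₚ.≤-reflexive (trans (c+d X) ∣X∣)))
      ∁X≡Y : ∁ X ≡ Y
      ∁X≡Y = sym (⊆∧∣∣≡⇒≡ (λ {i} i∈ → x∉p⇒x∈∁p λ i∈X → contradiction i∈
            (∉-fromVertices (g (3 + k) ∷ g (4 + k) ∷ g 0 ∷ []) (on-path i i∈X)))
          (ℕₚ.+-cancelˡ-≡ (2 + k) _ _ (trans (cong (2 + k +_) (∣fromVertices∣ {vs = g (3 + k) ∷ g (4 + k) ∷ g 0 ∷ []}
              ((k≢k+1 ∷ (0≢ (s≤s (s≤s z≤n)) ∘ sym) ∷ []) ∷ ((0≢ ℕₚ.≤-refl ∘ sym) ∷ []) ∷ [] ∷ [])))
            (trans (ℕₚ.+-comm (2 + k) 3) (trans (sym n≡) (trans (sym (∣X∣+∣∁X∣ X)) (cong (_+ ∣ ∁ X ∣) ∣X∣)))))))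
        where
        member : ∀ l {i} → i ∈ fromVertices (up (g ∘ suc) l) → ∃[ j ] (j < l × i ≡ g (suc j))
        member zero i∈ = contradiction i∈ ∉⊥
        member (suc l) i∈ with ∈-insert⁻ (fromVertices (up (g ∘ suc) l)) i∈
        ... | inj₁ p = let j , j<l , e = member l p in j , ℕₚ.m≤n⇒m≤1+n j<l , e
        ... | inj₂ e = l , ℕₚ.≤-refl , e
        on-path : ∀ i → i ∈ X → All (i ≢_) (g (3 + k) ∷ g (4 + k) ∷ g 0 ∷ [])
        on-path i i∈ with member (2 + k) i∈
        ... | j , j< , refl = apart P j≤ (ℕₚ.n≤1+n _) (ℕₚ.<⇒≢ (s≤s j<))
            ∷ apart P j≤ ℕₚ.≤-refl (ℕₚ.<⇒≢ (s≤s (ℕₚ.m≤n⇒m≤1+n j<))) ∷ apart P j≤ z≤n (λ ()) ∷ []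
          where
          j≤ : suc j ≤ 4 + k
          j≤ = ℕₚ.≤-trans j< 2+k≤

    absurd : Data.Empty.⊥
    absurd = ¬cyclic (path-cycle⇒Cyclic g
      (λ {i} {j} p q → inj P (ℕₚ.≤-pred (subst (i <_) n≡ p)) (ℕₚ.≤-pred (subst (j <_) n≡ q)))
      (λ i p → edge P i (ℕₚ.≤-pred (ℕₚ.≤-pred (subst (2 + i <_) n≡ p))))
      (λ i e → subst (λ i → Tri (g i) (g (1 + i)) (g 0)) (sym (ℕₚ.suc-injective (ℕₚ.suc-injective (trans e n≡)))) last-triangle)
      (λ i e → subst (λ i → Tri (g i) (g 0) (g 1)) (sym (ℕₚ.suc-injective (trans e n≡))) (rot (rot C))))

  -- Suppose `z` is a later path vertex. If it is interior, the edges at it listed by `interior` all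
  -- miss `g 0`. If it is the last, the path closes up. If it is the last but one, the edge agrees
  -- with the final triangle and so clashes with the one before, which leaves only k = 3 and three
  -- triangles on four vertices.
  fresh : ∀ {k g z} → Path k g → 2 ≤ k → Tri (g 0) (g 1) z → z ≢ g 2 → ∀ i → i ≤ suc k → z ≢ g i
  fresh P 2≤k Z z≢2 0 _ e = u≢w (proj₂ Z) (sym e)
  fresh P 2≤k Z z≢2 1 _ e = v≢w (proj₂ Z) (sym e)
  fresh P 2≤k Z z≢2 2 _ = z≢2
  fresh {k} {g} P 2≤k Z z≢2 (suc (suc (suc i))) 3+i≤ refl with ℕₚ.<-cmp (3 + i) k
  ... | tri< 3+i<k _ _ = [ first , second ]′ (interior P (1 + i) 3+i<k (rot (rot Z)))
    where
    0≢ : ∀ {j} → suc j ≤ suc k → g 0 ≢ g (suc j)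
    0≢ h = apart P z≤n h λ ()
    5≤ : 5 + i ≤ suc k
    5≤ = s≤s 3+i<k
    4≤ : 4 + i ≤ suc k
    4≤ = ℕₚ.<⇒≤ 5≤
    2≤ : 2 + i ≤ suc k
    2≤ = ℕₚ.<⇒≤ 3+i≤
    first : ¬ Inner (g (1 + i)) (g (2 + i)) (g (4 + i)) (g (5 + i)) (g 0) (g 1)
    first (ab e _) = 0≢ (ℕₚ.<⇒≤ 2≤) e
    first (bc e _) = 0≢ 2≤ e
    first (cd e _) = 0≢ 4≤ e
    second : ¬ Inner (g (1 + i)) (g (2 + i)) (g (4 + i)) (g (5 + i)) (g 1) (g 0)
    second (ab _ e) = 0≢ 2≤ e
    second (bc _ e) = 0≢ 4≤ e
    second (cd _ e) = 0≢ 5≤ e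
  ... | tri> _ _ k<3+i = closed i P Z (ℕₚ.≤-antisym 3+i≤ k<3+i)
    where
    closed : ∀ i {k} → Path k g → Tri (g 0) (g 1) (g (3 + i)) → 3 + i ≡ suc k → Data.Empty.⊥
    closed zero P Z refl = three-of-four (ℕₚ.<⇒≤ 7≤n) (edge P 1 ℕₚ.≤-refl) (edge P 0 (s≤s z≤n)) Z
    closed (suc i) P Z refl = Closing.absurd P Z
  ... | tri≈ _ refl _ = meets
    where
    X : Tri (g (3 + i)) (g 0) (g 1)
    X = rot (rot Z)
    A : Tri (g (3 + i)) (g (2 + i)) (g (1 + i))
    A = sw (rot (rot (edge P (1 + i) (ℕₚ.n≤1+n _))))
    B : Tri (g (3 + i)) (g (2 + i)) (g (4 + i))
    B = sw₁ (edge P (2 + i) ℕₚ.≤-refl)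
    ≤₄ : ∀ {j} → j ≤ 4 → j + i ≤ 4 + i
    ≤₄ = ℕₚ.+-monoˡ-≤ i
    A≢B : lookup (proj₁ A) (g (3 + i)) ≢ lookup (proj₁ B) (g (3 + i))
    A≢B = share₂ (proj₂ A) (proj₂ B) (apart P (≤₄ (s≤s z≤n)) ℕₚ.≤-refl (ℕₚ.<⇒≢ (ℕₚ.+-monoˡ-< i {1} {4} (s≤s (s≤s z≤n)))))
    X≡B : lookup (proj₁ X) (g (3 + i)) ≡ lookup (proj₁ B) (g (3 + i))
    X≡B = agree (proj₂ X) (proj₂ B)
      (apart P z≤n (≤₄ (s≤s (s≤s z≤n))) λ ()) (apart P z≤n ℕₚ.≤-refl λ ())
      (apart P (s≤s z≤n) (≤₄ (s≤s (s≤s z≤n))) λ ()) (apart P (s≤s z≤n) ℕₚ.≤-refl λ ())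
    short : ∀ i → Path (3 + i) g → 0 ≡ i → Tri (g 0) (g 1) (g (3 + i)) → Data.Empty.⊥
    short _ P refl Z = three-of-four (ℕₚ.<⇒≤ 7≤n) (edge P 1 (s≤s (s≤s z≤n))) (edge P 0 (s≤s z≤n)) Z
    meets : Data.Empty.⊥
    meets with clash (proj₂ X) (proj₂ A) (λ e → A≢B (trans (sym e) X≡B))
    ... | _ , inj₁ refl , inj₁ e , _ = apart P z≤n (≤₄ (s≤s (s≤s z≤n))) (λ ()) e
    ... | _ , inj₁ refl , inj₂ e , _ = apart P z≤n (≤₄ (s≤s z≤n)) (λ ()) e
    ... | _ , inj₂ refl , inj₁ e , _ = apart P (s≤s z≤n) (≤₄ (s≤s (s≤s z≤n))) (λ ()) e
    ... | _ , inj₂ refl , inj₂ e , _ = short i P (ℕₚ.suc-injective (inj P (s≤s z≤n) (≤₄ (s≤s z≤n)) e)) Z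

  -- Prepending to paths and reversing them.

  cons : V → (ℕ → V) → ℕ → V
  cons z g zero = z
  cons z g (suc i) = g i

  cons-path : ∀ {k g z} → Path k g → 2 ≤ k → Tri (g 0) (g 1) z → z ≢ g 2 → Path (1 + k) (cons z g)
  cons-path {k} {g} {z} P 2≤k Z z≢2 = record { inj = λ {i} {j} → inj′ i j ; edge = edge′ ; plain = plain′ }
    where
    z∉ = fresh P 2≤k Z z≢2
    inj′ : ∀ i j → i ≤ 2 + k → j ≤ 2 + k → cons z g i ≡ cons z g j → i ≡ j
    inj′ zero zero _ _ _ = refl
    inj′ zero (suc j) _ (s≤s q) e = contradiction e (z∉ j q)
    inj′ (suc i) zero (s≤s p) _ e = contradiction (sym e) (z∉ i p)
    inj′ (suc i) (suc j) (s≤s p) (s≤s q) e = cong suc (inj P p q e)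
    edge′ : ∀ i → i < 1 + k → Tri (cons z g i) (cons z g (1 + i)) (cons z g (2 + i))
    edge′ zero _ = rot (rot Z)
    edge′ (suc i) (s≤s p) = edge P i p
    plain′ : ∀ i → i ≤ 2 + k → ¬ Special (cons z g i)
    plain′ zero _ Sz = [ plain P 0 z≤n , plain P 1 (s≤s z≤n) ]′ (special-spreads Sz (rot (rot Z)))
    plain′ (suc i) (s≤s p) = plain P i p

  rev : ℕ → (ℕ → V) → ℕ → V
  rev k g i = g (suc k ∸ i)

  rev-at : ∀ k g i j → i + j ≡ suc k → rev k g i ≡ g j
  rev-at k g i j e = cong g (trans (cong (_∸ i) (sym e)) (ℕₚ.m+n∸m≡n i j))

  split< : ∀ {i k} → i < k → ∃[ j ] (suc i + j ≡ k)
  split< i<k = ℕₚ.m≤n⇒∃[o]m+o≡n i<k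

  rev-edge-indices : ∀ {i j k} → suc i + j ≡ k → i + (2 + j) ≡ suc k × (1 + i) + (1 + j) ≡ suc k × (2 + i) + j ≡ suc k
  rev-edge-indices {i} {j} refl = trans (ℕₚ.+-suc i (1 + j)) (cong suc (ℕₚ.+-suc i j)) , cong suc (ℕₚ.+-suc i j) , refl

  rev-path : ∀ {k g} → Path k g → Path k (rev k g)
  rev-path {k} {g} P = record
    { inj = λ {i} {j} p q e → ℕₚ.∸-cancelˡ-≡ p q (inj P (ℕₚ.m∸n≤m (suc k) i) (ℕₚ.m∸n≤m (suc k) j) e)
    ; edge = edge′
    ; plain = λ i p → plain P (suc k ∸ i) (ℕₚ.m∸n≤m (suc k) i) }
    where
    put : ∀ {a b c a′ b′ c′} → a ≡ a′ → b ≡ b′ → c ≡ c′ → Tri a′ b′ c′ → Tri a b c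
    put refl refl refl x = x
    edge′ : ∀ i → i < k → Tri (rev k g i) (rev k g (1 + i)) (rev k g (2 + i))
    edge′ i i<k with split< i<k
    ... | j , e = let p , q , r = rev-edge-indices {i} {j} e in
          put (rev-at k g i (2 + j) p) (rev-at k g (1 + i) (1 + j) q) (rev-at k g (2 + i) j r)
            (sw (rot (rot (edge P j (subst (suc j ≤_) e (s≤s (ℕₚ.m≤n+m j i)))))))

  OnPath : ℕ → (ℕ → V) → Subset n → Set
  OnPath k g e = ∃[ j ] (j < k × e ≡ tri (g j) (g (1 + j)) (g (2 + j)))

  OnPath-rev⁻ : ∀ {k g e} → OnPath k (rev k g) e → OnPath k g e
  OnPath-rev⁻ {k} {g} {e} (i , i<k , refl) with split< i<k
  ... | j , eq = let p , q , r = rev-edge-indices {i} {j} eq in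
        j , subst (suc j ≤_) eq (s≤s (ℕₚ.m≤n+m j i)) ,
        trans (cong₂ (λ a (b , c) → tri a b c) (rev-at k g i (2 + j) p)
                (cong₂ _,_ (rev-at k g (1 + i) (1 + j) q) (rev-at k g (2 + i) j r)))
          (trans (tri-rotate _ _ _) (trans (tri-rotate _ _ _) (tri-swap₂₃ _ _ _)))

  OnPath-rev : ∀ {k g e} → OnPath k g e → OnPath k (rev k g) e
  OnPath-rev {k} {g} {e} (i , i<k , refl) with split< i<k
  ... | j , eq = let p , q , r = rev-edge-indices {i} {j} eq in
        j , subst (suc j ≤_) eq (s≤s (ℕₚ.m≤n+m j i)) ,
        trans (trans (tri-rotate _ _ _) (trans (tri-rotate _ _ _) (tri-swap₂₃ _ _ _)))
          (sym (cong₂ (λ a (b , c) → tri a b c) (rev-at k g j (2 + i) (trans (ℕₚ.+-comm j _) (trans (sym (ℕₚ.+-suc (suc i) j) ) (trans (ℕₚ.+-suc (suc i) j) (cong suc eq)))))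
                (cong₂ _,_ (rev-at k g (1 + j) (1 + i) (trans (cong suc (ℕₚ.+-comm j (1 + i))) (cong suc eq)))
                  (rev-at k g (2 + j) i (trans (cong (2 +_) (ℕₚ.+-comm j i)) (cong suc eq))))))

  -- A path with two edges has two orderings, as its middle vertices may be swapped. For k = 2
  -- maximality is therefore also needed in the swapped order, at either end.
  module Front {k g} (P : Path k g) (2≤k : 2 ≤ k)
    (maximal : ∀ z → Tri (g 0) (g 1) z → z ≡ g 2)
    (maximal₂ : k ≡ 2 → ∀ z → Tri (g 0) (g 2) z → z ≡ g 1)
    (maximal₂′ : k ≡ 2 → ∀ z → Tri (g 3) (g 1) z → z ≡ g 2) where

    T₀ : Tri (g 1) (g 2) (g 0)
    T₀ = rot (edge P 0 (ℕₚ.≤-trans (s≤s z≤n) 2≤k))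
    T₁ : Tri (g 1) (g 2) (g 3)
    T₁ = edge P 1 2≤k
    3≤ : 3 ≤ suc k
    3≤ = s≤s 2≤k
    0≢3 : g 0 ≢ g 3
    0≢3 = apart P z≤n 3≤ λ ()

    -- `g 1` is essential, being shared with `g 2` by two edges. If `g 0` were essential too,
    -- `tight` would extend the path, or its swapped form when k = 2, or else add an edge at `g 2`
    -- that `interior` forbids.
    end-N : N (g 0)
    end-N with essential? (g 0)
    ... | inj₁ N0 = N0
    ... | inj₂ (¬N0 , _) with tight (rot (rot T₀)) ¬N0 (share-essential T₀ T₁ 0≢3)
    ...   | z , z≢0 , z≢1 , z≢2 , inj₁ Z = contradiction (maximal z Z) z≢2
    ...   | z , z≢0 , z≢1 , z≢2 , inj₂ Z = contradiction (ℕₚ.m≤n⇒m<n∨m≡n 2≤k) [ long , short ]′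
      where
      short : 2 ≢ k
      short 2≡k = z≢1 (maximal₂ (sym 2≡k) z Z)
      long : ¬ 2 < k
      long 2<k = [ first , second ]′ (interior P 0 2<k (sw₁ Z))
        where
        first : ¬ Inner (g 0) (g 1) (g 3) (g 4) (g 0) z
        first (ab _ e) = z≢1 e
        first (bc e _) = apart P z≤n (s≤s z≤n) (λ ()) e
        first (cd e _) = 0≢3 e
        second : ¬ Inner (g 0) (g 1) (g 3) (g 4) z (g 0)
        second (ab e _) = z≢0 e
        second (bc e _) = z≢1 e
        second (cd _ e) = apart P z≤n (s≤s 2<k) (λ ()) e

    first-edge : OnPath k g (tri (g 1) (g 2) (g 0))
    first-edge = 0 , ℕₚ.≤-trans (s≤s z≤n) 2≤k , sym (tri-rotate (g 0) (g 1) (g 2))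

    second-edge : OnPath k g (tri (g 1) (g 2) (g 3))
    second-edge = 1 , 2≤k , refl

    swapped : ∀ {a b c} → OnPath k g (tri a b c) → OnPath k g (tri a c b)
    swapped {a} {b} {c} (j , j<k , e) = j , j<k , trans (tri-swap₂₃ a c b) e

    via : ∀ {p q} → Tri (g 1) p q → p ≡ g 2 ⊎ p ≡ g 0 ⊎ p ≡ g 3 → OnPath k g (tri (g 1) p q)
    via X (inj₁ refl) = [ (λ { refl → first-edge }) , (λ { refl → second-edge }) ]′
      (no-third (plain P 1 (s≤s z≤n)) T₀ T₁ 0≢3 X)
    via {q = q} X (inj₂ (inj₁ refl)) with maximal q (sw₁ X)
    ... | refl = swapped first-edge
    via {q = q} X (inj₂ (inj₂ refl)) = go (q Finₚ.≟ g 2) (ℕₚ.<-cmp 3 k)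
      where
      go : Dec (q ≡ g 2) → _ → OnPath k g (tri (g 1) (g 3) q)
      go (yes refl) _ = swapped second-edge
      -- With exactly three edges, `q` would complete a table with centre `g 1`, `g 2`, `g 3` and
      -- outer vertices `g 0`, `g 4`, `q`.
      go (no q≢2) (tri≈ _ refl _) = contradiction (inj₂ (_ , _ , tab (g 0) (g 4) q T₁ T₀ (edge P 2 ℕₚ.≤-refl) X
        0≢3 (apart P ℕₚ.≤-refl (s≤s z≤n) λ ()) q≢2)) (plain P 1 (s≤s z≤n))
      go (no q≢2) (tri> _ _ k<3) = contradiction (maximal₂′ (ℕₚ.≤-antisym (ℕₚ.≤-pred k<3) 2≤k) q (sw₁ X)) q≢2
      go (no q≢2) (tri< 3<k _ _) = contradiction ([ first , second ]′ (interior P 1 3<k (sw₁ X))) id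
        where
        1≢ : ∀ {j} → suc (suc j) ≤ suc k → g 1 ≢ g (suc (suc j))
        1≢ h = apart P (s≤s z≤n) h λ ()
        first : ¬ Inner (g 1) (g 2) (g 4) (g 5) (g 1) q
        first (ab _ e) = q≢2 e
        first (bc e _) = 1≢ (ℕₚ.<⇒≤ 3≤) e
        first (cd e _) = 1≢ (ℕₚ.<⇒≤ (s≤s 3<k)) e
        second : ¬ Inner (g 1) (g 2) (g 4) (g 5) q (g 1)
        second (ab _ e) = 1≢ (ℕₚ.<⇒≤ 3≤) e
        second (bc _ e) = 1≢ (ℕₚ.<⇒≤ (s≤s 3<k)) e
        second (cd _ e) = 1≢ (s≤s 3<k) e

    -- `T₀` and `T₁` disagree at `g 1`, so `X` disagrees with one of them and shares another vertex
    -- with it.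
    at-1 : ∀ {x y} → Tri (g 1) x y → OnPath k g (tri (g 1) x y)
    at-1 {x} {y} X = [ via X , (λ h → swapped (via (sw X) h)) ]′ neighbour
      where
      Near : V → Set
      Near p = p ≡ g 2 ⊎ p ≡ g 0 ⊎ p ≡ g 3
      transfer : ∀ {i} → i ≡ x ⊎ i ≡ y → Near i → Near x ⊎ Near y
      transfer (inj₁ refl) h = inj₁ h
      transfer (inj₂ refl) h = inj₂ h
      neighbour : Near x ⊎ Near y
      neighbour with lookup (proj₁ X) (g 1) ≟K lookup (proj₁ T₀) (g 1)
      ... | no d = let i , p , q , _ = clash (proj₂ X) (proj₂ T₀) d in transfer p ([ inj₁ , inj₂ ∘ inj₁ ]′ q)
      ... | yes e = let i , p , q , _ = clash (proj₂ X) (proj₂ T₁) (λ f → share₂ (proj₂ T₀) (proj₂ T₁) 0≢3 (trans (sym e) f))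
                    in transfer p ([ inj₁ , inj₂ ∘ inj₂ ]′ q)

  -- Translation of closed paths with non-essential ends into ears.

  module Ear {k g} (P : Path k g) (2≤k : 2 ≤ k) (N₀ : N (g 0)) (N₁ : N (g (suc k)))
    (closed : ∀ i {x y} → 1 ≤ i → i ≤ k → Tri (g i) x y → OnPath k g (tri (g i) x y)) where

    f : Fin (2 + k) → V
    f = g ∘ toℕ

    T : ℕ → Subset n
    T j = tri (g j) (g (1 + j)) (g (2 + j))

    f-edge : ∀ (j : Fin k) → tri (f (inject₁ (inject₁ j))) (f (inject₁ (suc j))) (f (suc (suc j))) ≡ T (toℕ j)
    f-edge j = cong₂ (λ a b → tri (g a) (g (suc b)) (g (2 + toℕ j)))
      (trans (Finₚ.toℕ-inject₁ (inject₁ j)) (Finₚ.toℕ-inject₁ j)) (Finₚ.toℕ-inject₁ j)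

    PathEdge⇒OnPath : ∀ {e} → PathEdge f e → OnPath k g e
    PathEdge⇒OnPath (j , refl) = toℕ j , Finₚ.toℕ<n j , f-edge j

    OnPath⇒PathEdge : ∀ {e} → OnPath k g e → PathEdge f e
    OnPath⇒PathEdge (j , j<k , refl) = fromℕ< j<k ,
      trans (cong T (sym (Finₚ.toℕ-fromℕ< j<k))) (sym (f-edge (fromℕ< j<k)))

    T-edge : ∀ {j} → j < k → PathEdge f (T j)
    T-edge {j} j<k = OnPath⇒PathEdge (j , j<k , refl)

    in-T : ∀ {i j} → i ≤ suc k → j < k → g i ∈ T j → j ≤ i × i ≤ 2 + j
    in-T {i} {j} i≤ j<k h with tri⁻ h
    ... | inj₁ e with inj P i≤ (ℕₚ.<⇒≤ (ℕₚ.m≤n⇒m≤1+n j<k)) e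
    ...   | refl = ℕₚ.≤-refl , ℕₚ.m≤n+m _ 2
    in-T {i} {j} i≤ j<k h | inj₂ (inj₁ e) with inj P i≤ (ℕₚ.m≤n⇒m≤1+n j<k) e
    ... | refl = ℕₚ.n≤1+n _ , ℕₚ.n≤1+n _
    in-T {i} {j} i≤ j<k h | inj₂ (inj₂ e) with inj P i≤ (s≤s j<k) e
    ... | refl = ℕₚ.m≤n+m _ 2 , ℕₚ.≤-refl

    T-injective : ∀ {i j} → i < k → j < k → T i ≡ T j → i ≡ j
    T-injective {i} {j} i<k j<k e = ℕₚ.≤-antisym
      (proj₁ (in-T (ℕₚ.<⇒≤ (ℕₚ.m≤n⇒m≤1+n j<k)) i<k (subst (g j ∈_) (sym e) tri₁)))
      (proj₁ (in-T (ℕₚ.<⇒≤ (ℕₚ.m≤n⇒m≤1+n i<k)) j<k (subst (g i ∈_) e tri₁)))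

    vertex : ∀ {e v} → PathEdge f e → v ∈ e → ∃[ i ] (i ≤ suc k × v ≡ g i)
    vertex p v∈ with PathEdge⇒OnPath p
    ... | j , j<k , refl with tri⁻ v∈
    ...   | inj₁ e = j , ℕₚ.<⇒≤ (ℕₚ.m≤n⇒m≤1+n j<k) , e
    ...   | inj₂ (inj₁ e) = 1 + j , ℕₚ.m≤n⇒m≤1+n j<k , e
    ...   | inj₂ (inj₂ e) = 2 + j , s≤s j<k , e

    not-end : ∀ i → 1 ≤ i → i ≤ k → ¬ IsEnd (PathEdge f) (g i)
    not-end (suc i) _ i<k (e , _ , _ , unique) = go i i<k λ j<k h → unique _ (T-edge j<k) h
      where
      go : ∀ i → i < k → (∀ {j} → j < k → g (suc i) ∈ T j → T j ≡ e) → Data.Empty.⊥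
      go i i<k at with ℕₚ.m≤n⇒m<n∨m≡n i<k
      ... | inj₁ 1+i<k = ℕₚ.1+n≢n (T-injective 1+i<k i<k (trans (at 1+i<k tri₁) (sym (at i<k (tri₂ {a = g i})))))
      go zero i<k at | inj₂ 1≡k = ℕₚ.<⇒≢ 2≤k 1≡k
      go (suc i) i<k at | inj₂ _ = ℕₚ.1+n≢n (T-injective i<k (ℕₚ.<⇒≤ i<k)
        (trans (at i<k (tri₂ {a = g (suc i)})) (sym (at (ℕₚ.<⇒≤ i<k) (tri₃ {a = g i})))))

    ends-N : ∀ v → IsEnd (PathEdge f) v → N v
    ends-N v end@(e , p , v∈ , _) with vertex p v∈
    ... | zero , _ , refl = N₀
    ... | suc i , 1+i≤ , refl with ℕₚ.m≤n⇒m<n∨m≡n 1+i≤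
    ...   | inj₁ (s≤s i<k) = contradiction end (not-end (suc i) (s≤s z≤n) i<k)
    ...   | inj₂ refl = N₁

    internal : ∀ {v} → IsInternal (PathEdge f) v → ∃[ i ] (1 ≤ i × i ≤ k × v ≡ g i)
    internal {v} (e , e′ , p , p′ , e≢e′ , v∈ , v∈′) with vertex p v∈ | PathEdge⇒OnPath p | PathEdge⇒OnPath p′
    ... | i , i≤ , refl | j , j<k , refl | j′ , j′<k , refl = i , 1≤i , i≤k , refl
      where
      i∈ = in-T i≤ j<k v∈
      i∈′ = in-T i≤ j′<k v∈′
      1≤i : 1 ≤ i
      1≤i with i ℕₚ.≟ 0
      ... | no i≢0 = ℕₚ.n≢0⇒n>0 i≢0
      ... | yes refl = contradiction (cong T (trans (ℕₚ.n≤0⇒n≡0 (proj₁ i∈)) (sym (ℕₚ.n≤0⇒n≡0 (proj₁ i∈′))))) e≢e′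
      i≤k : i ≤ k
      i≤k with ℕₚ.m≤n⇒m<n∨m≡n i≤
      ... | inj₁ (s≤s h) = h
      ... | inj₂ refl = contradiction (cong T (ℕₚ.suc-injective (trans (last j<k (proj₂ i∈)) (sym (last j′<k (proj₂ i∈′)))))) e≢e′
        where
        last : ∀ {j} → j < k → suc k ≤ 2 + j → suc j ≡ k
        last j<k h = ℕₚ.≤-antisym j<k (ℕₚ.≤-pred h)

    internal-essential : ∀ i → 1 ≤ i → i ≤ k → ¬ N (g i)
    internal-essential (suc i) _ i<k with ℕₚ.m≤n⇒m<n∨m≡n i<k
    ... | inj₁ 1+i<k = share-essential (rot (edge P i i<k)) (edge P (1 + i) 1+i<k)
          (apart P (ℕₚ.<⇒≤ (ℕₚ.m≤n⇒m≤1+n i<k)) (s≤s 1+i<k) λ ())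
    internal-essential (suc zero) _ i<k | inj₂ refl = contradiction 2≤k λ { (s≤s ()) }
    internal-essential (suc (suc i)) _ 2+i≤k | inj₂ _ =
      share-essential (sw (rot (rot (edge P i (ℕₚ.<⇒≤ 2+i≤k))))) (sw₁ (edge P (1 + i) 2+i≤k))
        (apart P (ℕₚ.≤-trans (ℕₚ.m≤n+m i 2) (ℕₚ.m≤n⇒m≤1+n 2+i≤k)) (s≤s 2+i≤k) λ ())

    earEdge : ∀ {e} → OnPath k g e → EarEdge E N e
    earEdge on = k , f , 2≤k
      , (λ {i} {j} e → Finₚ.toℕ-injective (inj P (ℕₚ.≤-pred (Finₚ.toℕ<n i)) (ℕₚ.≤-pred (Finₚ.toℕ<n j)) e))
      , (λ e′ p → edge-E (PathEdge⇒OnPath p))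
      , ends-N
      , (λ v h → essential v (internal h))
      , (λ e′ v Ee′ ¬p h v∈ → outside-edge e′ v Ee′ ¬p v∈ (internal h))
      , OnPath⇒PathEdge on
      where
      edge-E : ∀ {e′} → OnPath k g e′ → E e′
      edge-E (j , j<k , refl) = Tri⇒E (edge P j j<k)
      essential : ∀ v → ∃[ i ] (1 ≤ i × i ≤ k × v ≡ g i) → ¬ N v
      essential v (i , p , q , refl) = internal-essential i p q
      outside-edge : ∀ e′ v → E e′ → ¬ PathEdge f e′ → v ∈ e′ → ¬ (∃[ i ] (1 ≤ i × i ≤ k × v ≡ g i))
      outside-edge e′ v Ee′ ¬p v∈ (i , p , q , refl) with edge-at Ee′ v∈
      ... | x , y , X , refl = ¬p (OnPath⇒PathEdge (closed i p q X))

  swap-middle : (ℕ → V) → ℕ → V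
  swap-middle g 1 = g 2
  swap-middle g 2 = g 1
  swap-middle g i = g i

  swap-middle-path : ∀ {g} → Path 2 g → Path 2 (swap-middle g)
  swap-middle-path {g} P = record { inj = λ {i} {j} → inj′ i j ; edge = edge′ ; plain = plain′ }
    where
    π : ℕ → ℕ
    π 1 = 2
    π 2 = 1
    π i = i
    at : ∀ i → swap-middle g i ≡ g (π i)
    at 0 = refl
    at 1 = refl
    at 2 = refl
    at (suc (suc (suc i))) = refl
    π≤ : ∀ i → i ≤ 3 → π i ≤ 3
    π≤ 0 _ = z≤n
    π≤ 1 _ = s≤s (s≤s z≤n)
    π≤ 2 _ = s≤s z≤n
    π≤ (suc (suc (suc i))) h = h
    ππ : ∀ i → π (π i) ≡ i
    ππ 0 = refl
    ππ 1 = refl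
    ππ 2 = refl
    ππ (suc (suc (suc i))) = refl
    inj′ : ∀ i j → i ≤ 3 → j ≤ 3 → swap-middle g i ≡ swap-middle g j → i ≡ j
    inj′ i j p q e = trans (sym (ππ i)) (trans (cong π (inj P (π≤ i p) (π≤ j q)
      (trans (sym (at i)) (trans e (at j))))) (ππ j))
    edge′ : ∀ i → i < 2 → Tri (swap-middle g i) (swap-middle g (1 + i)) (swap-middle g (2 + i))
    edge′ 0 _ = sw (edge P 0 (s≤s z≤n))
    edge′ 1 _ = sw₁ (edge P 1 (s≤s (s≤s z≤n)))
    edge′ (suc (suc i)) (s≤s (s≤s ()))
    plain′ : ∀ i → i ≤ 3 → ¬ Special (swap-middle g i)
    plain′ i p S = plain P (π i) (π≤ i p) (subst Special (at i) S)

  OnPath-swap-middle : ∀ {g e} → OnPath 2 g e → OnPath 2 (swap-middle g) e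
  OnPath-swap-middle (0 , _ , refl) = 0 , s≤s z≤n , tri-swap₂₃ _ _ _
  OnPath-swap-middle (1 , _ , refl) = 1 , s≤s (s≤s z≤n) , tri-swap₁₂ _ _ _
  OnPath-swap-middle (suc (suc i) , s≤s (s≤s ()) , _)

  Longer : ℕ → Subset n → Set
  Longer k e = ∃[ g ] (Path (1 + k) g × OnPath (1 + k) g e)

  lengthen : ∀ {k g e} → Path k g → 2 ≤ k → OnPath k g e → ∃[ z ] (Tri (g 0) (g 1) z × z ≢ g 2) → Longer k e
  lengthen P 2≤k (j , j<k , e) (z , Z , z≢2) = _ , cons-path P 2≤k Z z≢2 , suc j , s≤s j<k , e

  lengthen₂ : ∀ {k g e} → Path k g → k ≡ 2 → OnPath k g e → ∃[ z ] (Tri (g 0) (g 2) z × z ≢ g 1) → Longer k e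
  lengthen₂ P refl on = lengthen (swap-middle-path P) ℕₚ.≤-refl (OnPath-swap-middle on)

  Extension : ℕ → (ℕ → V) → Set
  Extension k g = (∃[ z ] (Tri (g 0) (g 1) z × z ≢ g 2)) ⊎ (k ≡ 2 × ∃[ z ] (Tri (g 0) (g 2) z × z ≢ g 1))

  extension? : ∀ k g → Dec (Extension k g)
  extension? k g = Finₚ.any? (λ z → Tri? (g 0) (g 1) z ×-dec ¬? (z Finₚ.≟ g 2))
    ⊎-dec ((k ℕₚ.≟ 2) ×-dec Finₚ.any? (λ z → Tri? (g 0) (g 2) z ×-dec ¬? (z Finₚ.≟ g 1)))

  extend : ∀ {k g e} → Path k g → 2 ≤ k → OnPath k g e → Extension k g → Longer k e
  extend P 2≤k on (inj₁ x) = lengthen P 2≤k on x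
  extend P 2≤k on (inj₂ (k≡2 , x)) = lengthen₂ P k≡2 on x

  maximal⇒ear : ∀ {k g e} → Path k g → 2 ≤ k → OnPath k g e →
                ¬ Extension k g → ¬ Extension k (rev k g) → EarEdge E N e
  maximal⇒ear {k} {g} P 2≤k on ¬x ¬x′ = Ear.earEdge P 2≤k F.end-N B.end-N closed on
    where
    equal : ∀ {u v w : V} → ¬ (∃[ z ] (Tri u v z × z ≢ w)) → ∀ z → Tri u v z → z ≡ w
    equal {w = w} h z Z with z Finₚ.≟ w
    ... | yes e = e
    ... | no z≢w = contradiction (z , Z , z≢w) h
    R = rev k g
    max : ∀ z → Tri (g 0) (g 1) z → z ≡ g 2
    max = equal (¬x ∘ inj₁)
    max₂ : k ≡ 2 → ∀ z → Tri (g 0) (g 2) z → z ≡ g 1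
    max₂ e = equal λ h → ¬x (inj₂ (e , h))
    max₂′ : k ≡ 2 → ∀ z → Tri (g 3) (g 1) z → z ≡ g 2
    max₂′ refl = equal λ h → ¬x′ (inj₂ (refl , h))
    Rmax : ∀ z → Tri (R 0) (R 1) z → z ≡ R 2
    Rmax = equal (¬x′ ∘ inj₁)
    Rmax₂ : k ≡ 2 → ∀ z → Tri (R 0) (R 2) z → z ≡ R 1
    Rmax₂ e = equal λ h → ¬x′ (inj₂ (e , h))
    Rmax₂′ : k ≡ 2 → ∀ z → Tri (R 3) (R 1) z → z ≡ R 2
    Rmax₂′ refl = equal λ h → ¬x (inj₂ (refl , h))
    module F = Front P 2≤k max max₂ max₂′
    module B = Front (rev-path P) 2≤k Rmax Rmax₂ Rmax₂′
    closed : ∀ i {x y} → 1 ≤ i → i ≤ k → Tri (g i) x y → OnPath k g (tri (g i) x y)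
    closed 1 _ _ X = F.at-1 X
    closed (suc (suc i)) {x} {y} _ 2+i≤k X with ℕₚ.m≤n⇒m<n∨m≡n 2+i≤k
    ... | inj₂ refl = OnPath-rev⁻ (B.at-1 X)
    ... | inj₁ 2+i<k = [ on-path , flipped ∘ on-path ]′ (interior P i 2+i<k X)
      where
      i<k : i < k
      i<k = ℕₚ.<-trans (ℕₚ.m<n+m i {2} (s≤s z≤n)) 2+i<k
      flipped : OnPath k g (tri (g (2 + i)) y x) → OnPath k g (tri (g (2 + i)) x y)
      flipped (j , j<k , e) = j , j<k , trans (tri-swap₂₃ _ _ _) e
      on-path : ∀ {x y} → Inner (g i) (g (1 + i)) (g (3 + i)) (g (4 + i)) x y → OnPath k g (tri (g (2 + i)) x y)
      on-path (ab refl refl) = i , i<k , tri-rotate _ _ _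
      on-path (bc refl refl) = 1 + i , ℕₚ.<⇒≤ 2+i<k , tri-swap₁₂ _ _ _
      on-path (cd refl refl) = 2 + i , 2+i<k , refl

  -- The edge `e` stays on the path while it is lengthened at either end. By `size` a path has fewer
  -- than `n` edges, so the fuel cannot run out.
  path⇒ear : ∀ fuel {k g e} → n ≤ k + fuel → Path k g → 2 ≤ k → OnPath k g e → EarEdge E N e
  path⇒ear zero {k} n≤k P _ _ = contradiction (ℕₚ.≤-trans (size P) (ℕₚ.≤-trans n≤k (ℕₚ.≤-reflexive (ℕₚ.+-identityʳ k))))
    (ℕₚ.<⇒≱ (ℕₚ.n≤1+n _))
  path⇒ear (suc fuel) {k} {g} {e} n≤ P 2≤k on = go (extension? k g) (extension? k (rev k g))
    where
    continue : Longer k e → EarEdge E N e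
    continue (g′ , P′ , on′) = path⇒ear fuel (subst (n ≤_) (ℕₚ.+-suc k fuel) n≤) P′ (ℕₚ.m≤n⇒m≤1+n 2≤k) on′
    go : Dec (Extension k g) → Dec (Extension k (rev k g)) → EarEdge E N e
    go (yes x) _ = continue (extend P 2≤k on x)
    go (no _) (yes x) = continue (extend (rev-path P) 2≤k (OnPath-rev on) x)
    go (no ¬x) (no ¬x′) = maximal⇒ear P 2≤k on ¬x ¬x′

  two-edges : ∀ {a b c d} → Tri a b c → Tri b c d → a ≢ d → (∀ i → ¬ Special (nth a (b ∷ c ∷ d ∷ []) i)) →
              ¬ Special a → Path 2 (nth a (a ∷ b ∷ c ∷ d ∷ []))
  two-edges {a} {b} {c} {d} X Y a≢d plain₁ ¬Sa = record
    { inj = λ p q → nth-injective abcd (s≤s p) (s≤s q) ; edge = edge′ ; plain = plain′ }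
    where
    abcd : Distinct (a ∷ b ∷ c ∷ d ∷ [])
    abcd = let x = proj₂ X ; y = proj₂ Y in
      (u≢v x ∷ u≢w x ∷ a≢d ∷ []) ∷ (u≢v y ∷ u≢w y ∷ []) ∷ (v≢w y ∷ []) ∷ [] ∷ []
    edge′ : ∀ i → i < 2 → Tri (nth a (a ∷ b ∷ c ∷ d ∷ []) i) (nth a (b ∷ c ∷ d ∷ []) i) (nth a (c ∷ d ∷ []) i)
    edge′ 0 _ = X
    edge′ 1 _ = Y
    edge′ (suc (suc i)) (s≤s (s≤s ()))
    plain′ : ∀ i → i ≤ 3 → ¬ Special (nth a (a ∷ b ∷ c ∷ d ∷ []) i)
    plain′ zero _ = ¬Sa
    plain′ (suc i) _ = plain₁ i

  -- Without special vertices, the edge found by `tight` shares a pair with the given one, and the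
  -- two form the initial path.
  two-essential : ∀ {u v w} → Tri u v w → ¬ N u → ¬ N v →
    EarEdge E N (tri u v w) ⊎ TripodEdge E N (tri u v w) ⊎ TableEdge E N (tri u v w)
  two-essential {u} {v} {w} T ¬Nu ¬Nv = by-special (special? u) (special? v) (special? w)
    where
    by-special : Dec (Special u) → Dec (Special v) → Dec (Special w) → _
    by-special (yes S) _ _ = inj₂ (special-edge S (Tri⇒E T) tri₁)
    by-special _ (yes S) _ = inj₂ (special-edge S (Tri⇒E T) (tri₂ {a = u}))
    by-special _ _ (yes S) = inj₂ (special-edge S (Tri⇒E T) (tri₃ {a = u}))
    by-special (no ¬u) (no ¬v) (no ¬w) = inj₁ (ear (tight T ¬Nu ¬Nv))
      where
      spread : ∀ {p q z} → ¬ Special p → ¬ Special q → Tri z p q → ¬ Special z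
      spread ¬p ¬q Z S = [ ¬p , ¬q ]′ (special-spreads S Z)
      plains : ∀ a {b c d} → ¬ Special a → ¬ Special b → ¬ Special c → ¬ Special d → ∀ i → ¬ Special (nth a (b ∷ c ∷ d ∷ []) i)
      plains a ¬a ¬b ¬c ¬d 0 = ¬b
      plains a ¬a ¬b ¬c ¬d 1 = ¬c
      plains a ¬a ¬b ¬c ¬d 2 = ¬d
      plains a ¬a ¬b ¬c ¬d (suc (suc (suc i))) = ¬a
      ear : ∃[ z ] (z ≢ u × z ≢ v × z ≢ w × (Tri u v z ⊎ Tri u w z)) → EarEdge E N (tri u v w)
      ear (z , _ , _ , z≢w , inj₁ Z) = path⇒ear n (ℕₚ.m≤n+m n 2)
        (two-edges (rot (rot T)) Z (z≢w ∘ sym) (plains w ¬w ¬u ¬v (spread ¬u ¬v (rot (rot Z)))) ¬w)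
        ℕₚ.≤-refl (0 , s≤s z≤n , sym (tri-rotate w u v))
      ear (z , _ , z≢v , _ , inj₂ Z) = path⇒ear n (ℕₚ.m≤n+m n 2)
        (two-edges (sw₁ T) Z (z≢v ∘ sym) (plains v ¬v ¬u ¬w (spread ¬u ¬w (rot (rot Z)))) ¬v)
        ℕₚ.≤-refl (0 , s≤s z≤n , tri-swap₁₂ u v w)

-- Classification of an edge by the number of its essential vertices.

module _ {m : ℕ} (L : Vec K (suc m) → Set) (sys : IsotropicSystem (suc m) L)
         (5≤n : 5 ≤ suc m) (tc : ThreeConnected L) (¬cyclic : ¬ Cyclic L) where

  open Hypergraph L sys 5≤n tc

  private
    InStructure : Subset n → Set
    InStructure e = EarEdge E N e ⊎ TriangleEdge E N e ⊎ WindmillEdge E N e ⊎ TripodEdge E N e ⊎ TableEdge E N e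

    -- With five vertices the system is always cyclic; with six, the pair of edges given by `tight`
    -- makes it so.
    two-essential : ∀ {u v w} → Tri u v w → ¬ N u → ¬ N v → InStructure (tri u v w)
    two-essential {u} {v} {w} T ¬Nu ¬Nv with ℕₚ.<-cmp 6 n
    ... | tri< 7≤n _ _ = [ inj₁ , inj₂ ∘ inj₂ ∘ inj₂ ]′
            (Paths.two-essential L sys 5≤n tc ¬cyclic 7≤n T ¬Nu ¬Nv)
    ... | tri> _ _ n<6 = contradiction (5-cyclic (ℕₚ.≤-antisym (ℕₚ.≤-pred n<6) 5≤n)) ¬cyclic
    ... | tri≈ _ 6≡n _ with tight T ¬Nu ¬Nv
    ...   | z , z≢u , z≢v , z≢w , inj₁ Z = contradiction (Six.6-cyclic (sym 6≡n) (rot (rot T)) Z (z≢w ∘ sym)) ¬cyclic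
    ...   | z , z≢u , z≢v , z≢w , inj₂ Z = contradiction (Six.6-cyclic (sym 6≡n) (sw₁ T) Z (z≢v ∘ sym)) ¬cyclic

    all-vertices : ∀ {u v w} → N u → N v → N w → InN N (tri u v w)
    all-vertices Nu Nv Nw i i∈ = [ (λ { refl → Nu }) , [ (λ { refl → Nv }) , (λ { refl → Nw }) ]′ ]′ (tri⁻ i∈)

    classify : ∀ {u v w} → Tri u v w → InStructure (tri u v w)
    classify {u} {v} {w} T with essential? u | essential? v | essential? w
    ... | inj₁ Nu | inj₁ Nv | inj₁ Nw = inj₂ (inj₁ (triangleEdge (Tri⇒E T) (all-vertices Nu Nv Nw)))
    ... | inj₂ (¬Nu , _) | inj₁ Nv | inj₁ Nw = inj₂ (inj₂ (inj₁ (windmillEdge T ¬Nu Nv Nw)))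
    ... | inj₁ Nu | inj₂ (¬Nv , _) | inj₁ Nw =
          subst InStructure (sym (tri-rotate u v w)) (inj₂ (inj₂ (inj₁ (windmillEdge (rot T) ¬Nv Nw Nu))))
    ... | inj₁ Nu | inj₁ Nv | inj₂ (¬Nw , _) =
          subst InStructure (tri-rotate w u v) (inj₂ (inj₂ (inj₁ (windmillEdge (rot (rot T)) ¬Nw Nu Nv))))
    ... | inj₂ (¬Nu , _) | inj₂ (¬Nv , _) | _ = two-essential T ¬Nu ¬Nv
    ... | inj₂ (¬Nu , _) | inj₁ _ | inj₂ (¬Nw , _) =
          subst InStructure (sym (tri-swap₂₃ u v w)) (two-essential (sw T) ¬Nu ¬Nw)
    ... | inj₁ _ | inj₂ (¬Nv , _) | inj₂ (¬Nw , _) =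
          subst InStructure (sym (tri-rotate u v w)) (two-essential (rot T) ¬Nv ¬Nw)

  edge-in-structure : ∀ e → E e → InStructure e
  edge-in-structure e Ee with edge-at Ee (proj₂ (some-vertex Ee))
  ... | v , w , T , e≡ = subst InStructure (sym e≡) (classify T)

theorem4p14 : (n : ℕ) → 5 ≤ n → (L : Vec K n → Set)
    → IsotropicSystem n L → ThreeConnected L → ¬ Cyclic L
    → (e : Subset n)
    → Edge L e ⇔ (EarEdge (Edge L) (NonEssential L) e
    ⊎ TriangleEdge (Edge L) (NonEssential L) e
    ⊎ WindmillEdge (Edge L) (NonEssential L) e
    ⊎ TripodEdge (Edge L) (NonEssential L) e
    ⊎ TableEdge (Edge L) (NonEssential L) e)
-- `NonEssential` unfolds only for a successor, and `5 ≤ n` rules out zero. Conversely, each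
-- structure records that its edges are edges.
theorem4p14 (suc m) 5≤n L sys tc ¬cyclic e = mk⇔ (edge-in-structure L sys 5≤n tc ¬cyclic e) λ where
  (inj₁ (_ , _ , _ , _ , edges , _ , _ , _ , e∈)) → edges e e∈
  (inj₂ (inj₁ (Ee , _))) → Ee
  (inj₂ (inj₂ (inj₁ (_ , _ , Ee , _)))) → Ee
  (inj₂ (inj₂ (inj₂ (inj₁ (_ , _ , _ , Ee , _))))) → Ee
  (inj₂ (inj₂ (inj₂ (inj₂ (_ , _ , Ee , _))))) → Ee
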